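{- For all $u,v\in S_{\mathbb{Z}_+}$, \[\mathrm{FS}(u,v)=\max_{i\le 1+\max(\mathrm{FS}(u),\mathrm{FS}(v))}\bigl(\Lambda_i(u)+\Lambda_i(v)+i-1\bigr),\] the maximum being over integers $i$.
   Context: $S_{\mathbb{Z}_+}$ is the group of permutations of the positive integers fixing all but finitely many (viewed inside bijections of $\mathbb{Z}$ fixing all integers $\le 0$), and $S_n\subseteq S_{\mathbb{Z}_+}$ those fixing all integers $>n$. Schubert structure constants $c_{u,v}^w$ are defined by $\mathfrak{S}_u\mathfrak{S}_v=\sum_w c_{u,v}^w\mathfrak{S}_w$ in terms of Schubert polynomials. For $w\in S_{\mathbb{Z}_+}$, $\mathrm{FS}(w)=\min\{n\ge 1: w\in S_n\}$, and $\mathrm{FS}(u,v)=\max\{\mathrm{FS}(w): c_{u,v}^w\neq 0\}$. For $w$ and $i\in\mathbb{Z}$, $\Lambda_i(w)=|\{j\ge i : \exists j'<j \text{ with } w(j')>w(j)\}|$ (the number of nonzero entries, with index at least $i$, of the dual Lehmer code $\mathrm{dualcode}(w)_j=|\{j'<j: w(j')>w(j)\}|$). -}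

module Defs where

open import Data.Nat as ℕ using (ℕ; zero; suc; _⊔_)
open import Data.Integer as ℤ using (ℤ; +_; -_)
open import Data.Bool using (Bool; true; false; if_then_else_)
open import Data.List using (List; []; _∷_; map; concatMap; upTo; length; foldr)
open import Data.List.Membership.Propositional using (_∈_)
open import Data.List.Relation.Unary.AllPairs using (AllPairs)
open import Data.List.Relation.Unary.Unique.Propositional using (Unique)
open import Data.List.Relation.Binary.Permutation.Propositional using (_↭_)
open import Data.List.Properties using (≡-dec)
open import Data.Maybe using (Maybe; just; nothing)
open import Data.Product using (Σ; ∃; _×_; _,_; proj₁; proj₂)
open import Relation.Binary.PropositionalEquality using (_≡_)
open import Relation.Nullary using (¬_; yes; no)
open import Relation.Nullary.Decidable using (⌊_⌋)
open import Function.Bundles using (_⇔_)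

-- Permutations in S_{Z+}
-- A permutation is given by its one-line notation [w(1),...,w(n)], a
-- list that is a rearrangement of [1..n]; it fixes every integer > n
-- (and every integer ≤ 0).  Different lists (differing by trailing
-- fixed points) may represent the same permutation; equality of
-- permutations is pointwise equality of the underlying maps (_≈ₚ_).

oneToN : ℕ → List ℕ
oneToN n = map suc (upTo n)

record Perm : Set where
  constructor mkPerm
  field
    word   : List ℕ
    isPerm : word ↭ oneToN (length word)
open Perm public

at : List ℕ → ℕ → ℕ → ℕ
at []       i       d = d
at (x ∷ xs) zero    d = d
at (x ∷ xs) (suc zero) d = x
at (x ∷ xs) (suc (suc i)) d = at xs (suc i) d

-- w(i) for positive integers i (and w(0) = 0)
app : Perm → ℕ → ℕ
app w i = at (word w) i i

appℤ : Perm → ℤ → ℤ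
appℤ w (+ suc k) = + app w (suc k)
appℤ w j         = j

_≈ₚ_ : Perm → Perm → Set
u ≈ₚ w = ∀ i → app u i ≡ app w i

-- FS(w) = min { n ≥ 1 : w ∈ S_n } = max (1, largest i with w(i) ≠ i)

lastNonFixed : ℕ → List ℕ → ℕ
lastNonFixed k []       = 0
lastNonFixed k (x ∷ xs) with x ℕ.≟ suc k
... | yes _ = lastNonFixed (suc k) xs
... | no  _ = suc k ⊔ lastNonFixed (suc k) xs

FS : Perm → ℕ
FS w = 1 ⊔ lastNonFixed 0 (word w)

HasInv : Perm → ℤ → Set
HasInv w j = ∃ λ j' → (j' ℤ.< j) × (appℤ w j ℤ.< appℤ w j')

-- IsΛ w i n : the set {j ≥ i : dualcode(w)_j ≠ 0} has exactly n elements
IsΛ : Perm → ℤ → ℕ → Set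
IsΛ w i n = Σ (List ℤ) λ js →
  Unique js × (∀ j → (j ∈ js) ⇔ ((i ℤ.≤ j) × HasInv w j)) × (length js ≡ n)

-- Polynomials in ℤ[x₁, x₂, …]
-- A monomial is an exponent list e (e at index k = exponent of x_{k+1});
-- a polynomial is a finite formal sum of (coefficient, monomial).
-- Two polynomials are equal iff all their coefficients agree.

Mono : Set
Mono = List ℕ

Poly : Set
Poly = List (ℤ × Mono)

stripZeros : Mono → Mono
stripZeros []       = []
stripZeros (e ∷ es) with stripZeros es
... | [] = if ⌊ e ℕ.≟ 0 ⌋ then [] else e ∷ []
... | r  = e ∷ r

coeff : Poly → Mono → ℤ
coeff []            m = + 0
coeff ((c , e) ∷ p) m with ≡-dec ℕ._≟_ (stripZeros e) (stripZeros m)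
... | yes _ = c ℤ.+ coeff p m
... | no  _ = coeff p m

_≈ᴾ_ : Poly → Poly → Set
p ≈ᴾ q = ∀ m → coeff p m ≡ coeff q m

addMono : Mono → Mono → Mono
addMono []       f        = f
addMono e        []       = e
addMono (a ∷ e)  (b ∷ f)  = (a ℕ.+ b) ∷ addMono e f

_*ᴾ_ : Poly → Poly → Poly
p *ᴾ q = concatMap (λ { (c , e) → map (λ { (d , f) → (c ℤ.* d , addMono e f) }) q }) p

scale : ℤ → Poly → Poly
scale c = map (λ { (d , f) → (c ℤ.* d , f) })

expAt : Mono → ℕ → ℕ
expAt []       _       = 0
expAt (a ∷ _)  zero    = a
expAt (_ ∷ e)  (suc i) = expAt e i

setAt : Mono → ℕ → ℕ → Mono
setAt []       zero    v = v ∷ []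
setAt []       (suc i) v = 0 ∷ setAt [] i v
setAt (_ ∷ e)  zero    v = v ∷ e
setAt (a ∷ e)  (suc i) v = a ∷ setAt e i v

-- divided difference ∂_i = (f - s_i f)/(x_i - x_{i+1}), i ≥ 1, on a term;
-- explicit formula  ∂_i(x_i^a x_{i+1}^b) = Σ_{k<a-b} x_i^{a-1-k} x_{i+1}^{b+k}  (a > b),
-- 0 (a = b), and -Σ_{k<b-a} x_i^{b-1-k} x_{i+1}^{a+k} (a < b).
ddTerm : ℕ → ℤ × Mono → Poly
ddTerm i (c , e) with expAt e (i ℕ.∸ 1) | expAt e i
... | a | b with ℕ.compare a b
...   | ℕ.less    a' k = map (λ t → (ℤ.- c , setAt (setAt e (i ℕ.∸ 1) (b ℕ.∸ 1 ℕ.∸ t)) i (a ℕ.+ t))) (upTo (b ℕ.∸ a))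
...   | ℕ.equal   _    = []
...   | ℕ.greater b' k = map (λ t → (c , setAt (setAt e (i ℕ.∸ 1) (a ℕ.∸ 1 ℕ.∸ t)) i (b ℕ.+ t))) (upTo (a ℕ.∸ b))

∂ : ℕ → Poly → Poly
∂ i = concatMap (ddTerm i)

-- Schubert polynomials by divided differences:
-- S_{w₀} = x₁^{n-1} x₂^{n-2} ⋯ x_{n-1}  for the longest w₀ ∈ S_n, and
-- S_w = ∂_i S_{w s_i} whenever w(i) < w(i+1)  (ℓ(w s_i) = ℓ(w) + 1).
-- We always use the smallest ascent i; the fuel n*n exceeds ℓ(w₀),
-- the number of steps needed, so it never runs out.

firstAscent : ℕ → List ℕ → Maybe ℕ
firstAscent k []       = nothing
firstAscent k (x ∷ xs) = go k x xs
  where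
  go : ℕ → ℕ → List ℕ → Maybe ℕ
  go k x []       = nothing
  go k x (y ∷ ys) = if x ℕ.<ᵇ y then just (suc k) else go (suc k) y ys

swapAt : ℕ → List ℕ → List ℕ
swapAt _             []           = []
swapAt _             (x ∷ [])     = x ∷ []
swapAt zero          xs           = xs
swapAt (suc zero)    (x ∷ y ∷ xs) = y ∷ x ∷ xs
swapAt (suc (suc i)) (x ∷ xs)     = x ∷ swapAt (suc i) xs

staircase : ℕ → Mono
staircase n = map (λ k → n ℕ.∸ 1 ℕ.∸ k) (upTo n)

schubAux : ℕ → ℕ → List ℕ → Poly
schubAux n zero       w = []
schubAux n (suc fuel) w with firstAscent 0 w
... | nothing = (+ 1 , staircase n) ∷ []
... | just i  = ∂ i (schubAux n fuel (swapAt i w))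

𝔖 : Perm → Poly
𝔖 w = schubAux (length (word w)) (suc (length (word w) ℕ.* length (word w))) (word w)

-- Schubert structure constants.
-- A Schubert expansion of 𝔖_u 𝔖_v is a finite list of pairwise distinct
-- permutations w with integer coefficients c with 𝔖_u 𝔖_v = Σ c 𝔖_w.
-- (Schubert polynomials form a ℤ-basis, so c_{u,v}^w is the coefficient
-- attached to w in the list, and 0 if w does not occur.)

sumSchub : List (Perm × ℤ) → Poly
sumSchub = concatMap (λ { (w , c) → scale c (𝔖 w) })

IsSchubertExpansion : Perm → Perm → List (Perm × ℤ) → Set
IsSchubertExpansion u v L =
  AllPairs (λ a b → ¬ (proj₁ a ≈ₚ proj₁ b)) L × ((𝔖 u *ᴾ 𝔖 v) ≈ᴾ sumSchub L)

IsFSPair : List (Perm × ℤ) → ℤ → Set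
IsFSPair L M =
  (∃ λ w → ∃ λ c → ((w , c) ∈ L) × (¬ c ≡ + 0) × (+ FS w ≡ M)) ×
  (∀ w c → (w , c) ∈ L → ¬ c ≡ + 0 → + FS w ℤ.≤ M)

IsMaxΛ : Perm → Perm → ℤ → ℤ → Set
IsMaxΛ u v B M =
  (∃ λ i → (i ℤ.≤ B) × ∃ λ a → ∃ λ b → IsΛ u i a × IsΛ v i b ×
      ((+ a ℤ.+ + b ℤ.+ i ℤ.- + 1) ≡ M)) ×
  (∀ i → i ℤ.≤ B → ∀ a b → IsΛ u i a → IsΛ v i b →
      (+ a ℤ.+ + b ℤ.+ i ℤ.- + 1) ℤ.≤ M)

{-# OPTIONS --safe #-}
module Submission where

-- Work with coefficients.  Let Λ′_i(w) be the number of positions > i that are not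
-- left-to-right maxima of w.  Descending from the longest word along first ascents
-- shows deg_{x_i} 𝔖_w ≤ Λ′_i(w); if i is a left-to-right maximum of w, equality holds
-- and the top coefficient in x_i is again a Schubert polynomial in the remaining variables.
-- Taking for i the position of the largest value, this top coefficient is 𝔖 of the
-- permutation with that value deleted, so the 𝔖_w with w ∈ S_n are triangular with
-- respect to these coefficients: they form a basis of the polynomials whose monomials
-- divide x_1^{n-1} x_2^{n-2} ⋯ x_{n-1}.  Hence FS(u,v) is the maximum of
-- deg_{x_i}(𝔖_u 𝔖_v) + i over the i with positive degree, and degrees add in products.
-- The function i ↦ Λ′_i(u) + Λ′_i(v) + i has just increased at its first maximum, so that
-- i is a left-to-right maximum of both u and v, where both degree bounds are attained.

open import Defs
open import Data.Nat using (_⊔_)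
open import Data.Nat as ℕ using (ℕ; zero; suc; _+_; _*_; _∸_; _≤_; _<_; _⊓_; z≤n; s≤s)
open import Data.Nat.Properties
open import Data.Integer using (ℤ; +_)
open import Data.Integer as ℤ using (0ℤ; 1ℤ; -[1+_]; +<+; +≤+; -≤+)
import Data.Integer.Properties as ℤₚ
open import Data.Integer.Tactic.RingSolver using (solve-∀)
open import Data.Bool using (true; false; T)
open import Data.Empty using (⊥)
open import Data.Fin as Fin using (Fin; toℕ; fromℕ; fromℕ<)
open import Data.Fin.Properties using (toℕ<n; toℕ-fromℕ; toℕ-fromℕ<; toℕ-injective)
open import Data.List using (List; []; _∷_; _++_; map; upTo; applyUpTo; length; allFin; cartesianProductWith)
open import Data.List.Properties using (≡-dec; map-applyUpTo; upTo-∷ʳ; map-++; length-++; length-map; length-upTo; ++-identityʳ; ∷-injective)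
open import Data.List.Membership.Propositional using (_∈_)
open import Data.List.Membership.Propositional.Properties using (∈-allFin; ∈-cartesianProductWith⁺; ∈-∃++; ∈-++⁺ʳ; ∈-map⁺; ∈-map⁻)
open import Data.List.Membership.Propositional.Properties.WithK using (unique∧set⇒bag)
open import Data.List.Relation.Binary.BagAndSetEquality using (∼bag⇒↭)
open import Data.List.Relation.Binary.Permutation.Propositional using (_↭_; ↭-refl; ↭-sym; ↭-trans; prep; ↭-reflexive)
open import Data.List.Relation.Binary.Permutation.Propositional.Properties using (∈-resp-↭; ↭-length; drop-mid; ∷↭∷ʳ)
open import Data.List.Relation.Unary.All using () renaming (All to AllL; [] to []ᴬ; _∷_ to _∷ᴬ_)
import Data.List.Relation.Unary.All as LAll
import Data.List.Relation.Unary.All.Properties as LAllₚ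
open import Data.List.Relation.Unary.AllPairs using (AllPairs; []; _∷_)
import Data.List.Relation.Unary.AllPairs as LPairs
import Data.List.Relation.Unary.AllPairs.Properties as LPairsₚ
open import Data.List.Relation.Unary.Any using (here; there)
open import Data.List.Relation.Unary.Unique.Propositional using (Unique)
open import Data.List.Relation.Unary.Unique.Propositional.Properties using (cartesianProductWith⁺; allFin⁺; map⁺)
open import Data.Maybe using (Maybe; just; nothing)
open import Data.Product using (Σ; ∃; _×_; _,_; proj₁; proj₂)
open import Data.Sum using (_⊎_; inj₁; inj₂)
open import Data.Unit using (⊤; tt)
open import Data.Vec using (Vec; []; _∷_; toList)
open import Data.Vec.Properties using (length-toList)
import Data.Vec.Properties as Vecₚ
open import Data.Vec.Relation.Unary.All using (All; []; _∷_)
import Data.Vec.Relation.Unary.All as VAll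
open import Function using (_∘_)
open import Function.Bundles using (mk⇔; Equivalence)
open import Relation.Binary.Definitions using (tri<; tri≈; tri>)
open import Relation.Binary.PropositionalEquality
open import Relation.Nullary using (¬_; yes; no; Dec; contradiction)

-- Coefficient functions and divided differences

-- All inductions run along the single chain of first ascents by which `𝔖` is computed. The relation
-- `Sch` records this chain; since the first ascent of a word is unique, it determines the
-- coefficient function from the word. The obstacle is the word of the top coefficient. It is not w
-- with the entry at i deleted and the rest flattened: 𝔖 of 132 is x_1 + x_2, whose top coefficient
-- in x_1 is 𝔖 of 12, whereas deleting the first entry flattens to 21. The correct word `rem i w`
-- lets the deleted value cascade along the later left-to-right maxima; at the largest value this is
-- plain deletion. A peak may also have degree 0, where no monomial of the product forces a large
-- FS. Only the convention FS ≥ 1 is left there, so such a peak has to be shown to have value 1.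
-- Positions count from 0 in words and from 1 in the statement: `cnt 0 (suc i)` is Λ_{i+2}, and Λ′_i
-- of the overview is Λ_{i+1}.

Fun : ℕ → Set
Fun n = Vec ℕ n → ℤ

Σ≤ : ℕ → (ℕ → ℤ) → ℤ
Σ≤ zero    f = f 0
Σ≤ (suc k) f = f (suc k) ℤ.+ Σ≤ k f

Σ≤-cong : ∀ k {f g} → (∀ q → q ≤ k → f q ≡ g q) → Σ≤ k f ≡ Σ≤ k g
Σ≤-cong zero    h = h 0 z≤n
Σ≤-cong (suc k) h = cong₂ ℤ._+_ (h (suc k) ≤-refl) (Σ≤-cong k (λ q q≤k → h q (m≤n⇒m≤1+n q≤k)))

Σ≤-zero : ∀ k {f} → (∀ q → q ≤ k → f q ≡ 0ℤ) → Σ≤ k f ≡ 0ℤ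
Σ≤-zero zero    h = h 0 z≤n
Σ≤-zero (suc k) h = cong₂ ℤ._+_ (h (suc k) ≤-refl) (Σ≤-zero k (λ q q≤k → h q (m≤n⇒m≤1+n q≤k)))

Σ≤-single : ∀ k {f} p → p ≤ k → (∀ q → q ≤ k → q ≢ p → f q ≡ 0ℤ) → Σ≤ k f ≡ f p
Σ≤-single zero    zero    p≤k h = refl
Σ≤-single (suc k) {f} p p≤k h with p ℕ.≟ suc k
... | yes refl = trans (cong (λ z → f (suc k) ℤ.+ z) (Σ≤-zero k (λ q q≤k → h q (m≤n⇒m≤1+n q≤k) (<⇒≢ (s≤s q≤k)))))
                       (ℤₚ.+-identityʳ _)
... | no p≢    = trans (cong₂ ℤ._+_ (h (suc k) ≤-refl (λ e → p≢ (sym e)))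
                         (Σ≤-single k p (≤-pred (≤∧≢⇒< p≤k p≢)) (λ q q≤k → h q (m≤n⇒m≤1+n q≤k))))
                       (ℤₚ.+-identityˡ _)

+-nonzero : ∀ x y → x ℤ.+ y ≢ 0ℤ → x ≢ 0ℤ ⊎ y ≢ 0ℤ
+-nonzero x y h with x ℤ.≟ 0ℤ
... | no x≢0   = inj₁ x≢0
... | yes refl = inj₂ (λ y≡0 → h (trans (ℤₚ.+-identityˡ y) y≡0))

Σ≤-nonzero : ∀ k f → Σ≤ k f ≢ 0ℤ → ∃ λ q → q ≤ k × f q ≢ 0ℤ
Σ≤-nonzero zero    f h = 0 , z≤n , h
Σ≤-nonzero (suc k) f h with +-nonzero (f (suc k)) (Σ≤ k f) h
... | inj₁ f≢0 = suc k , ≤-refl , f≢0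
... | inj₂ s≢0 with Σ≤-nonzero k f s≢0
...   | q , q≤k , fq = q , m≤n⇒m≤1+n q≤k , fq

-- D k is the divided difference ∂_{k+1} read on coefficients.
D : ∀ {n} → ℕ → Fun n → Fun n
D k       F []          = 0ℤ
D zero    F (a ∷ [])    = 0ℤ
D zero    F (a ∷ b ∷ e) =
  Σ≤ (a ⊓ b) (λ q → F ((suc (a + b) ∸ q) ∷ q ∷ e) ℤ.- F (q ∷ (suc (a + b) ∸ q) ∷ e))
D (suc k) F (x ∷ e)     = D k (λ r → F (x ∷ r)) e

D-cong : ∀ {n} k {F G : Fun n} → (∀ e → F e ≡ G e) → ∀ e → D k F e ≡ D k G e
D-cong k       h []          = refl
D-cong zero    h (a ∷ [])    = refl
D-cong zero    h (a ∷ b ∷ e) = Σ≤-cong (a ⊓ b) (λ q _ → cong₂ ℤ._-_ (h _) (h _))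
D-cong (suc k) h (x ∷ e)     = D-cong k (λ r → h (x ∷ r)) e

ex : ∀ {n} → Vec ℕ n → ℕ → ℕ
ex []      i       = 0
ex (x ∷ e) zero    = x
ex (x ∷ e) (suc i) = ex e i

Deg : ∀ {n} → ℕ → Fun n → ℕ → Set
Deg i F d = ∀ e → F e ≢ 0ℤ → ex e i ≤ d

Deg-zero : ∀ {n} i {F : Fun n} {d} → Deg i F d → ∀ e → d < ex e i → F e ≡ 0ℤ
Deg-zero i {F} h e d< with F e ℤ.≟ 0ℤ
... | yes p = p
... | no p  = contradiction (h e p) (<⇒≱ d<)

-- Words and their chains of first ascents

swap : ∀ {n} → ℕ → Vec ℕ n → Vec ℕ n
swap k       []          = []
swap zero    (x ∷ [])    = x ∷ []
swap zero    (x ∷ y ∷ w) = y ∷ x ∷ w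
swap (suc k) (x ∷ w)     = x ∷ swap k w

-- `there` asks for a descent in front, so k is the first ascent and the entries at 0, ..., k
-- decrease. Hence no position from 1 to k is a left-to-right maximum.
data Asc : ∀ {n} → ℕ → Vec ℕ n → Set where
  here  : ∀ {n x y} {w : Vec ℕ n} → x < y → Asc 0 (x ∷ y ∷ w)
  there : ∀ {n x y k} {w : Vec ℕ n} → y < x → Asc k (y ∷ w) → Asc (suc k) (x ∷ y ∷ w)

data Decr : ∀ {n} → Vec ℕ n → Set where
  []   : Decr []
  [-]  : ∀ {x} → Decr (x ∷ [])
  _∷_  : ∀ {n x y} {w : Vec ℕ n} → y < x → Decr (y ∷ w) → Decr (x ∷ y ∷ w)

stairδ : ∀ {n} → Fun n
stairδ []              = 1ℤ
stairδ {suc n} (x ∷ e) with x ℕ.≟ n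
... | yes _ = stairδ e
... | no  _ = 0ℤ

-- Sch w F: F is the coefficient function of 𝔖_w in n variables, w being any word of n distinct values.
data Sch : ∀ {n} → Vec ℕ n → Fun n → Set where
  top  : ∀ {n} {w : Vec ℕ n} {F} → Decr w → (∀ e → F e ≡ stairδ e) → Sch w F
  step : ∀ {n k} {w : Vec ℕ n} {F G} → Asc k w → Sch (swap k w) G → (∀ e → F e ≡ D k G e) → Sch w F

Sch-cong : ∀ {n} {w : Vec ℕ n} {F G} → (∀ e → G e ≡ F e) → Sch w F → Sch w G
Sch-cong h (top d p)    = top d (λ e → trans (h e) (p e))
Sch-cong h (step a s p) = step a s (λ e → trans (h e) (p e))

Asc-unique : ∀ {n k l} {w : Vec ℕ n} → Asc k w → Asc l w → k ≡ l
Asc-unique (here _)    (here _)    = refl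
Asc-unique (here p)    (there q _) = contradiction p (<-asym q)
Asc-unique (there q _) (here p)    = contradiction p (<-asym q)
Asc-unique (there _ a) (there _ b) = cong suc (Asc-unique a b)

Asc-¬Decr : ∀ {n k} {w : Vec ℕ n} → Asc k w → ¬ Decr w
Asc-¬Decr (here p)    (q ∷ _) = <-asym p q
Asc-¬Decr (there _ a) (_ ∷ d) = Asc-¬Decr a d

Sch-functional : ∀ {n} {w : Vec ℕ n} {F G} → Sch w F → Sch w G → ∀ e → F e ≡ G e
Sch-functional (top _ p)     (top _ q)    e = trans (p e) (sym (q e))
Sch-functional (top d _)     (step a _ _) e = contradiction d (Asc-¬Decr a)
Sch-functional (step a _ _)  (top d _)    e = contradiction d (Asc-¬Decr a)
Sch-functional (step {k = k} a s p) (step b t q) e with Asc-unique a b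
... | refl = trans (p e) (trans (D-cong k (Sch-functional s t) e) (sym (q e)))

-- Counting the entries that are not left-to-right maxima

nm : ℕ → ℕ → ℕ
nm N x with x ℕ.<? N
... | yes _ = 1
... | no  _ = 0

nm-< : ∀ {N x} → x < N → nm N x ≡ 1
nm-< {N} {x} p with x ℕ.<? N
... | yes _ = refl
... | no ¬p = contradiction p ¬p

nm-≥ : ∀ {N x} → N ≤ x → nm N x ≡ 0
nm-≥ {N} {x} p with x ℕ.<? N
... | yes q = contradiction p (<⇒≱ q)
... | no _  = refl

nm≤1 : ∀ N x → nm N x ≤ 1
nm≤1 N x with x ℕ.<? N
... | yes _ = ≤-refl
... | no _  = z≤n

-- cnt N j w counts the positions ≥ j (from 0) of w whose entry is below N or
-- below an earlier entry; for N = 0 these are the non-left-to-right-maxima.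
cnt : ∀ {n} → ℕ → ℕ → Vec ℕ n → ℕ
cnt N j       []      = 0
cnt N zero    (x ∷ w) = nm N x + cnt (N ⊔ suc x) 0 w
cnt N (suc j) (x ∷ w) = cnt (N ⊔ suc x) j w

⊔-swap : ∀ a b c → a ⊔ b ⊔ c ≡ a ⊔ c ⊔ b
⊔-swap a b c = trans (⊔-assoc a b c) (trans (cong (a ⊔_) (⊔-comm b c)) (sym (⊔-assoc a c b)))

cnt-suc≤ : ∀ {n} N j (w : Vec ℕ n) → cnt N (suc j) w ≤ cnt N j w
cnt-suc≤ N j       []      = z≤n
cnt-suc≤ N zero    (x ∷ w) = m≤n+m _ (nm N x)
cnt-suc≤ N (suc j) (x ∷ w) = cnt-suc≤ (N ⊔ suc x) j w

cnt-swap-above : ∀ {n} N k j (w : Vec ℕ n) → suc (suc k) ≤ j → cnt N j (swap k w) ≡ cnt N j w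
cnt-swap-above N k       j             []          p = refl
cnt-swap-above N zero    j             (x ∷ [])    p = refl
cnt-swap-above N zero    (suc (suc j)) (x ∷ y ∷ w) p = cong (λ z → cnt z j w) (⊔-swap N (suc y) (suc x))
cnt-swap-above N (suc k) (suc j)       (x ∷ w)     p = cnt-swap-above (N ⊔ suc x) k j w (≤-pred p)
cnt-swap-above N zero    (suc zero)    (x ∷ y ∷ w) (s≤s ())

-- After the swap the smaller entry stands right behind the larger one, so position `suc k` is
-- certainly counted.
cnt-swap-at : ∀ {n k} N {w : Vec ℕ n} → Asc k w →
  cnt N (suc k) (swap k w) ≡ suc (cnt N (suc (suc k)) (swap k w))
cnt-swap-at N (here {x = x} {y} {w} p) =
  cong (_+ cnt (N ⊔ suc y ⊔ suc x) 0 w) (nm-< (≤-trans (m≤n⇒m≤1+n p) (m≤n⊔m N (suc y))))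
cnt-swap-at N (there {x = x} _ a) = cnt-swap-at (N ⊔ suc x) a

data Head< : ∀ {n} → ℕ → Vec ℕ n → Set where
  head< : ∀ {n N x} {w : Vec ℕ n} → x < N → Head< N (x ∷ w)

-- The decreasing run up to the ascent starts below N, so the smaller swapped entry is counted in
-- both orders, and the larger one is compared with the same bound N in both.
cnt-swap-below′ : ∀ {n k} N j {w : Vec ℕ n} → Asc k w → Head< N w → j ≤ k → cnt N j (swap k w) ≡ cnt N j w
cnt-swap-below′ N zero (here {x = x} {y} {w} p) (head< q) j≤k = begin
  nm N y + (nm (N ⊔ suc y) x + cnt (N ⊔ suc y ⊔ suc x) 0 w)
    ≡⟨ cong₂ (λ s z → nm N y + (s + cnt z 0 w)) (nm-< (≤-trans q (m≤m⊔n N (suc y)))) (⊔-swap N (suc y) (suc x)) ⟩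
  nm N y + suc (cnt (N ⊔ suc x ⊔ suc y) 0 w)
    ≡⟨ +-suc (nm N y) _ ⟩
  suc (nm N y + cnt (N ⊔ suc x ⊔ suc y) 0 w)
    ≡⟨ cong₂ (λ s z → s + (nm z y + cnt (N ⊔ suc x ⊔ suc y) 0 w)) (sym (nm-< q)) (sym (m≥n⇒m⊔n≡m q)) ⟩
  nm N x + (nm (N ⊔ suc x) y + cnt (N ⊔ suc x ⊔ suc y) 0 w) ∎
  where open ≡-Reasoning
cnt-swap-below′ N zero (there {x = x} p a) q j≤k =
  cong (λ z → nm N x + z) (cnt-swap-below′ (N ⊔ suc x) 0 a (head< (≤-trans (m≤n⇒m≤1+n p) (m≤n⊔m N (suc x)))) z≤n)
cnt-swap-below′ N (suc j) (there {x = x} p a) q j≤k =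
  cnt-swap-below′ (N ⊔ suc x) j a (head< (≤-trans (m≤n⇒m≤1+n p) (m≤n⊔m N (suc x)))) (≤-pred j≤k)

-- An ascent not at the first position is not at a left-to-right maximum when it is the first one,
-- so that swapping it keeps the number of left-to-right maxima.
cnt-swap-below : ∀ {n k} N j {w : Vec ℕ n} → Asc k w → suc j ≤ k → cnt N (suc j) (swap k w) ≡ cnt N (suc j) w
cnt-swap-below N j (there {x = x} p a) j<k =
  cnt-swap-below′ (N ⊔ suc x) j a (head< (≤-trans (m≤n⇒m≤1+n p) (m≤n⊔m N (suc x)))) (≤-pred j<k)

-- The degree bound

exceeds : ∀ a b q → q ≤ a ⊓ b → a < suc (a + b) ∸ q × b < suc (a + b) ∸ q
exceeds a b q q≤ =
  ≤-trans (≤-reflexive (sym (m+n∸n≡m (suc a) b))) (∸-monoʳ-≤ (suc (a + b)) (≤-trans q≤ (m⊓n≤n a b))) ,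
  ≤-trans (≤-reflexive (sym (trans (cong (λ z → suc z ∸ a) (+-comm a b)) (m+n∸n≡m (suc b) a)))) (∸-monoʳ-≤ (suc (a + b)) (≤-trans q≤ (m⊓n≤m a b)))

-- A source of the exponents (a, b) has exponents p and q, in one order or the other, with p + q = a
-- + b + 1 and q ≤ min(a, b); hence p exceeds both a and b.
D-support : ∀ {n} k (F : Fun n) e → D k F e ≢ 0ℤ → ∃ λ e′ → F e′ ≢ 0ℤ ×
  (∀ i → i ≢ k → i ≢ suc k → ex e i ≡ ex e′ i) ×
  ((ex e k < ex e′ k × ex e (suc k) < ex e′ k) ⊎ (ex e k < ex e′ (suc k) × ex e (suc k) < ex e′ (suc k)))
D-support k       F []          h = contradiction refl h
D-support zero    F (a ∷ [])    h = contradiction refl h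
D-support zero    F (a ∷ b ∷ e) h with Σ≤-nonzero (a ⊓ b) _ h
... | q , q≤ , d with +-nonzero (F ((suc (a + b) ∸ q) ∷ q ∷ e)) (ℤ.- F (q ∷ (suc (a + b) ∸ q) ∷ e)) d
...   | inj₁ f = _ , f , (λ { zero p _ → contradiction refl p ; (suc zero) _ p → contradiction refl p ; (suc (suc i)) _ _ → refl }) ,
                 inj₁ (exceeds a b q q≤)
...   | inj₂ f = _ , (λ z → f (cong ℤ.-_ z)) , (λ { zero p _ → contradiction refl p ; (suc zero) _ p → contradiction refl p ; (suc (suc i)) _ _ → refl }) ,
                 inj₂ (exceeds a b q q≤)
D-support (suc k) F (x ∷ e)     h with D-support k (λ r → F (x ∷ r)) e h
... | e′ , f , same , big = x ∷ e′ , f ,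
      (λ { zero _ _ → refl ; (suc i) p q → same i (λ z → p (cong suc z)) (λ z → q (cong suc z)) }) , big

stair-deg : ∀ {n} (e : Vec ℕ n) i → stairδ e ≢ 0ℤ → ex e i ≤ n ∸ suc i
stair-deg []              i       h = z≤n
stair-deg {suc n} (x ∷ e) i       h with x ℕ.≟ n
stair-deg {suc n} (x ∷ e) zero    h | yes p = ≤-reflexive p
stair-deg {suc n} (x ∷ e) (suc i) h | yes p = stair-deg e i h
... | no _ = contradiction refl h

cnt-Decr : ∀ {n} N j {w : Vec ℕ n} x → Decr (x ∷ w) → x < N → cnt N j w ≡ n ∸ j
cnt-Decr N zero    {[]}    x d p = refl
cnt-Decr N (suc j) {[]}    x d p = refl
cnt-Decr N zero    {y ∷ w} x (q ∷ d) p =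
  cong₂ _+_ (nm-< (<-trans q p)) (cnt-Decr (N ⊔ suc y) 0 y d (m≤n⊔m N (suc y)))
cnt-Decr N (suc j) {y ∷ w} x (q ∷ d) p = cnt-Decr (N ⊔ suc y) j y d (m≤n⊔m N (suc y))

-- The divided difference leaves both exponents strictly below the larger of the two old ones
-- (`D-support`); this pays for the 1 that `cnt-swap-at` adds.
swap-bound : ∀ {n k a b} {w : Vec ℕ n} → Asc k w → a ≤ cnt 0 (suc k) (swap k w) → b ≤ cnt 0 (suc (suc k)) (swap k w) →
  a ⊔ b ≤ suc (cnt 0 (suc (suc k)) w)
swap-bound {k = k} {w = w} asc p q = ⊔-lub
  (≤-trans p (≤-reflexive (trans (cnt-swap-at 0 asc) (cong suc same))))
  (≤-trans q (≤-trans (≤-reflexive same) (n≤1+n _)))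
  where
  same : cnt 0 (suc (suc k)) (swap k w) ≡ cnt 0 (suc (suc k)) w
  same = cnt-swap-above 0 k (suc (suc k)) w ≤-refl

-- deg_{x_{i+1}} 𝔖_w ≤ Λ_{i+2}(w)
Sch-deg : ∀ {n} {w : Vec ℕ n} {F} → Sch w F → ∀ i → Deg i F (cnt 0 (suc i) w)
Sch-deg {w = []}    (top d p) i [] h = z≤n
Sch-deg {suc n} {w = x ∷ w} (top d p) i e h =
  ≤-trans (stair-deg e i (λ z → h (trans (p e) z))) (≤-reflexive (sym (cnt-Decr (suc x) i x d ≤-refl)))
Sch-deg {w = w} (step {k = k} a s p) i e h with D-support k _ e (λ z → h (trans (p e) z))
... | e′ , f , same , big with <-cmp i k
...   | tri< i<k i≢k _ = subst₂ _≤_ (sym (same i i≢k (λ z → <⇒≢ (<-trans i<k ≤-refl) z))) (cnt-swap-below 0 i a i<k)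
                          (Sch-deg s i e′ f)
...   | tri≈ _ refl _ = ≤-trans (≤-pred (≤-trans (bnd big) (swap-bound a (Sch-deg s k e′ f) (Sch-deg s (suc k) e′ f)))) (cnt-suc≤ 0 (suc k) w)
  where
  bnd : _ → ex e k < ex e′ k ⊔ ex e′ (suc k)
  bnd (inj₁ (l , _)) = ≤-trans l (m≤m⊔n _ _)
  bnd (inj₂ (l , _)) = ≤-trans l (m≤n⊔m _ _)
...   | tri> _ i≢k k<i with i ℕ.≟ suc k
...     | no i≢sk = subst₂ _≤_ (sym (same i i≢k i≢sk)) (cnt-swap-above 0 k (suc i) w (s≤s k<i)) (Sch-deg s i e′ f)
...     | yes refl = ≤-pred (≤-trans (bnd big) (swap-bound a (Sch-deg s k e′ f) (Sch-deg s (suc k) e′ f)))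
  where
  bnd : _ → ex e (suc k) < ex e′ k ⊔ ex e′ (suc k)
  bnd (inj₁ (_ , l)) = ≤-trans l (m≤m⊔n _ _)
  bnd (inj₂ (_ , l)) = ≤-trans l (m≤n⊔m _ _)

-- Top coefficients

ins : ∀ {n} → ℕ → ℕ → Vec ℕ n → Vec ℕ (suc n)
ins zero    m e       = m ∷ e
ins (suc i) m []      = m ∷ []
ins (suc i) m (x ∷ e) = x ∷ ins i m e

push : ∀ {n} → ℕ → Vec ℕ n → Vec ℕ n
push x []      = []
push x (y ∷ w) = (x ⊓ y) ∷ push (x ⊔ y) w

-- Deletes the entry at i and moves it to the next larger left-to-right maximum,
-- the value found there to the next one, and so on; the maximum disappears.
rem : ∀ {n} → ℕ → Vec ℕ (suc n) → Vec ℕ n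
rem zero    (x ∷ w)     = push x w
rem (suc i) (x ∷ [])    = []
rem (suc i) (x ∷ y ∷ w) = x ∷ rem i (y ∷ w)

rem-∷ : ∀ {n} i x (w : Vec ℕ (suc n)) → rem (suc i) (x ∷ w) ≡ x ∷ rem i w
rem-∷ i x (y ∷ w) = refl

Lr : ∀ {n} → ℕ → ℕ → Vec ℕ n → Set
Lr N i       []      = ⊥
Lr N zero    (x ∷ w) = N ≤ x
Lr N (suc i) (x ∷ w) = Lr (N ⊔ suc x) i w

overshoot : ∀ m {q b} → q < b → suc m < suc (m + b) ∸ q
overshoot m {q} q<b = ≤-trans (≤-reflexive (sym (m+n∸n≡m (suc (suc m)) q)))
  (∸-monoˡ-≤ q (s≤s (≤-trans (≤-reflexive (sym (+-suc m q))) (+-monoʳ-≤ m q<b))))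

-- In the sum of `D` only q = b survives: a smaller q gives the first variable an exponent above m +
-- 1, and the subtracted terms give the second one an exponent above m. If b > m, then q = b is out
-- of range and both sides vanish.
D-top : ∀ {n} (G : Fun (suc (suc n))) m b e → Deg 0 G (suc m) → Deg 1 G m →
  D 0 G (m ∷ b ∷ e) ≡ G (suc m ∷ b ∷ e)
D-top G m b e d₀ d₁ with b ℕ.≤? m
... | yes b≤m = trans (Σ≤-single (m ⊓ b) b (⊓-glb b≤m ≤-refl) off)
      (trans (cong₂ ℤ._-_ (cong (λ z → G (z ∷ b ∷ e)) (m+n∸n≡m (suc m) b))
                          (Deg-zero 1 d₁ (b ∷ _ ∷ e) (≤-reflexive (sym (m+n∸n≡m (suc m) b)))))
             (ℤₚ.+-identityʳ _))
  where
  off : ∀ q → q ≤ m ⊓ b → q ≢ b → G ((suc (m + b) ∸ q) ∷ q ∷ e) ℤ.- G (q ∷ (suc (m + b) ∸ q) ∷ e) ≡ 0ℤ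
  off q q≤ q≢b = cong₂ ℤ._-_ (Deg-zero 0 d₀ (_ ∷ q ∷ e) (overshoot m q<b)) (Deg-zero 1 d₁ (q ∷ _ ∷ e) (≤-trans (n≤1+n _) (overshoot m q<b)))
    where
    q<b : q < b
    q<b = ≤∧≢⇒< (≤-trans q≤ (m⊓n≤n m b)) q≢b
... | no b≰m = trans (Σ≤-zero (m ⊓ b) off) (sym (Deg-zero 1 d₁ (suc m ∷ b ∷ e) (≰⇒> b≰m)))
  where
  off : ∀ q → q ≤ m ⊓ b → G ((suc (m + b) ∸ q) ∷ q ∷ e) ℤ.- G (q ∷ (suc (m + b) ∸ q) ∷ e) ≡ 0ℤ
  off q q≤ = cong₂ ℤ._-_ (Deg-zero 0 d₀ (_ ∷ q ∷ e) (overshoot m q<b)) (Deg-zero 1 d₁ (q ∷ _ ∷ e) (≤-trans (n≤1+n _) (overshoot m q<b)))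
    where
    q<b : q < b
    q<b = ≤-trans (s≤s (≤-trans q≤ (m⊓n≤m m b))) (≰⇒> b≰m)

D-sym : ∀ {n} (G : Fun (suc (suc n))) a b e → D 0 G (a ∷ b ∷ e) ≡ D 0 G (b ∷ a ∷ e)
D-sym G a b e rewrite ⊓-comm a b | +-comm a b = refl

-- The carried value x passes the decreasing run unchanged; behind the ascent a < b it leaves
-- `x ⊓ b`, still above a.
push-Asc : ∀ {n k x} {w : Vec ℕ n} → Asc k w → Head< x w → Asc k (push x w)
push-Asc {x = x} (here {x = a} {b} a<b) (head< a<x) =
  here (subst₂ (λ s t → s < t ⊓ b) (sym (m≥n⇒m⊓n≡n (<⇒≤ a<x))) (sym (m≥n⇒m⊔n≡m (<⇒≤ a<x))) (⊓-glb a<x a<b))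
push-Asc {x = x} (there {x = a} {b} b<a asc) (head< a<x)
  rewrite m≥n⇒m⊓n≡n (<⇒≤ a<x) | m≥n⇒m⊔n≡m (<⇒≤ a<x) =
  there (≤-trans (s≤s (m⊓n≤n x b)) b<a) (push-Asc asc (head< (<-trans b<a a<x)))

push-swap : ∀ {n k x} {w : Vec ℕ n} → Asc k w → Head< x w → push x (swap k w) ≡ swap k (push x w)
push-swap {x = x} (here {x = a} {b} {w} a<b) (head< a<x) = cong₂ _∷_
  (cong (_⊓ b) (sym x⊔a)) (cong₂ _∷_ (trans (m≥n⇒m⊓n≡n (≤-trans (<⇒≤ a<x) (m≤m⊔n x b))) (sym (m≥n⇒m⊓n≡n (<⇒≤ a<x))))
    (cong (λ z → push z w) (⊔-swap x b a)))
  where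
  x⊔a : x ⊔ a ≡ x
  x⊔a = m≥n⇒m⊔n≡m (<⇒≤ a<x)
push-swap {x = x} (there {x = a} {b} b<a asc) (head< a<x) =
  cong ((x ⊓ a) ∷_) (push-swap asc (head< (≤-trans b<a (m≤n⊔m x a))))

-- How the first ascent k meets the left-to-right maximum i. In `commute` neither swapped position
-- is i: deletion only renumbers the ascent, and the divided difference acts on the remaining
-- variables. In `absorb` i is k or `suc k`: after the swap the larger entry stands at k, the
-- cascade of `rem` from there yields the same word, and the divided difference merely lowers the
-- top exponent by one.
data StepView {n} (N k i : ℕ) (w : Vec ℕ (suc n)) : Set where
  commute : ∀ k′ → Asc k′ (rem i w) → rem i (swap k w) ≡ swap k′ (rem i w) → Lr N i (swap k w) →
    cnt N (suc i) (swap k w) ≡ cnt N (suc i) w →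
    (∀ (G : Fun (suc n)) m e → D k G (ins i m e) ≡ D k′ (λ r → G (ins i m r)) e) → StepView N k i w
  absorb : rem k (swap k w) ≡ rem i w → Lr N k (swap k w) →
    cnt N (suc k) (swap k w) ≡ suc (cnt N (suc i) w) →
    cnt N (suc (suc k)) (swap k w) ≤ cnt N (suc i) w →
    (∀ (G : Fun (suc n)) m → Deg k G (suc m) → Deg (suc k) G m →
       ∀ e → D k G (ins i m e) ≡ G (ins k (suc m) e)) → StepView N k i w

stepView : ∀ {n k} N i {w : Vec ℕ (suc n)} → Asc k w → Lr N i w → StepView N k i w
stepView N zero (here {x = x} {y} {w} p) l = absorb
  (cong₂ _∷_ (⊓-comm y x) (cong (λ z → push z w) (⊔-comm y x)))
  (≤-trans l (<⇒≤ p))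
  (cong₂ _+_ (nm-< (≤-trans (m≤n⇒m≤1+n p) (m≤n⊔m N (suc y))))
    (trans (cong (λ z → cnt z 0 w) (⊔-swap N (suc y) (suc x))) (cong (_+ cnt (N ⊔ suc x ⊔ suc y) 0 w) (sym (nm-≥ (⊔-lub (≤-trans l (<⇒≤ p)) p))))))
  (≤-trans (≤-reflexive (cong (λ z → cnt z 0 w) (⊔-swap N (suc y) (suc x)))) (m≤n+m _ (nm (N ⊔ suc x) y)))
  (λ { G m d₀ d₁ (b ∷ e) → D-top G m b e d₀ d₁ })
stepView N zero (there {x = x} p a) l = commute _
  (push-Asc a (head< p)) (push-swap a (head< p)) l
  (cnt-swap-below′ (N ⊔ suc x) 0 a (head< (≤-trans (m≤n⇒m≤1+n p) (m≤n⊔m N (suc x)))) z≤n)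
  (λ G m e → refl)
stepView N (suc zero) (here {x = x} {y} {w} p) l = absorb
  (cong₂ _∷_ (m≥n⇒m⊓n≡n (<⇒≤ p)) (cong (λ z → push z w) (m≥n⇒m⊔n≡m (<⇒≤ p))))
  (≤-trans (m≤m⊔n N (suc x)) l)
  (cong₂ _+_ (nm-< (≤-trans (m≤n⇒m≤1+n p) (m≤n⊔m N (suc y)))) (cong (λ z → cnt z 0 w) (⊔-swap N (suc y) (suc x))))
  (≤-reflexive (cong (λ z → cnt z 0 w) (⊔-swap N (suc y) (suc x))))
  (λ { G m d₀ d₁ (b ∷ e) → trans (D-sym G b m e) (D-top G m b e d₀ d₁) })
stepView N (suc (suc i)) (here {x = x} {y} {z ∷ w} p) l = commute 0
  (here p) refl (subst (λ q → Lr q i (z ∷ w)) (⊔-swap N (suc x) (suc y)) l)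
  (cong (λ q → cnt q (suc i) (z ∷ w)) (⊔-swap N (suc y) (suc x)))
  (λ { G m (a ∷ b ∷ e) → refl })
stepView N (suc zero) (there {x = x} p a) l =
  contradiction (≤-trans (m≤n⊔m N (suc x)) l) (<⇒≱ (m≤n⇒m≤1+n p))
stepView {k = suc k} N (suc (suc i)) (there {x = x} {y} {w = z ∷ w} p a) l with stepView (N ⊔ suc x) (suc i) a l
... | commute k′ a′ r l′ c d = commute (suc k′) (there p a′) (trans (rem-∷ (suc i) x (swap k (y ∷ z ∷ w))) (cong (x ∷_) r)) l′ c
    (λ { G m (h ∷ e) → d (λ s → G (h ∷ s)) m e })
... | absorb r l′ c c′ d = absorb (trans (rem-∷ k x (swap k (y ∷ z ∷ w))) (cong (x ∷_) r)) l′ c c′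
    (λ { G m d₀ d₁ (h ∷ e) → d (λ s → G (h ∷ s)) m (λ s f → d₀ (h ∷ s) f) (λ s f → d₁ (h ∷ s) f) e })

Decr-¬Lr : ∀ {n} N i x {w : Vec ℕ n} → Decr (x ∷ w) → x < N → ¬ Lr N i w
Decr-¬Lr N zero    x (q ∷ d) p l = <⇒≱ (<-trans q p) l
Decr-¬Lr N (suc i) x {y ∷ w} (q ∷ d) p l = Decr-¬Lr (N ⊔ suc y) i y d (m≤n⊔m N (suc y)) l

Decr-push : ∀ {n} x y {w : Vec ℕ n} → Decr (x ∷ w) → x ≤ y → push y w ≡ w
Decr-push x y {[]}    d       p = refl
Decr-push x y {z ∷ w} (q ∷ d) p = cong₂ _∷_ (m≥n⇒m⊓n≡n z≤y)
  (trans (cong (λ s → push s w) (m≥n⇒m⊔n≡m z≤y)) (Decr-push z y d z≤y))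
  where
  z≤y : z ≤ y
  z≤y = ≤-trans (<⇒≤ q) p

Decr-tail : ∀ {n x} {w : Vec ℕ n} → Decr (x ∷ w) → Decr w
Decr-tail [-]     = []
Decr-tail (_ ∷ d) = d

stairδ-top : ∀ {n} (e : Vec ℕ n) → stairδ (n ∷ e) ≡ stairδ e
stairδ-top {n} e with n ℕ.≟ n
... | yes _ = refl
... | no ¬p = contradiction refl ¬p

Sch-word : ∀ {n} {v w : Vec ℕ n} {F} → v ≡ w → Sch v F → Sch w F
Sch-word refl s = s

-- Along the chain the followed position stays i while swaps commute with its deletion and becomes k
-- when a swap is absorbed. At the end the word decreases, its only left-to-right maximum is at 0,
-- and deleting it leaves the shorter staircase.
Sch-top : ∀ {n} {w : Vec ℕ (suc n)} {F} → Sch w F → ∀ i → Lr 0 i w →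
  Sch (rem i w) (λ e → F (ins i (cnt 0 (suc i) w) e))
Sch-top {w = x ∷ w} (top d p) zero l =
  Sch-word (sym (Decr-push x x d ≤-refl))
    (top (Decr-tail d) (λ e → trans (p _) (trans (cong (λ z → stairδ (z ∷ e)) (cnt-Decr (suc x) 0 x d ≤-refl)) (stairδ-top e))))
Sch-top {w = x ∷ w} (top d p) (suc i) l = contradiction l (Decr-¬Lr (suc x) i x d ≤-refl)
Sch-top {w = w} {F} (step {k = k} {G = G} a s p) i l with stepView 0 i a l
... | commute k′ a′ r l′ c d =
  step a′ (Sch-word r (Sch-top s i l′))
    (λ e → trans (p _) (trans (d G _ e) (D-cong k′ (λ v → cong (λ z → G (ins i z v)) (sym c)) e)))
... | absorb r l′ c c′ d =
  Sch-word r (Sch-cong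
    (λ e → trans (p _) (trans (d G _ (λ v f → ≤-trans (Sch-deg s k v f) (≤-reflexive c)) (λ v f → ≤-trans (Sch-deg s (suc k) v f) c′) e)
                              (cong (λ z → G (ins k z e)) (sym c))))
    (Sch-top s k l′))

-- Products

conv : ∀ {n} → Fun n → Fun n → Fun n
conv F G []      = F [] ℤ.* G []
conv F G (x ∷ E) = Σ≤ x (λ q → conv (λ e → F (q ∷ e)) (λ e → G ((x ∸ q) ∷ e)) E)

conv-cong : ∀ {n} {F F′ G G′ : Fun n} → (∀ e → F e ≡ F′ e) → (∀ e → G e ≡ G′ e) → ∀ E → conv F G E ≡ conv F′ G′ E
conv-cong f g []      = cong₂ ℤ._*_ (f []) (g [])
conv-cong f g (x ∷ E) = Σ≤-cong x (λ q _ → conv-cong (λ e → f (q ∷ e)) (λ e → g ((x ∸ q) ∷ e)) E)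

conv-zeroˡ : ∀ {n} {F G : Fun n} → (∀ e → F e ≡ 0ℤ) → ∀ E → conv F G E ≡ 0ℤ
conv-zeroˡ {G = G} f [] = trans (cong (ℤ._* G []) (f [])) (ℤₚ.*-zeroˡ (G []))
conv-zeroˡ f (x ∷ E)    = Σ≤-zero x (λ q _ → conv-zeroˡ (λ e → f (q ∷ e)) E)

conv-zeroʳ : ∀ {n} {F G : Fun n} → (∀ e → G e ≡ 0ℤ) → ∀ E → conv F G E ≡ 0ℤ
conv-zeroʳ {F = F} g [] = trans (cong (F [] ℤ.*_) (g [])) (ℤₚ.*-zeroʳ (F []))
conv-zeroʳ g (x ∷ E)    = Σ≤-zero x (λ q _ → conv-zeroʳ (λ e → g ((x ∸ q) ∷ e)) E)

-- Under the two degree bounds the exponent a + b splits only as a and b.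
conv-top : ∀ {n} i → i ≤ n → (F G : Fun (suc n)) → ∀ {a b} → Deg i F a → Deg i G b → ∀ E →
  conv F G (ins i (a + b) E) ≡ conv (λ e → F (ins i a e)) (λ e → G (ins i b e)) E
conv-top zero i≤n F G {a} {b} dF dG E = trans
  (Σ≤-single (a + b) a (m≤m+n a b) off)
  (cong (λ z → conv (λ e → F (a ∷ e)) (λ e → G (z ∷ e)) E) (m+n∸m≡n a b))
  where
  off : ∀ q → q ≤ a + b → q ≢ a → conv (λ e → F (q ∷ e)) (λ e → G ((a + b ∸ q) ∷ e)) E ≡ 0ℤ
  off q q≤ q≢a with <-cmp q a
  ... | tri< q<a _ _ = conv-zeroʳ (λ e → Deg-zero 0 dG (_ ∷ e)
          (≤-trans (≤-reflexive (sym (m+n∸m≡n q (suc b)))) (∸-monoˡ-≤ q (≤-trans (≤-reflexive (+-suc q b)) (+-monoˡ-≤ b q<a))))) E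
  ... | tri≈ _ q≡a _ = contradiction q≡a q≢a
  ... | tri> _ _ a<q = conv-zeroˡ (λ e → Deg-zero 0 dF (_ ∷ e) a<q) E
conv-top (suc i) (s≤s i≤n) F G dF dG (x ∷ E) =
  Σ≤-cong x (λ q _ → conv-top i i≤n (λ e → F (q ∷ e)) (λ e → G ((x ∸ q) ∷ e)) (λ e → dF (q ∷ e)) (λ e → dG ((x ∸ q) ∷ e)) E)

conv-deg : ∀ {n} i (F G : Fun n) {a b} → Deg i F a → Deg i G b → Deg i (conv F G) (a + b)
conv-deg i       F G dF dG []      h = z≤n
conv-deg zero    F G {a} {b} dF dG (x ∷ E) h with x ℕ.≤? (a + b)
... | yes p = p
... | no ¬p = contradiction (Σ≤-zero x off) h
  where
  off : ∀ q → q ≤ x → conv (λ e → F (q ∷ e)) (λ e → G ((x ∸ q) ∷ e)) E ≡ 0ℤ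
  off q q≤x with q ℕ.≤? a
  ... | no q≰a  = conv-zeroˡ (λ e → Deg-zero 0 dF (_ ∷ e) (≰⇒> q≰a)) E
  ... | yes q≤a = conv-zeroʳ (λ e → Deg-zero 0 dG (_ ∷ e)
          (≤-trans (≤-reflexive (sym (m+n∸m≡n q (suc b)))) (∸-monoˡ-≤ q (≤-trans (≤-reflexive (+-suc q b)) (≤-trans (s≤s (+-monoˡ-≤ b q≤a)) (≰⇒> ¬p)))))) E
conv-deg (suc i) F G dF dG (x ∷ E) h with Σ≤-nonzero x _ h
... | q , _ , f = conv-deg i (λ e → F (q ∷ e)) (λ e → G ((x ∸ q) ∷ e)) (λ e → dF (q ∷ e)) (λ e → dG ((x ∸ q) ∷ e)) E f

-- Position 0 is always a left-to-right maximum, so top coefficients in the first variable can be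
-- taken until both words are empty, where both coefficients are 1.
conv-nonzero : ∀ {n} {v w : Vec ℕ n} {F G} → Sch v F → Sch w G → ∃ λ E → conv F G E ≢ 0ℤ
conv-nonzero {v = []} {[]} (top _ p) (top _ q) =
  [] , λ z → contradiction (trans (sym (cong₂ ℤ._*_ (p []) (q []))) z) (λ ())
conv-nonzero {v = []} {[]} (step () _ _) _
conv-nonzero {v = []} {[]} (top _ _) (step () _ _)
conv-nonzero {v = v@(_ ∷ _)} {w@(_ ∷ _)} {F} {G} s t with conv-nonzero (Sch-top s 0 z≤n) (Sch-top t 0 z≤n)
... | E , h = ins 0 (cnt 0 1 v + cnt 0 1 w) E , λ z → h (trans (sym (conv-top 0 z≤n F G (Sch-deg s 0) (Sch-deg t 0) E)) z)

ex-ins : ∀ {n} i m (e : Vec ℕ n) → i ≤ n → ex (ins i m e) i ≡ m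
ex-ins zero    m e       p       = refl
ex-ins (suc i) m (x ∷ e) (s≤s p) = ex-ins i m e p

Lr⇒< : ∀ {n} N i (w : Vec ℕ n) → Lr N i w → i < n
Lr⇒< N zero    (x ∷ w) l = s≤s z≤n
Lr⇒< N (suc i) (x ∷ w) l = s≤s (Lr⇒< (N ⊔ suc x) i w l)

conv-attained : ∀ {n} {v w : Vec ℕ n} {F G} → Sch v F → Sch w G → ∀ i → Lr 0 i v → Lr 0 i w →
  ∃ λ E → conv F G E ≢ 0ℤ × ex E i ≡ cnt 0 (suc i) v + cnt 0 (suc i) w
conv-attained {zero} {[]} s t i ()
conv-attained {suc n} {v} {w} {F} {G} s t i l l′ with conv-nonzero (Sch-top s i l) (Sch-top t i l′)
... | E , h = ins i _ E , (λ z → h (trans (sym (conv-top i i≤n F G (Sch-deg s i) (Sch-deg t i) E)) z)) , ex-ins i _ E i≤n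
  where
  i≤n : i ≤ n
  i≤n = ≤-pred (Lr⇒< 0 i v l)

-- Coefficients of formal sums

eqℤ : ℕ → ℕ → ℤ
eqℤ a b with a ℕ.≟ b
... | yes _ = 1ℤ
... | no  _ = 0ℤ

eqℤ-refl : ∀ a → eqℤ a a ≡ 1ℤ
eqℤ-refl a with a ℕ.≟ a
... | yes _ = refl
... | no ¬p = contradiction refl ¬p

eqℤ-≢ : ∀ {a b} → a ≢ b → eqℤ a b ≡ 0ℤ
eqℤ-≢ {a} {b} p with a ℕ.≟ b
... | yes q = contradiction q p
... | no _  = refl

*-zeroʳ′ : ∀ x {y} → y ≡ 0ℤ → x ℤ.* y ≡ 0ℤ
*-zeroʳ′ x refl = ℤₚ.*-zeroʳ x

*-zeroˡ′ : ∀ {x} y → x ≡ 0ℤ → x ℤ.* y ≡ 0ℤ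
*-zeroˡ′ y refl = ℤₚ.*-zeroˡ y

tl : Mono → Mono
tl []      = []
tl (_ ∷ e) = e

δ₀ : Mono → ℤ
δ₀ []          = 1ℤ
δ₀ (zero ∷ e)  = δ₀ e
δ₀ (suc _ ∷ e) = 0ℤ

-- Exponents of e beyond the first n have to vanish; `δ₀` tests what remains.
δ : ∀ {n} → Mono → Fun n
δ e []      = δ₀ e
δ e (x ∷ m) = eqℤ (expAt e 0) x ℤ.* δ (tl e) m

-- One step of `stripZeros` as a function of the stripped tail. Its injectivity reduces equality of
-- stripped monomials to heads and stripped tails.
stripCons : ℕ → Mono → Mono
stripCons zero    []      = []
stripCons (suc a) []      = suc a ∷ []
stripCons a       (x ∷ r) = a ∷ x ∷ r

strip-∷ : ∀ a e → stripZeros (a ∷ e) ≡ stripCons a (stripZeros e)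
strip-∷ zero    e with stripZeros e
... | []    = refl
... | _ ∷ _ = refl
strip-∷ (suc a) e with stripZeros e
... | []    = refl
... | _ ∷ _ = refl

stripCons-injective : ∀ a b r s → stripCons a r ≡ stripCons b s → a ≡ b × r ≡ s
stripCons-injective zero    zero    []      []      p    = refl , refl
stripCons-injective zero    (suc b) []      []      ()
stripCons-injective (suc a) zero    []      []      ()
stripCons-injective (suc a) (suc b) []      []      refl = refl , refl
stripCons-injective zero    zero    []      (x ∷ s) ()
stripCons-injective zero    (suc b) []      (x ∷ s) ()
stripCons-injective (suc a) zero    []      (x ∷ s) ()
stripCons-injective (suc a) (suc b) []      (x ∷ s) ()
stripCons-injective zero    zero    (x ∷ r) []      ()
stripCons-injective zero    (suc b) (x ∷ r) []      ()
stripCons-injective (suc a) zero    (x ∷ r) []      ()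
stripCons-injective (suc a) (suc b) (x ∷ r) []      ()
stripCons-injective zero    zero    (x ∷ r) (y ∷ s) refl = refl , refl
stripCons-injective zero    (suc b) (x ∷ r) (y ∷ s) ()
stripCons-injective (suc a) zero    (x ∷ r) (y ∷ s) ()
stripCons-injective (suc a) (suc b) (x ∷ r) (y ∷ s) refl = refl , refl

strip-head-tail : ∀ e → stripZeros e ≡ stripCons (expAt e 0) (stripZeros (tl e))
strip-head-tail []      = refl
strip-head-tail (a ∷ e) = strip-∷ a e

DeltaSpec : ∀ {n} → Mono → Vec ℕ n → Set
DeltaSpec e m = (stripZeros e ≡ stripZeros (toList m) × δ e m ≡ 1ℤ) ⊎ (stripZeros e ≢ stripZeros (toList m) × δ e m ≡ 0ℤ)

δ-spec : ∀ {n} e (m : Vec ℕ n) → DeltaSpec e m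
δ-spec []          []      = inj₁ (refl , refl)
δ-spec (zero ∷ e)  []      with δ-spec e []
... | inj₁ (p , q) = inj₁ (trans (strip-∷ 0 e) (cong (stripCons 0) p) , q)
... | inj₂ (p , q) = inj₂ ((λ z → p (proj₂ (stripCons-injective 0 0 (stripZeros e) [] (trans (sym (strip-∷ 0 e)) z)))) , q)
δ-spec (suc a ∷ e) []      = inj₂ ((λ z → contradiction (proj₁ (stripCons-injective (suc a) 0 (stripZeros e) [] (trans (sym (strip-∷ (suc a) e)) z))) (λ ())) , refl)
δ-spec e           (x ∷ m) with expAt e 0 ℕ.≟ x
... | no p = inj₂ ((λ z → p (proj₁ (stripCons-injective (expAt e 0) x (stripZeros (tl e)) (stripZeros (toList m))
                  (trans (sym (strip-head-tail e)) (trans z (strip-∷ x (toList m))))))) , ℤₚ.*-zeroˡ (δ (tl e) m))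
... | yes p with δ-spec (tl e) m
...   | inj₁ (q , r) = inj₁ (trans (strip-head-tail e) (trans (cong₂ stripCons p q) (sym (strip-∷ x (toList m)))) , trans (ℤₚ.*-identityˡ (δ (tl e) m)) r)
...   | inj₂ (q , r) = inj₂ ((λ z → q (proj₂ (stripCons-injective (expAt e 0) x (stripZeros (tl e)) (stripZeros (toList m))
                  (trans (sym (strip-head-tail e)) (trans z (strip-∷ x (toList m))))))) , trans (ℤₚ.*-identityˡ (δ (tl e) m)) r)

cf : ∀ {n} → Poly → Fun n
cf p m = coeff p (toList m)

cf-∷ : ∀ {n} c e p (m : Vec ℕ n) → cf ((c , e) ∷ p) m ≡ c ℤ.* δ e m ℤ.+ cf p m
cf-∷ c e p m with ≡-dec ℕ._≟_ (stripZeros e) (stripZeros (toList m)) | δ-spec e m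
... | yes p′ | inj₁ (_ , q) = cong (ℤ._+ cf p m) (sym (trans (cong (c ℤ.*_) q) (ℤₚ.*-identityʳ c)))
... | yes p′ | inj₂ (r , _) = contradiction p′ r
... | no p′  | inj₁ (r , _) = contradiction r p′
... | no p′  | inj₂ (_ , q) = sym (trans (cong (λ z → c ℤ.* z ℤ.+ cf p m) q) (trans (cong (ℤ._+ cf p m) (ℤₚ.*-zeroʳ c)) (ℤₚ.+-identityˡ (cf p m))))

cf-++ : ∀ {n} p q (m : Vec ℕ n) → cf (p ++ q) m ≡ cf p m ℤ.+ cf q m
cf-++ []            q m = sym (ℤₚ.+-identityˡ (cf q m))
cf-++ ((c , e) ∷ p) q m = begin
  cf ((c , e) ∷ p ++ q) m                  ≡⟨ cf-∷ c e (p ++ q) m ⟩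
  c ℤ.* δ e m ℤ.+ cf (p ++ q) m            ≡⟨ cong (λ z → c ℤ.* δ e m ℤ.+ z) (cf-++ p q m) ⟩
  c ℤ.* δ e m ℤ.+ (cf p m ℤ.+ cf q m)      ≡⟨ sym (ℤₚ.+-assoc (c ℤ.* δ e m) (cf p m) (cf q m)) ⟩
  c ℤ.* δ e m ℤ.+ cf p m ℤ.+ cf q m        ≡⟨ cong (ℤ._+ cf q m) (sym (cf-∷ c e p m)) ⟩
  cf ((c , e) ∷ p) m ℤ.+ cf q m            ∎
  where open ≡-Reasoning

Σ≤-linear : ∀ k c f g → Σ≤ k (λ q → c ℤ.* f q ℤ.+ g q) ≡ c ℤ.* Σ≤ k f ℤ.+ Σ≤ k g
Σ≤-linear zero    c f g = refl
Σ≤-linear (suc k) c f g = trans (cong (λ z → c ℤ.* f (suc k) ℤ.+ g (suc k) ℤ.+ z) (Σ≤-linear k c f g))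
  (ring c (f (suc k)) (g (suc k)) (Σ≤ k f) (Σ≤ k g))
  where
  ring : ∀ c x y s t → c ℤ.* x ℤ.+ y ℤ.+ (c ℤ.* s ℤ.+ t) ≡ c ℤ.* (x ℤ.+ s) ℤ.+ (y ℤ.+ t)
  ring = solve-∀

Σ≤-scale : ∀ k c f → Σ≤ k (λ q → c ℤ.* f q) ≡ c ℤ.* Σ≤ k f
Σ≤-scale zero    c f = refl
Σ≤-scale (suc k) c f = trans (cong (λ z → c ℤ.* f (suc k) ℤ.+ z) (Σ≤-scale k c f)) (sym (ℤₚ.*-distribˡ-+ c (f (suc k)) (Σ≤ k f)))

D-linear : ∀ {n} k c (F G : Fun n) e → D k (λ r → c ℤ.* F r ℤ.+ G r) e ≡ c ℤ.* D k F e ℤ.+ D k G e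
D-linear k       c F G []          = sym (trans (ℤₚ.+-identityʳ (c ℤ.* 0ℤ)) (ℤₚ.*-zeroʳ c))
D-linear zero    c F G (a ∷ [])    = sym (trans (ℤₚ.+-identityʳ (c ℤ.* 0ℤ)) (ℤₚ.*-zeroʳ c))
D-linear zero    c F G (a ∷ b ∷ e) = trans (Σ≤-cong (a ⊓ b) (λ q _ → ring c (F _) (G _) (F _) (G _))) (Σ≤-linear (a ⊓ b) c _ _)
  where
  ring : ∀ c x y s t → c ℤ.* x ℤ.+ y ℤ.- (c ℤ.* s ℤ.+ t) ≡ c ℤ.* (x ℤ.- s) ℤ.+ (y ℤ.- t)
  ring = solve-∀
D-linear (suc k) c F G (x ∷ e)     = D-linear k c (λ r → F (x ∷ r)) (λ r → G (x ∷ r)) e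

D-zero : ∀ {n} k (e : Vec ℕ n) → D k (λ _ → 0ℤ) e ≡ 0ℤ
D-zero k       []          = refl
D-zero zero    (a ∷ [])    = refl
D-zero zero    (a ∷ b ∷ e) = Σ≤-zero (a ⊓ b) (λ _ _ → refl)
D-zero (suc k) (x ∷ e)     = D-zero k e

D-scale : ∀ {n} k c (F : Fun n) e → D k (λ r → c ℤ.* F r) e ≡ c ℤ.* D k F e
D-scale k c F e = trans (D-cong k (λ r → sym (ℤₚ.+-identityʳ (c ℤ.* F r))) e)
  (trans (D-linear k c F (λ _ → 0ℤ) e) (trans (cong (λ z → c ℤ.* D k F e ℤ.+ z) (D-zero k e)) (ℤₚ.+-identityʳ _)))

Σ< : ℕ → (ℕ → ℤ) → ℤ
Σ< zero    f = 0ℤ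
Σ< (suc k) f = f 0 ℤ.+ Σ< k (f ∘ suc)

Σ<-cong : ∀ k {f g} → (∀ t → f t ≡ g t) → Σ< k f ≡ Σ< k g
Σ<-cong zero    h = refl
Σ<-cong (suc k) h = cong₂ ℤ._+_ (h 0) (Σ<-cong k (h ∘ suc))

Σ<-zero : ∀ k {f} → (∀ t → t < k → f t ≡ 0ℤ) → Σ< k f ≡ 0ℤ
Σ<-zero zero    h = refl
Σ<-zero (suc k) h = cong₂ ℤ._+_ (h 0 (s≤s z≤n)) (Σ<-zero k (λ t p → h (suc t) (s≤s p)))

Σ<-empty : ∀ {k} f → k ≡ 0 → Σ< k f ≡ 0ℤ
Σ<-empty f refl = refl

Σ<-single : ∀ k {f} p → p < k → (∀ t → t ≢ p → f t ≡ 0ℤ) → Σ< k f ≡ f p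
Σ<-single (suc k) {f} zero    p<k h = trans (cong (λ z → f 0 ℤ.+ z) (Σ<-zero k (λ t _ → h (suc t) (λ ())))) (ℤₚ.+-identityʳ (f 0))
Σ<-single (suc k) {f} (suc p) p<k h = trans (cong₂ ℤ._+_ (h 0 (λ ())) (Σ<-single k p (≤-pred p<k) (λ t q → h (suc t) (λ z → q (suc-injective z)))))
  (ℤₚ.+-identityˡ (f (suc p)))

Σ<-scale : ∀ k c f → Σ< k (λ t → c ℤ.* f t) ≡ c ℤ.* Σ< k f
Σ<-scale zero    c f = sym (ℤₚ.*-zeroʳ c)
Σ<-scale (suc k) c f = trans (cong (λ z → c ℤ.* f 0 ℤ.+ z) (Σ<-scale k c (f ∘ suc))) (sym (ℤₚ.*-distribˡ-+ c (f 0) (Σ< k (f ∘ suc))))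

cf-applyUpTo : ∀ {n} c (s : ℕ → Mono) g k (m : Vec ℕ n) → cf (map (λ t → (c , s t)) (applyUpTo g k)) m ≡ c ℤ.* Σ< k (λ t → δ (s (g t)) m)
cf-applyUpTo c s g zero    m = sym (ℤₚ.*-zeroʳ c)
cf-applyUpTo c s g (suc k) m = trans (cf-∷ c (s (g 0)) _ m)
  (trans (cong (λ z → c ℤ.* δ (s (g 0)) m ℤ.+ z) (cf-applyUpTo c s (g ∘ suc) k m)) (sym (ℤₚ.*-distribˡ-+ c (δ (s (g 0)) m) _)))

set₂ : ℕ → Mono → ℕ → ℕ → Mono
set₂ k e x y = setAt (setAt e k x) (suc k) y

-- The truncated `a ∸ b` makes this 0 unless a > b, so the three cases of `ddTerm` become one
-- difference of two halves with a and b exchanged.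
half : ∀ {n} → ℕ → Mono → ℕ → ℕ → Vec ℕ n → ℤ
half k e a b m = Σ< (a ∸ b) (λ t → δ (set₂ k e (a ∸ 1 ∸ t) (b + t)) m)

cf-ddTerm : ∀ {n} k c e (m : Vec ℕ n) → cf (ddTerm (suc k) (c , e)) m ≡
  c ℤ.* (half k e (expAt e k) (expAt e (suc k)) m ℤ.- half k e (expAt e (suc k)) (expAt e k) m)
cf-ddTerm k c e m with expAt e k | expAt e (suc k)
... | a | b with ℕ.compare a b
...   | ℕ.less .a r = trans (cf-applyUpTo (ℤ.- c) (λ t → set₂ k e (suc (a + r) ∸ 1 ∸ t) (a + t)) (λ t → t) (suc (a + r) ∸ a) m)
          (trans (ring c _) (cong (λ z → c ℤ.* (z ℤ.- half k e (suc (a + r)) a m)) (sym (Σ<-empty _ (m≤n⇒m∸n≡0 (m≤n⇒m≤1+n (m≤m+n a r)))))))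
  where
  ring : ∀ c x → ℤ.- c ℤ.* x ≡ c ℤ.* (0ℤ ℤ.- x)
  ring = solve-∀
...   | ℕ.equal .a = sym (trans (cong (λ z → c ℤ.* z) (ℤₚ.+-inverseʳ (half k e a a m))) (ℤₚ.*-zeroʳ c))
...   | ℕ.greater .b r = trans (cf-applyUpTo c (λ t → set₂ k e (suc (b + r) ∸ 1 ∸ t) (b + t)) (λ t → t) (suc (b + r) ∸ b) m)
          (cong (λ z → c ℤ.* z) (trans (sym (ℤₚ.+-identityʳ _)) (cong (λ z → half k e (suc (b + r)) b m ℤ.- z) (sym (Σ<-empty _ (m≤n⇒m∸n≡0 (m≤n⇒m≤1+n (m≤m+n b r))))))))

δ-setAt-zero : ∀ {n} e v x (m : Vec ℕ n) → δ (setAt e 0 v) (x ∷ m) ≡ eqℤ v x ℤ.* δ (tl e) m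
δ-setAt-zero []      v x m = refl
δ-setAt-zero (a ∷ e) v x m = refl

δ-setAt-suc : ∀ {n} e k v x (m : Vec ℕ n) → δ (setAt e (suc k) v) (x ∷ m) ≡ eqℤ (expAt e 0) x ℤ.* δ (setAt (tl e) k v) m
δ-setAt-suc []      k v x m = refl
δ-setAt-suc (a ∷ e) k v x m = refl

tl-setAt : ∀ e k v → tl (setAt e (suc k) v) ≡ setAt (tl e) k v
tl-setAt []      k v = refl
tl-setAt (a ∷ e) k v = refl

head-setAt-zero : ∀ e v → expAt (setAt e 0 v) 0 ≡ v
head-setAt-zero []      v = refl
head-setAt-zero (_ ∷ _) v = refl

head-setAt-suc : ∀ e k v → expAt (setAt e (suc k) v) 0 ≡ expAt e 0
head-setAt-suc []      k v = refl
head-setAt-suc (_ ∷ _) k v = refl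

tl-setAt-zero : ∀ e v → tl (setAt e 0 v) ≡ tl e
tl-setAt-zero []      v = refl
tl-setAt-zero (_ ∷ _) v = refl

expAt-suc : ∀ e k → expAt e (suc k) ≡ expAt (tl e) k
expAt-suc []      k = refl
expAt-suc (_ ∷ _) k = refl

δ-set₂-zero : ∀ {n} e x y a b (m : Vec ℕ n) → δ (set₂ 0 e x y) (a ∷ b ∷ m) ≡ (eqℤ x a ℤ.* eqℤ y b) ℤ.* δ (tl (tl e)) m
δ-set₂-zero e x y a b m = begin
  δ (set₂ 0 e x y) (a ∷ b ∷ m)                                   ≡⟨ δ-setAt-suc (setAt e 0 x) 0 y a (b ∷ m) ⟩
  eqℤ (expAt (setAt e 0 x) 0) a ℤ.* δ (setAt (tl (setAt e 0 x)) 0 y) (b ∷ m)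
    ≡⟨ cong₂ (λ s t → eqℤ s a ℤ.* δ (setAt t 0 y) (b ∷ m)) (head-setAt-zero e x) (tl-setAt-zero e x) ⟩
  eqℤ x a ℤ.* δ (setAt (tl e) 0 y) (b ∷ m)                       ≡⟨ cong (λ z → eqℤ x a ℤ.* z) (δ-setAt-zero (tl e) y b m) ⟩
  eqℤ x a ℤ.* (eqℤ y b ℤ.* δ (tl (tl e)) m)                      ≡⟨ sym (ℤₚ.*-assoc (eqℤ x a) (eqℤ y b) _) ⟩
  eqℤ x a ℤ.* eqℤ y b ℤ.* δ (tl (tl e)) m                        ∎
  where open ≡-Reasoning

δ-set₂-suc : ∀ {n} k e x y a (m : Vec ℕ n) → δ (set₂ (suc k) e x y) (a ∷ m) ≡ eqℤ (expAt e 0) a ℤ.* δ (set₂ k (tl e) x y) m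
δ-set₂-suc k e x y a m = trans (δ-setAt-suc (setAt e (suc k) x) (suc k) y a m)
  (cong₂ (λ s t → eqℤ s a ℤ.* δ (setAt t (suc k) y) m) (head-setAt-suc e k x) (tl-setAt e k x))

-- Both sums are 1 exactly when b ≤ min(a′,b′) and a + b = a′ + b′ + 1, and 0 otherwise.
monomial-difference : ∀ a b a′ b′ →
  Σ< (a ∸ b) (λ t → eqℤ (a ∸ 1 ∸ t) a′ ℤ.* eqℤ (b + t) b′) ≡
  Σ≤ (a′ ⊓ b′) (λ q → eqℤ a (suc (a′ + b′) ∸ q) ℤ.* eqℤ b q)
monomial-difference a b a′ b′ with b ℕ.≤? a′ ⊓ b′ | a ℕ.≟ suc (a′ + b′) ∸ b
... | yes p | yes q = trans (trans (Σ<-single (a ∸ b) (b′ ∸ b) t< off) (cong₂ ℤ._*_ one₁ one₂))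
                            (sym (trans (Σ≤-single (a′ ⊓ b′) b p off′) (cong₂ ℤ._*_ one₃ (eqℤ-refl b))))
  where
  b≤a′ : b ≤ a′
  b≤a′ = ≤-trans p (m⊓n≤m a′ b′)
  b≤b′ : b ≤ b′
  b≤b′ = ≤-trans p (m⊓n≤n a′ b′)
  a≡ : a ≡ suc (a′ + (b′ ∸ b))
  a≡ = trans q (+-∸-assoc (suc a′) b≤b′)
  t< : b′ ∸ b < a ∸ b
  t< = ≤-trans (≤-reflexive (sym (trans (cong (λ z → suc z ∸ b) (+-comm b (b′ ∸ b))) (m+n∸n≡m (suc (b′ ∸ b)) b))))
         (∸-monoˡ-≤ b (≤-trans (s≤s (+-monoˡ-≤ (b′ ∸ b) b≤a′)) (≤-reflexive (sym a≡))))
  one₁ : eqℤ (a ∸ 1 ∸ (b′ ∸ b)) a′ ≡ 1ℤ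
  one₁ = trans (cong (λ z → eqℤ z a′) (trans (cong (λ z → z ∸ 1 ∸ (b′ ∸ b)) a≡) (m+n∸n≡m a′ (b′ ∸ b)))) (eqℤ-refl a′)
  one₂ : eqℤ (b + (b′ ∸ b)) b′ ≡ 1ℤ
  one₂ = trans (cong (λ z → eqℤ z b′) (m+[n∸m]≡n b≤b′)) (eqℤ-refl b′)
  one₃ : eqℤ a (suc (a′ + b′) ∸ b) ≡ 1ℤ
  one₃ = trans (cong (eqℤ a) (sym q)) (eqℤ-refl a)
  off : ∀ t → t ≢ b′ ∸ b → eqℤ (a ∸ 1 ∸ t) a′ ℤ.* eqℤ (b + t) b′ ≡ 0ℤ
  off t t≢ = *-zeroʳ′ (eqℤ (a ∸ 1 ∸ t) a′) (eqℤ-≢ {b + t} (λ z → t≢ (trans (sym (m+n∸m≡n b t)) (cong (_∸ b) z))))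
  off′ : ∀ q′ → q′ ≤ a′ ⊓ b′ → q′ ≢ b → eqℤ a (suc (a′ + b′) ∸ q′) ℤ.* eqℤ b q′ ≡ 0ℤ
  off′ q′ _ q≢ = *-zeroʳ′ (eqℤ a (suc (a′ + b′) ∸ q′)) (eqℤ-≢ (λ z → q≢ (sym z)))
... | yes p | no q = trans (Σ<-zero (a ∸ b) off) (sym (Σ≤-zero (a′ ⊓ b′) off′))
  where
  off : ∀ t → t < a ∸ b → eqℤ (a ∸ 1 ∸ t) a′ ℤ.* eqℤ (b + t) b′ ≡ 0ℤ
  off t t< with a ∸ 1 ∸ t ℕ.≟ a′ | b + t ℕ.≟ b′
  ... | no _     | yes _    = refl
  ... | no _     | no _     = refl
  ... | yes _    | no _     = refl
  ... | yes refl | yes refl = contradiction eq q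
    where
    t<a : suc t ≤ a
    t<a = ≤-trans t< (m∸n≤m a b)
    eq : a ≡ suc (a ∸ 1 ∸ t + (b + t)) ∸ b
    eq = sym (trans (cong (λ z → suc z ∸ b) (trans (cong (λ y → a ∸ 1 ∸ t + y) (+-comm b t)) (sym (+-assoc (a ∸ 1 ∸ t) t b))))
           (trans (m+n∸n≡m (suc (a ∸ 1 ∸ t + t)) b)
             (trans (cong (λ z → suc (z + t)) (∸-+-assoc a 1 t)) (trans (sym (+-suc (a ∸ suc t) t)) (m∸n+n≡m t<a)))))
  off′ : ∀ q′ → q′ ≤ a′ ⊓ b′ → eqℤ a (suc (a′ + b′) ∸ q′) ℤ.* eqℤ b q′ ≡ 0ℤ
  off′ q′ _ with b ℕ.≟ q′
  ... | yes refl = trans (cong (ℤ._* 1ℤ) (eqℤ-≢ q)) refl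
  ... | no _     = ℤₚ.*-zeroʳ (eqℤ a (suc (a′ + b′) ∸ q′))
... | no p  | _ = trans (Σ<-zero (a ∸ b) off) (sym (Σ≤-zero (a′ ⊓ b′) off′))
  where
  off : ∀ t → t < a ∸ b → eqℤ (a ∸ 1 ∸ t) a′ ℤ.* eqℤ (b + t) b′ ≡ 0ℤ
  off t t< with a ∸ 1 ∸ t ℕ.≟ a′ | b + t ℕ.≟ b′
  ... | no _     | yes _    = refl
  ... | no _     | no _     = refl
  ... | yes _    | no _     = refl
  ... | yes refl | yes refl = contradiction (⊓-glb b≤ (m≤m+n b t)) p
    where
    b≤ : b ≤ a ∸ 1 ∸ t
    b≤ = ≤-trans (m+n≤o⇒m≤o∸n b (≤-trans (≤-reflexive (+-comm b (suc t))) (≤-trans (+-monoˡ-≤ b t<) (≤-reflexive (m∸n+n≡m b≤a)))))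
           (≤-reflexive (sym (∸-+-assoc a 1 t)))
      where
      b≤a : b ≤ a
      b≤a with b ℕ.≤? a
      ... | yes z = z
      ... | no z  = contradiction (≤-trans t< (≤-reflexive (m≤n⇒m∸n≡0 (<⇒≤ (≰⇒> z))))) (λ ())
  off′ : ∀ q′ → q′ ≤ a′ ⊓ b′ → eqℤ a (suc (a′ + b′) ∸ q′) ℤ.* eqℤ b q′ ≡ 0ℤ
  off′ q′ q≤ = *-zeroʳ′ (eqℤ a (suc (a′ + b′) ∸ q′)) (eqℤ-≢ (λ { refl → p q≤ }))

half-scale : ∀ {n} k e a b x (m : Vec ℕ n) → half (suc k) e a b (x ∷ m) ≡ eqℤ (expAt e 0) x ℤ.* half k (tl e) a b m
half-scale k e a b x m = trans (Σ<-cong (a ∸ b) (λ t → δ-set₂-suc k e (a ∸ 1 ∸ t) (b + t) x m)) (Σ<-scale (a ∸ b) (eqℤ (expAt e 0) x) _)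

-- The exponents away from k and `suc k` contribute a common factor; on the remaining two,
-- `monomial-difference` matches the explicit image of a monomial with the sum over sources in `D`.
D-δ : ∀ {n} k e (m : Vec ℕ n) → suc k < n →
  half k e (expAt e k) (expAt e (suc k)) m ℤ.- half k e (expAt e (suc k)) (expAt e k) m ≡ D k (δ e) m
D-δ zero e (a′ ∷ b′ ∷ m) _ = trans (cong₂ ℤ._-_ (side a b) (side b a))
    (trans (sym (ringʳ P (R a b) (R b a))) (trans (cong (P ℤ.*_) sub) (trans (sym (Σ≤-scale (a′ ⊓ b′) P _)) (Σ≤-cong (a′ ⊓ b′) (λ q _ → term q)))))
  where
  a b : ℕ
  a = expAt e 0
  b = expAt e 1
  P : ℤ
  P = δ (tl (tl e)) m
  R : ℕ → ℕ → ℤ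
  R x y = Σ≤ (a′ ⊓ b′) (λ q → eqℤ x (suc (a′ + b′) ∸ q) ℤ.* eqℤ y q)
  side : ∀ x y → half 0 e x y (a′ ∷ b′ ∷ m) ≡ P ℤ.* R x y
  side x y = trans (Σ<-cong (x ∸ y) (λ t → trans (δ-set₂-zero e (x ∸ 1 ∸ t) (y + t) a′ b′ m) (ℤₚ.*-comm (eqℤ (x ∸ 1 ∸ t) a′ ℤ.* eqℤ (y + t) b′) P)))
    (trans (Σ<-scale (x ∸ y) P _) (cong (P ℤ.*_) (monomial-difference x y a′ b′)))
  ringʳ : ∀ p x y → p ℤ.* (x ℤ.- y) ≡ p ℤ.* x ℤ.- p ℤ.* y
  ringʳ = solve-∀
  f g : ℕ → ℤ
  f q = eqℤ a (suc (a′ + b′) ∸ q) ℤ.* eqℤ b q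
  g q = eqℤ b (suc (a′ + b′) ∸ q) ℤ.* eqℤ a q
  sub : R a b ℤ.- R b a ≡ Σ≤ (a′ ⊓ b′) (λ q → f q ℤ.- g q)
  sub = trans (ring₁ (R a b) (R b a)) (trans (sym (Σ≤-linear (a′ ⊓ b′) (ℤ.- 1ℤ) g f)) (Σ≤-cong (a′ ⊓ b′) (λ q _ → ring₂ (f q) (g q))))
    where
    ring₁ : ∀ x y → x ℤ.- y ≡ ℤ.- 1ℤ ℤ.* y ℤ.+ x
    ring₁ = solve-∀
    ring₂ : ∀ x y → ℤ.- 1ℤ ℤ.* y ℤ.+ x ≡ x ℤ.- y
    ring₂ = solve-∀
  term : ∀ q → P ℤ.* (f q ℤ.- g q) ≡ δ e ((suc (a′ + b′) ∸ q) ∷ q ∷ m) ℤ.- δ e (q ∷ (suc (a′ + b′) ∸ q) ∷ m)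
  term q rewrite sym (expAt-suc e 0) = ring₃ P (eqℤ a (suc (a′ + b′) ∸ q)) (eqℤ b q) (eqℤ b (suc (a′ + b′) ∸ q)) (eqℤ a q)
    where
    ring₃ : ∀ p x y z w → p ℤ.* (x ℤ.* y ℤ.- z ℤ.* w) ≡ x ℤ.* (y ℤ.* p) ℤ.- w ℤ.* (z ℤ.* p)
    ring₃ = solve-∀
D-δ (suc k) e (x ∷ m) (s≤s k<n) rewrite expAt-suc e k | expAt-suc e (suc k) =
  trans (cong₂ ℤ._-_ (half-scale k e a b x m) (half-scale k e b a x m))
    (trans (sym (ring (eqℤ (expAt e 0) x) (half k (tl e) a b m) (half k (tl e) b a m)))
      (trans (cong (λ z → eqℤ (expAt e 0) x ℤ.* z) (D-δ k (tl e) m k<n)) (sym (D-scale k (eqℤ (expAt e 0) x) (δ (tl e)) m))))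
  where
  a b : ℕ
  a = expAt (tl e) k
  b = expAt (tl e) (suc k)
  ring : ∀ p x y → p ℤ.* (x ℤ.- y) ≡ p ℤ.* x ℤ.- p ℤ.* y
  ring = solve-∀
D-δ zero e (_ ∷ []) (s≤s ())

cf-∂ : ∀ {n} k p (m : Vec ℕ n) → suc k < n → cf (∂ (suc k) p) m ≡ D k (cf p) m
cf-∂ k []            m k<n = sym (D-zero k m)
cf-∂ k ((c , e) ∷ p) m k<n = begin
  cf (ddTerm (suc k) (c , e) ++ ∂ (suc k) p) m                ≡⟨ cf-++ (ddTerm (suc k) (c , e)) (∂ (suc k) p) m ⟩
  cf (ddTerm (suc k) (c , e)) m ℤ.+ cf (∂ (suc k) p) m        ≡⟨ cong₂ ℤ._+_ (trans (cf-ddTerm k c e m) (cong (c ℤ.*_) (D-δ k e m k<n))) (cf-∂ k p m k<n) ⟩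
  c ℤ.* D k (δ e) m ℤ.+ D k (cf p) m                          ≡⟨ sym (D-linear k c (δ e) (cf p) m) ⟩
  D k (λ r → c ℤ.* δ e r ℤ.+ cf p r) m                        ≡⟨ D-cong k (λ r → sym (cf-∷ c e p r)) m ⟩
  D k (cf ((c , e) ∷ p)) m                                    ∎
  where open ≡-Reasoning

-- Schubert polynomials of words

lt : ∀ {n} → ℕ → Vec ℕ n → ℕ
lt x []      = 0
lt x (y ∷ w) = nm y x + lt x w

-- For distinct entries, each swap at a first ascent removes exactly one of these pairs, so this is
-- the length of the chain and has to stay below the fuel.
nonInv : ∀ {n} → Vec ℕ n → ℕ
nonInv []      = 0
nonInv (x ∷ w) = lt x w + nonInv w

+-swap : ∀ a b c → a + (b + c) ≡ b + (a + c)
+-swap a b c = trans (sym (+-assoc a b c)) (trans (cong (_+ c) (+-comm a b)) (+-assoc b a c))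

lt-swap : ∀ {n} x k (w : Vec ℕ n) → lt x (swap k w) ≡ lt x w
lt-swap x k       []          = refl
lt-swap x zero    (y ∷ [])    = refl
lt-swap x zero    (y ∷ z ∷ w) = +-swap (nm z x) (nm y x) (lt x w)
lt-swap x (suc k) (y ∷ w)     = cong (λ s → nm y x + s) (lt-swap x k w)

nonInv-swap : ∀ {n k} {w : Vec ℕ n} → Asc k w → suc (nonInv (swap k w)) ≡ nonInv w
nonInv-swap (here {x = x} {y} {w} p) = begin
  suc (nm x y + lt y w + (lt x w + nonInv w)) ≡⟨ cong (λ z → suc (z + lt y w + (lt x w + nonInv w))) (nm-≥ (<⇒≤ p)) ⟩
  suc (lt y w + (lt x w + nonInv w))          ≡⟨ cong suc (+-swap (lt y w) (lt x w) (nonInv w)) ⟩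
  suc (lt x w + (lt y w + nonInv w))          ≡⟨ cong (λ z → z + lt x w + (lt y w + nonInv w)) (sym (nm-< p)) ⟩
  nm y x + lt x w + (lt y w + nonInv w)       ∎
  where open ≡-Reasoning
nonInv-swap {k = suc k} (there {x = x} {y} {w = w} _ a) = trans (sym (+-suc _ _))
  (cong₂ _+_ (lt-swap x k (y ∷ w)) (nonInv-swap a))

lt≤ : ∀ {n} x (w : Vec ℕ n) → lt x w ≤ n
lt≤ x []      = z≤n
lt≤ x (y ∷ w) = +-mono-≤ (nm≤1 y x) (lt≤ x w)

nonInv≤ : ∀ {n} (w : Vec ℕ n) → nonInv w ≤ n * n
nonInv≤ []              = z≤n
nonInv≤ {suc n} (x ∷ w) = ≤-trans (+-mono-≤ (lt≤ x w) (≤-trans (nonInv≤ w) (*-monoʳ-≤ n (n≤1+n n)))) (n≤1+n _)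

Dist : ∀ {n} → Vec ℕ n → Set
Dist []      = ⊤
Dist (x ∷ w) = All (x ≢_) w × Dist w

All-swap : ∀ {n} {P : ℕ → Set} k {w : Vec ℕ n} → All P w → All P (swap k w)
All-swap k       []           = []
All-swap zero    (p ∷ [])     = p ∷ []
All-swap zero    (p ∷ q ∷ ps) = q ∷ p ∷ ps
All-swap (suc k) (p ∷ ps)     = p ∷ All-swap k ps

Dist-swap : ∀ {n} k (w : Vec ℕ n) → Dist w → Dist (swap k w)
Dist-swap k       []          d = tt
Dist-swap zero    (x ∷ [])    d = d
Dist-swap zero    (x ∷ y ∷ w) ((p ∷ ps) , qs , d) = ((λ z → p (sym z)) ∷ qs) , ps , d
Dist-swap (suc k) (x ∷ w)     (ps , d) = All-swap k ps , Dist-swap k w d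

decr-or-asc : ∀ {n} (w : Vec ℕ n) → Dist w → Decr w ⊎ ∃ λ k → Asc k w
decr-or-asc []          d = inj₁ []
decr-or-asc (x ∷ [])    d = inj₁ [-]
decr-or-asc (x ∷ y ∷ w) ((p ∷ _) , d) with <-cmp x y | decr-or-asc (y ∷ w) d
... | tri< x<y _ _ | _            = inj₂ (0 , here x<y)
... | tri≈ _ x≡y _ | _            = contradiction x≡y p
... | tri> _ _ y<x | inj₁ dec     = inj₁ (y<x ∷ dec)
... | tri> _ _ y<x | inj₂ (k , a) = inj₂ (suc k , there y<x a)

-- scan is the local function of firstAscent in Defs, which has no name outside
-- its where block: unification recovers it from the unfolding of firstAscent.
mutual
  scan : ℕ → ℕ → List ℕ → ℕ → ℕ → List ℕ → Maybe ℕ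
  scan = _

  scan-unfold : ∀ K x y ys → (x ℕ.<ᵇ y) ≡ false → firstAscent K (x ∷ y ∷ ys) ≡ scan K x (y ∷ ys) (suc K) y ys
  scan-unfold K x y ys p rewrite p with suc K | y ∷ ys
  ... | k | zs = refl

<ᵇ-true : ∀ {x y} → x < y → (x ℕ.<ᵇ y) ≡ true
<ᵇ-true {x} {y} p with x ℕ.<ᵇ y | <⇒<ᵇ p
... | true | _ = refl

<ᵇ-false : ∀ {x y} → y < x → (x ℕ.<ᵇ y) ≡ false
<ᵇ-false {x} {y} p with x ℕ.<ᵇ y in eq
... | false = refl
... | true  = contradiction (<ᵇ⇒< x y (subst (λ b → T b) (sym eq) tt)) (<-asym p)

-- `K₀`, `x₀` and `zs` are the arguments of the enclosing `firstAscent`, over which its local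
-- function is lifted.
scan-Asc : ∀ {n k x} {w : Vec ℕ n} K₀ x₀ zs K → Asc k (x ∷ w) → scan K₀ x₀ zs K x (toList w) ≡ just (suc (K + k))
scan-Asc K₀ x₀ zs K (here p) rewrite <ᵇ-true p = cong (λ z → just (suc z)) (sym (+-identityʳ K))
scan-Asc K₀ x₀ zs K (there {k = k} p a) rewrite <ᵇ-false p = trans (scan-Asc K₀ x₀ zs (suc K) a) (cong (λ z → just (suc z)) (sym (+-suc K k)))

scan-Decr : ∀ {n x} {w : Vec ℕ n} K₀ x₀ zs K → Decr (x ∷ w) → scan K₀ x₀ zs K x (toList w) ≡ nothing
scan-Decr K₀ x₀ zs K [-]     = refl
scan-Decr K₀ x₀ zs K (p ∷ d) rewrite <ᵇ-false p = scan-Decr K₀ x₀ zs (suc K) d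

firstAscent-Asc : ∀ {n k} {w : Vec ℕ n} → Asc k w → firstAscent 0 (toList w) ≡ just (suc k)
firstAscent-Asc {w = x ∷ w} a = scan-Asc 0 x (toList w) 0 a

firstAscent-Decr : ∀ {n} {w : Vec ℕ n} → Decr w → firstAscent 0 (toList w) ≡ nothing
firstAscent-Decr {w = []}    d = refl
firstAscent-Decr {w = x ∷ w} d = scan-Decr 0 x (toList w) 0 d

swapAt-toList : ∀ {n} k (w : Vec ℕ n) → swapAt (suc k) (toList w) ≡ toList (swap k w)
swapAt-toList k       []          = refl
swapAt-toList zero    (x ∷ [])    = refl
swapAt-toList (suc k) (x ∷ [])    = refl
swapAt-toList zero    (x ∷ y ∷ w) = refl
swapAt-toList (suc k) (x ∷ y ∷ w) = cong (x ∷_) (swapAt-toList k (y ∷ w))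

δ-stair : ∀ {n} f (m : Vec ℕ n) → (∀ k → f k ≡ n ∸ 1 ∸ k) → δ (applyUpTo f n) m ≡ stairδ m
δ-stair f [] h = refl
δ-stair {suc n} f (x ∷ m) h with f 0 ℕ.≟ x | x ℕ.≟ n
... | yes p | yes q = trans (ℤₚ.*-identityˡ _) (δ-stair (f ∘ suc) m (λ k → trans (h (suc k)) (sym (∸-+-assoc n 1 k))))
... | yes p | no q  = contradiction (trans (sym p) (h 0)) q
... | no p  | yes q = contradiction (trans (h 0) (sym q)) p
... | no p  | no q  = refl

Asc⇒< : ∀ {n k} {w : Vec ℕ n} → Asc k w → suc k < n
Asc⇒< (here _)    = s≤s (s≤s z≤n)
Asc⇒< (there _ a) = s≤s (Asc⇒< a)

schubAux-Sch : ∀ {n} fuel (w : Vec ℕ n) → Dist w → nonInv w < fuel → Sch w (cf (schubAux n fuel (toList w)))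
schubAux-Sch {n} (suc fuel) w d p with decr-or-asc w d
... | inj₁ dec rewrite firstAscent-Decr dec =
  top dec (λ e → trans (cf-∷ 1ℤ (staircase n) [] e) (trans (ℤₚ.+-identityʳ _) (trans (ℤₚ.*-identityˡ _)
    (trans (cong (λ s → δ s e) (map-applyUpTo (λ z → z) (λ k → n ∸ 1 ∸ k) n)) (δ-stair (λ k → n ∸ 1 ∸ k) e (λ _ → refl))))))
... | inj₂ (k , a) rewrite firstAscent-Asc a | swapAt-toList k w =
  step a (schubAux-Sch fuel (swap k w) (Dist-swap k w d) (≤-pred (≤-trans (≤-reflexive (cong suc (nonInv-swap a))) p)))
    (λ e → cf-∂ k (schubAux n fuel (toList (swap k w))) e (Asc⇒< a))

schub : ∀ {n} → Vec ℕ n → Fun n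
schub {n} w = cf (schubAux n (suc (n * n)) (toList w))

schub-Sch : ∀ {n} (w : Vec ℕ n) → Dist w → Sch w (schub w)
schub-Sch {n} w d = schubAux-Sch (suc (n * n)) w d (s≤s (nonInv≤ w))

-- Products and scalar multiples of formal sums

conv-linearˡ : ∀ {n} c (F F′ G : Fun n) E → conv (λ e → c ℤ.* F e ℤ.+ F′ e) G E ≡ c ℤ.* conv F G E ℤ.+ conv F′ G E
conv-linearˡ c F F′ G []      = ring c (F []) (F′ []) (G [])
  where
  ring : ∀ c x y z → (c ℤ.* x ℤ.+ y) ℤ.* z ≡ c ℤ.* (x ℤ.* z) ℤ.+ y ℤ.* z
  ring = solve-∀
conv-linearˡ c F F′ G (x ∷ E) = trans
  (Σ≤-cong x (λ q _ → conv-linearˡ c (λ e → F (q ∷ e)) (λ e → F′ (q ∷ e)) (λ e → G ((x ∸ q) ∷ e)) E)) (Σ≤-linear x c _ _)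

conv-linearʳ : ∀ {n} c (F G G′ : Fun n) E → conv F (λ e → c ℤ.* G e ℤ.+ G′ e) E ≡ c ℤ.* conv F G E ℤ.+ conv F G′ E
conv-linearʳ c F G G′ []      = ring c (G []) (G′ []) (F [])
  where
  ring : ∀ c x y z → z ℤ.* (c ℤ.* x ℤ.+ y) ≡ c ℤ.* (z ℤ.* x) ℤ.+ z ℤ.* y
  ring = solve-∀
conv-linearʳ c F G G′ (x ∷ E) = trans
  (Σ≤-cong x (λ q _ → conv-linearʳ c (λ e → F (q ∷ e)) (λ e → G ((x ∸ q) ∷ e)) (λ e → G′ ((x ∸ q) ∷ e)) E)) (Σ≤-linear x c _ _)

conv-scaleˡ : ∀ {n} c (F G : Fun n) E → conv (λ e → c ℤ.* F e) G E ≡ c ℤ.* conv F G E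
conv-scaleˡ c F G []      = ℤₚ.*-assoc c (F []) (G [])
conv-scaleˡ c F G (x ∷ E) = trans
  (Σ≤-cong x (λ q _ → conv-scaleˡ c (λ e → F (q ∷ e)) (λ e → G ((x ∸ q) ∷ e)) E)) (Σ≤-scale x c _)

conv-scaleʳ : ∀ {n} c (F G : Fun n) E → conv F (λ e → c ℤ.* G e) E ≡ c ℤ.* conv F G E
conv-scaleʳ c F G []      = ring c (F []) (G [])
  where
  ring : ∀ c x y → x ℤ.* (c ℤ.* y) ≡ c ℤ.* (x ℤ.* y)
  ring = solve-∀
conv-scaleʳ c F G (x ∷ E) = trans
  (Σ≤-cong x (λ q _ → conv-scaleʳ c (λ e → F (q ∷ e)) (λ e → G ((x ∸ q) ∷ e)) E)) (Σ≤-scale x c _)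

addMono-head : ∀ e f → expAt (addMono e f) 0 ≡ expAt e 0 + expAt f 0
addMono-head []      f       = refl
addMono-head (a ∷ e) []      = sym (+-identityʳ a)
addMono-head (a ∷ e) (b ∷ f) = refl

addMono-[] : ∀ e → addMono e [] ≡ e
addMono-[] []      = refl
addMono-[] (a ∷ e) = refl

addMono-tl : ∀ e f → tl (addMono e f) ≡ addMono (tl e) (tl f)
addMono-tl []      f       = refl
addMono-tl (a ∷ e) []      = sym (addMono-[] e)
addMono-tl (a ∷ e) (b ∷ f) = refl

δ₀-addMono : ∀ e f → δ₀ e ℤ.* δ₀ f ≡ δ₀ (addMono e f)
δ₀-addMono []          f           = ℤₚ.*-identityˡ (δ₀ f)
δ₀-addMono (zero ∷ e)  []          = ℤₚ.*-identityʳ (δ₀ e)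
δ₀-addMono (suc _ ∷ e) []          = refl
δ₀-addMono (zero ∷ e)  (zero ∷ f)  = δ₀-addMono e f
δ₀-addMono (zero ∷ e)  (suc _ ∷ f) = ℤₚ.*-zeroʳ (δ₀ e)
δ₀-addMono (suc _ ∷ e) (_ ∷ f)     = refl

eqℤ-conv : ∀ a b x → Σ≤ x (λ q → eqℤ a q ℤ.* eqℤ b (x ∸ q)) ≡ eqℤ (a + b) x
eqℤ-conv a b x with a + b ℕ.≟ x
... | yes refl = trans (Σ≤-single (a + b) a (m≤m+n a b) (λ q _ q≢ → *-zeroˡ′ (eqℤ b (a + b ∸ q)) (eqℤ-≢ (λ z → q≢ (sym z)))))
                   (cong₂ ℤ._*_ (eqℤ-refl a) (trans (cong (eqℤ b) (m+n∸m≡n a b)) (eqℤ-refl b)))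
... | no p = Σ≤-zero x off
  where
  off : ∀ q → q ≤ x → eqℤ a q ℤ.* eqℤ b (x ∸ q) ≡ 0ℤ
  off q q≤x with a ℕ.≟ q
  ... | no _ = refl
  ... | yes refl = trans (ℤₚ.*-identityˡ _) (eqℤ-≢ (λ { refl → p (m+[n∸m]≡n q≤x) }))

conv-δ : ∀ {n} e f (E : Vec ℕ n) → conv (δ e) (δ f) E ≡ δ (addMono e f) E
conv-δ e f []      = δ₀-addMono e f
conv-δ e f (x ∷ E) = begin
  Σ≤ x (λ q → conv (λ r → eqℤ (expAt e 0) q ℤ.* δ (tl e) r) (λ r → eqℤ (expAt f 0) (x ∸ q) ℤ.* δ (tl f) r) E)
    ≡⟨ Σ≤-cong x (λ q _ → pull q) ⟩
  Σ≤ x (λ q → P ℤ.* (eqℤ (expAt e 0) q ℤ.* eqℤ (expAt f 0) (x ∸ q)))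
    ≡⟨ Σ≤-scale x P _ ⟩
  P ℤ.* Σ≤ x (λ q → eqℤ (expAt e 0) q ℤ.* eqℤ (expAt f 0) (x ∸ q))
    ≡⟨ cong (P ℤ.*_) (eqℤ-conv (expAt e 0) (expAt f 0) x) ⟩
  P ℤ.* eqℤ (expAt e 0 + expAt f 0) x
    ≡⟨ ℤₚ.*-comm P _ ⟩
  eqℤ (expAt e 0 + expAt f 0) x ℤ.* P
    ≡⟨ cong₂ (λ s t → eqℤ s x ℤ.* t) (sym (addMono-head e f)) (trans (conv-δ (tl e) (tl f) E) (cong (λ s → δ s E) (sym (addMono-tl e f)))) ⟩
  δ (addMono e f) (x ∷ E) ∎
  where
  open ≡-Reasoning
  P : ℤ
  P = conv (δ (tl e)) (δ (tl f)) E
  pull : ∀ q → conv (λ r → eqℤ (expAt e 0) q ℤ.* δ (tl e) r) (λ r → eqℤ (expAt f 0) (x ∸ q) ℤ.* δ (tl f) r) E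
             ≡ P ℤ.* (eqℤ (expAt e 0) q ℤ.* eqℤ (expAt f 0) (x ∸ q))
  pull q = trans (conv-scaleˡ (eqℤ (expAt e 0) q) (δ (tl e)) _ E)
    (trans (cong (λ z → eqℤ (expAt e 0) q ℤ.* z) (conv-scaleʳ (eqℤ (expAt f 0) (x ∸ q)) (δ (tl e)) (δ (tl f)) E))
      (ring (eqℤ (expAt e 0) q) (eqℤ (expAt f 0) (x ∸ q)) P))
    where
    ring : ∀ a b p → a ℤ.* (b ℤ.* p) ≡ p ℤ.* (a ℤ.* b)
    ring = solve-∀

-- `h` stands for the pattern lambda inside `_*ᴾ_`, given only through its values on pairs.
cf-term* : ∀ {n} c e (h : ℤ × Mono → ℤ × Mono) → (∀ d f → h (d , f) ≡ (c ℤ.* d , addMono e f)) →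
  ∀ q (E : Vec ℕ n) → cf (map h q) E ≡ c ℤ.* conv (δ e) (cf q) E
cf-term* c e h hh []            E = sym (*-zeroʳ′ c (conv-zeroʳ (λ _ → refl) E))
cf-term* c e h hh ((d , f) ∷ q) E rewrite hh d f = begin
  cf ((c ℤ.* d , addMono e f) ∷ map h q) E                   ≡⟨ cf-∷ (c ℤ.* d) (addMono e f) (map h q) E ⟩
  c ℤ.* d ℤ.* δ (addMono e f) E ℤ.+ cf (map h q) E           ≡⟨ cong₂ (λ s t → c ℤ.* d ℤ.* s ℤ.+ t) (sym (conv-δ e f E)) (cf-term* c e h hh q E) ⟩
  c ℤ.* d ℤ.* conv (δ e) (δ f) E ℤ.+ c ℤ.* conv (δ e) (cf q) E ≡⟨ ring c d _ _ ⟩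
  c ℤ.* (d ℤ.* conv (δ e) (δ f) E ℤ.+ conv (δ e) (cf q) E)   ≡⟨ cong (c ℤ.*_) (sym (conv-linearʳ d (δ e) (δ f) (cf q) E)) ⟩
  c ℤ.* conv (δ e) (λ r → d ℤ.* δ f r ℤ.+ cf q r) E          ≡⟨ cong (c ℤ.*_) (conv-cong (λ _ → refl) (λ r → sym (cf-∷ d f q r)) E) ⟩
  c ℤ.* conv (δ e) (cf ((d , f) ∷ q)) E                      ∎
  where
  open ≡-Reasoning
  ring : ∀ c d x y → c ℤ.* d ℤ.* x ℤ.+ c ℤ.* y ≡ c ℤ.* (d ℤ.* x ℤ.+ y)
  ring = solve-∀

cf-* : ∀ {n} p q (E : Vec ℕ n) → cf (p *ᴾ q) E ≡ conv (cf p) (cf q) E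
cf-* []            q E = sym (conv-zeroˡ (λ _ → refl) E)
cf-* ((c , e) ∷ p) q E = begin
  cf (map _ q ++ (p *ᴾ q)) E                             ≡⟨ cf-++ (map _ q) (p *ᴾ q) E ⟩
  cf (map _ q) E ℤ.+ cf (p *ᴾ q) E                       ≡⟨ cong₂ ℤ._+_ (cf-term* c e _ (λ _ _ → refl) q E) (cf-* p q E) ⟩
  c ℤ.* conv (δ e) (cf q) E ℤ.+ conv (cf p) (cf q) E     ≡⟨ sym (conv-linearˡ c (δ e) (cf p) (cf q) E) ⟩
  conv (λ r → c ℤ.* δ e r ℤ.+ cf p r) (cf q) E           ≡⟨ conv-cong (λ r → sym (cf-∷ c e p r)) (λ _ → refl) E ⟩
  conv (cf ((c , e) ∷ p)) (cf q) E                       ∎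
  where open ≡-Reasoning

cf-scale : ∀ {n} c p (m : Vec ℕ n) → cf (scale c p) m ≡ c ℤ.* cf p m
cf-scale c []            m = sym (ℤₚ.*-zeroʳ c)
cf-scale c ((d , f) ∷ p) m = trans (cf-∷ (c ℤ.* d) f (scale c p) m)
  (trans (cong (λ z → c ℤ.* d ℤ.* δ f m ℤ.+ z) (cf-scale c p m)) (trans (ring c d (δ f m) (cf p m)) (cong (c ℤ.*_) (sym (cf-∷ d f p m)))))
  where
  ring : ∀ c d x y → c ℤ.* d ℤ.* x ℤ.+ c ℤ.* y ≡ c ℤ.* (d ℤ.* x ℤ.+ y)
  ring = solve-∀

-- Linear independence

ΣL : ∀ {A : Set} → List A → (A → ℤ) → ℤ
ΣL []       f = 0ℤ
ΣL (x ∷ xs) f = f x ℤ.+ ΣL xs f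

ΣL-cong : ∀ {A : Set} (xs : List A) {f g} → (∀ x → f x ≡ g x) → ΣL xs f ≡ ΣL xs g
ΣL-cong []       h = refl
ΣL-cong (x ∷ xs) h = cong₂ ℤ._+_ (h x) (ΣL-cong xs h)

ΣL-zero : ∀ {A : Set} (xs : List A) {f} → (∀ x → x ∈ xs → f x ≡ 0ℤ) → ΣL xs f ≡ 0ℤ
ΣL-zero []       h = refl
ΣL-zero (x ∷ xs) h = cong₂ ℤ._+_ (h x (here refl)) (ΣL-zero xs (λ y y∈ → h y (there y∈)))

ΣL-single : ∀ {A : Set} {xs : List A} {f} x → Unique xs → x ∈ xs → (∀ y → y ≢ x → f y ≡ 0ℤ) → ΣL xs f ≡ f x
ΣL-single {xs = _ ∷ xs} {f} x (u ∷ _) (here refl) h =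
  trans (cong (λ z → f x ℤ.+ z) (ΣL-zero xs (λ y y∈ → h y (λ { refl → LAll.lookup u y∈ refl })))) (ℤₚ.+-identityʳ (f x))
ΣL-single {xs = y ∷ xs} {f} x (u ∷ us) (there x∈) h =
  trans (cong₂ ℤ._+_ (h y (λ { refl → LAll.lookup u x∈ refl })) (ΣL-single x us x∈ h)) (ℤₚ.+-identityˡ (f x))

ΣL-+ : ∀ {A : Set} (xs : List A) f g → ΣL xs (λ x → f x ℤ.+ g x) ≡ ΣL xs f ℤ.+ ΣL xs g
ΣL-+ []       f g = refl
ΣL-+ (x ∷ xs) f g = trans (cong (λ z → f x ℤ.+ g x ℤ.+ z) (ΣL-+ xs f g)) (ring (f x) (g x) (ΣL xs f) (ΣL xs g))
  where
  ring : ∀ a b c d → a ℤ.+ b ℤ.+ (c ℤ.+ d) ≡ a ℤ.+ c ℤ.+ (b ℤ.+ d)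
  ring = solve-∀

ΣL-nonzero : ∀ {A : Set} (xs : List A) f → ΣL xs f ≢ 0ℤ → ∃ λ x → x ∈ xs × f x ≢ 0ℤ
ΣL-nonzero []       f h = contradiction refl h
ΣL-nonzero (x ∷ xs) f h with +-nonzero (f x) (ΣL xs f) h
... | inj₁ p = x , here refl , p
... | inj₂ p with ΣL-nonzero xs f p
...   | y , y∈ , q = y , there y∈ , q

ΣL-++ : ∀ {A : Set} (xs ys : List A) f → ΣL (xs ++ ys) f ≡ ΣL xs f ℤ.+ ΣL ys f
ΣL-++ []       ys f = sym (ℤₚ.+-identityˡ _)
ΣL-++ (x ∷ xs) ys f = trans (cong (λ z → f x ℤ.+ z) (ΣL-++ xs ys f)) (sym (ℤₚ.+-assoc (f x) (ΣL xs f) (ΣL ys f)))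

ΣL-map : ∀ {A B : Set} (g : A → B) xs f → ΣL (map g xs) f ≡ ΣL xs (λ x → f (g x))
ΣL-map g []       f = refl
ΣL-map g (x ∷ xs) f = cong (λ z → f (g x) ℤ.+ z) (ΣL-map g xs f)

ΣL-product : ∀ {A B C : Set} (h : A → B → C) xs ys f →
  ΣL (cartesianProductWith h xs ys) f ≡ ΣL xs (λ x → ΣL ys (λ y → f (h x y)))
ΣL-product h []       ys f = refl
ΣL-product h (x ∷ xs) ys f = trans (ΣL-++ (map (h x) ys) _ f) (cong₂ ℤ._+_ (ΣL-map (h x) ys f) (ΣL-product h xs ys f))

-- A permutation of 1..n+1 is the position of its largest value together with
-- the permutation of 1..n that remains when this value is deleted.
data Code : ℕ → Set where
  ε   : Code 0
  _◂_ : ∀ {n} → Fin (suc n) → Code n → Code (suc n)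

wd : ∀ {n} → Code n → Vec ℕ n
wd ε               = []
wd {suc n} (i ◂ x) = ins (toℕ i) (suc n) (wd x)

All-ins : ∀ {n} {P : ℕ → Set} i {M} {w : Vec ℕ n} → P M → All P w → All P (ins i M w)
All-ins zero    p ps       = p ∷ ps
All-ins (suc i) p []       = p ∷ []
All-ins (suc i) p (q ∷ ps) = q ∷ All-ins i p ps

Dist-ins : ∀ {n} i {M} {w : Vec ℕ n} → All (_≢ M) w → Dist w → Dist (ins i M w)
Dist-ins zero    p        d        = VAll.map (λ q z → q (sym z)) p , d
Dist-ins (suc i) []       d        = [] , tt
Dist-ins (suc i) (p ∷ ps) (qs , d) = All-ins i p qs , Dist-ins i ps d

wd-< : ∀ {n} (x : Code n) → All (_< suc n) (wd x)
wd-< ε       = []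
wd-< (i ◂ x) = All-ins (toℕ i) ≤-refl (VAll.map m≤n⇒m≤1+n (wd-< x))

wd-Dist : ∀ {n} (x : Code n) → Dist (wd x)
wd-Dist ε       = tt
wd-Dist (i ◂ x) = Dist-ins (toℕ i) (VAll.map <⇒≢ (wd-< x)) (wd-Dist x)

Lr-ins : ∀ {n} N i {M} {w : Vec ℕ n} → i ≤ n → N ≤ M → All (_< M) w → Lr N i (ins i M w)
Lr-ins N zero    i≤n       q ps       = q
Lr-ins N (suc i) (s≤s i≤n) q (p ∷ ps) = Lr-ins _ i i≤n (⊔-lub q p) ps

push-large : ∀ {n M} {w : Vec ℕ n} → All (_< M) w → push M w ≡ w
push-large []       = refl
push-large {w = x ∷ w} (p ∷ ps) = cong₂ _∷_ (m≥n⇒m⊓n≡n (<⇒≤ p)) (trans (cong (λ z → push z w) (m≥n⇒m⊔n≡m (<⇒≤ p))) (push-large ps))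

rem-ins : ∀ {n} i {M} {w : Vec ℕ n} → i ≤ n → All (_< M) w → rem i (ins i M w) ≡ w
rem-ins zero    i≤n       ps = push-large ps
rem-ins (suc i) {w = x ∷ w} (s≤s i≤n) (p ∷ ps) = trans (rem-∷ i x (ins i _ w)) (cong (x ∷_) (rem-ins i i≤n ps))

cnt-small : ∀ {n} N j {w : Vec ℕ n} → All (_< N) w → cnt N j w ≡ n ∸ j
cnt-small N zero    []       = refl
cnt-small N (suc j) []       = refl
cnt-small N zero    (p ∷ ps) = cong₂ _+_ (nm-< p) (cnt-small _ 0 (VAll.map (λ q → ≤-trans q (m≤m⊔n N _)) ps))
cnt-small N (suc j) (p ∷ ps) = cnt-small _ j (VAll.map (λ q → ≤-trans q (m≤m⊔n N _)) ps)

cnt-ins : ∀ {n} N i {M} {w : Vec ℕ n} → i ≤ n → All (_< M) w → cnt N (suc i) (ins i M w) ≡ n ∸ i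
cnt-ins N zero    i≤n       ps       = cnt-small _ 0 (VAll.map (λ q → ≤-trans (m≤n⇒m≤1+n q) (m≤n⊔m N _)) ps)
cnt-ins N (suc i) (s≤s i≤n) (p ∷ ps) = cnt-ins _ i i≤n ps

cnt≤ : ∀ {n} N j (w : Vec ℕ n) → cnt N j w ≤ n ∸ j
cnt≤ N j       []      = z≤n
cnt≤ N zero    (x ∷ w) = +-mono-≤ (nm≤1 N x) (cnt≤ _ 0 w)
cnt≤ N (suc j) (x ∷ w) = cnt≤ _ j w

cnt-Lr : ∀ {n} N i j (w : Vec ℕ n) → Lr N i w → j ≤ i → cnt N j w < n ∸ j
cnt-Lr N zero    zero    (x ∷ w) l j≤i = s≤s (≤-trans (≤-reflexive (cong (_+ cnt (N ⊔ suc x) 0 w) (nm-≥ l))) (cnt≤ _ 0 w))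
cnt-Lr N (suc i) zero    (x ∷ w) l j≤i = s≤s (≤-trans (+-monoˡ-≤ (cnt (N ⊔ suc x) 0 w) (nm≤1 N x)) (cnt-Lr _ i 0 w l z≤n))
cnt-Lr N (suc i) (suc j) (x ∷ w) l j≤i = cnt-Lr _ i j w l (≤-pred j≤i)

S : ∀ {n} → Code n → Fun n
S x = schub (wd x)

S-Sch : ∀ {n} (x : Code n) → Sch (wd x) (S x)
S-Sch x = schub-Sch (wd x) (wd-Dist x)

toℕ≤ : ∀ {n} (i : Fin (suc n)) → toℕ i ≤ n
toℕ≤ i = ≤-pred (toℕ<n i)

Lr-◂ : ∀ {n} (i : Fin (suc n)) (x : Code n) → Lr 0 (toℕ i) (wd (i ◂ x))
Lr-◂ i x = Lr-ins 0 (toℕ i) (toℕ≤ i) z≤n (wd-< x)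

-- All n - i positions behind the largest value are counted, which gives the exponent; and as no
-- larger value follows, the cascade of `rem` just deletes it.
S-top : ∀ {n} (i : Fin (suc n)) (x : Code n) e → S (i ◂ x) (ins (toℕ i) (n ∸ toℕ i) e) ≡ S x e
S-top {n} i x e = trans (cong (λ z → S (i ◂ x) (ins (toℕ i) z e)) (sym (cnt-ins 0 (toℕ i) (toℕ≤ i) (wd-< x))))
  (Sch-functional (Sch-word (rem-ins (toℕ i) (toℕ≤ i) (wd-< x)) (Sch-top (S-Sch (i ◂ x)) (toℕ i) (Lr-◂ i x))) (S-Sch x) e)

S-deg : ∀ {n} (x : Code n) j e → S x e ≢ 0ℤ → ex e j ≤ n ∸ suc j
S-deg x j e h = ≤-trans (Sch-deg (S-Sch x) j e h) (cnt≤ 0 (suc j) (wd x))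

-- Among the n - j positions behind j, position i holds the largest value and is not counted.
S-deg-below : ∀ {n} (i : Fin (suc n)) (x : Code n) j e → j < toℕ i → S (i ◂ x) e ≢ 0ℤ → ex e j < n ∸ j
S-deg-below i x j e j<i h = ≤-trans (s≤s (Sch-deg (S-Sch (i ◂ x)) j e h)) (cnt-Lr 0 (toℕ i) (suc j) (wd (i ◂ x)) (Lr-◂ i x) j<i)

S-off : ∀ {n} (i : Fin (suc n)) (x : Code n) j e → j < toℕ i → S (i ◂ x) (ins j (n ∸ j) e) ≡ 0ℤ
S-off {n} i x j e j<i with S (i ◂ x) (ins j (n ∸ j) e) ℤ.≟ 0ℤ
... | yes p = p
... | no p  = contradiction (sym (ex-ins j (n ∸ j) e (≤-trans (<⇒≤ j<i) (toℕ≤ i)))) (>⇒≢ (S-deg-below i x j _ j<i p))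

enum : ∀ n → List (Code n)
enum zero    = ε ∷ []
enum (suc n) = cartesianProductWith _◂_ (allFin (suc n)) (enum n)

◂-injective : ∀ {n} {i j : Fin (suc n)} {x y : Code n} → i ◂ x ≡ j ◂ y → i ≡ j × x ≡ y
◂-injective refl = refl , refl

enum-unique : ∀ n → Unique (enum n)
enum-unique zero    = LAll.[] ∷ []
enum-unique (suc n) = cartesianProductWith⁺ _◂_ ◂-injective (allFin⁺ (suc n)) (enum-unique n)

∈-enum : ∀ {n} (x : Code n) → x ∈ enum n
∈-enum ε       = here refl
∈-enum (i ◂ x) = ∈-cartesianProductWith⁺ _◂_ (∈-allFin i) (∈-enum x)

comb : ∀ {n} → (Code n → ℤ) → Fun n
comb {n} C e = ΣL (enum n) (λ x → C x ℤ.* S x e)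

*-nonzero : ∀ x y → x ℤ.* y ≢ 0ℤ → x ≢ 0ℤ × y ≢ 0ℤ
*-nonzero x y h = (λ { refl → h (ℤₚ.*-zeroˡ y) }) , (λ { refl → h (ℤₚ.*-zeroʳ x) })

comb-nonzero : ∀ {n} (C : Code n → ℤ) e → comb C e ≢ 0ℤ → ∃ λ x → C x ≢ 0ℤ × S x e ≢ 0ℤ
comb-nonzero {n} C e h with ΣL-nonzero (enum n) _ h
... | x , _ , p = x , *-nonzero (C x) (S x e) p

comb-+ : ∀ {n} (C C′ : Code n → ℤ) e → comb (λ x → C x ℤ.+ C′ x) e ≡ comb C e ℤ.+ comb C′ e
comb-+ {n} C C′ e = trans (ΣL-cong (enum n) (λ x → ℤₚ.*-distribʳ-+ (S x e) (C x) (C′ x)))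
  (ΣL-+ (enum n) (λ x → C x ℤ.* S x e) (λ x → C′ x ℤ.* S x e))

-- Triangularity: codes with the largest value further right do not reach this exponent (`S-off`),
-- and those with it further left are excluded by hypothesis.
comb-top : ∀ {n} (C : Code (suc n) → ℤ) i → (∀ j x → toℕ j < toℕ i → C (j ◂ x) ≡ 0ℤ) →
  ∀ e → comb C (ins (toℕ i) (n ∸ toℕ i) e) ≡ comb (λ x → C (i ◂ x)) e
comb-top {n} C i h e = trans (ΣL-product _◂_ (allFin (suc n)) (enum n) _)
  (trans (ΣL-single i (allFin⁺ (suc n)) (∈-allFin i) off) (ΣL-cong (enum n) (λ x → cong (C (i ◂ x) ℤ.*_) (S-top i x e))))
  where
  off : ∀ j → j ≢ i → ΣL (enum n) (λ x → C (j ◂ x) ℤ.* S (j ◂ x) (ins (toℕ i) (n ∸ toℕ i) e)) ≡ 0ℤ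
  off j j≢i with <-cmp (toℕ j) (toℕ i)
  ... | tri< l _ _ = ΣL-zero (enum n) (λ x _ → *-zeroˡ′ _ (h j x l))
  ... | tri≈ _ p _ = contradiction (toℕ-injective p) j≢i
  ... | tri> _ _ g = ΣL-zero (enum n) (λ x _ → *-zeroʳ′ (C (j ◂ x)) (S-off j x (toℕ i) e g))

Injective-comb : ℕ → Set
Injective-comb n = ∀ (C : Code n → ℤ) → (∀ e → comb C e ≡ 0ℤ) → ∀ x → C x ≡ 0ℤ

-- Injectivity in n variables is a parameter because `comb-injective` calls this within its own
-- induction. The bound t is there for `comb-size`, which knows the vanishing only at positions
-- before the last.
leading-zero′ : ∀ {n} → Injective-comb n → ∀ (C : Code (suc n) → ℤ) t →
  (∀ (j : Fin (suc n)) → toℕ j < t → ∀ e → comb C (ins (toℕ j) (n ∸ toℕ j) e) ≡ 0ℤ) →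
  ∀ i → toℕ i < t → ∀ x → C (i ◂ x) ≡ 0ℤ
leading-zero′ {n} inj C (suc t) h i i<t with toℕ i ℕ.≟ t
... | no i≢t  = leading-zero′ inj C t (λ j j<t → h j (m≤n⇒m≤1+n j<t)) i (≤∧≢⇒< (≤-pred i<t) i≢t)
... | yes i≡t = inj (λ x → C (i ◂ x)) (λ e → trans (sym (comb-top C i below e)) (h i i<t e))
  where
  below : ∀ j x → toℕ j < toℕ i → C (j ◂ x) ≡ 0ℤ
  below j x j<i = leading-zero′ inj C t (λ j′ l → h j′ (m≤n⇒m≤1+n l)) j (subst (toℕ j <_) i≡t j<i) x

comb-injective : ∀ n → Injective-comb n
comb-injective zero    C h ε       = trans (sym (trans (ℤₚ.+-identityʳ _) (ℤₚ.*-identityʳ (C ε)))) (h [])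
comb-injective (suc n) C h (i ◂ x) = leading-zero′ (comb-injective n) C (suc n) (λ j _ e → h _) i (toℕ<n i) x

leading-zero : ∀ {n} (C : Code (suc n) → ℤ) t →
  (∀ (j : Fin (suc n)) → toℕ j < t → ∀ e → comb C (ins (toℕ j) (n ∸ toℕ j) e) ≡ 0ℤ) →
  ∀ i → toℕ i < t → ∀ x → C (i ◂ x) ≡ 0ℤ
leading-zero {n} = leading-zero′ (comb-injective n)

-- Combinations supported in a smaller staircase

-- The last moved point: a largest value standing last is fixed and dropped. The identity gets 0,
-- hence the `1 ⊔ size x` in `FS-size`.
size : ∀ {n} → Code n → ℕ
size ε               = 0
size {suc n} (i ◂ x) with toℕ i ℕ.≟ n
... | yes _ = size x
... | no  _ = suc n

size≤ : ∀ {n} (x : Code n) → size x ≤ n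
size≤ ε               = z≤n
size≤ {suc n} (i ◂ x) with toℕ i ℕ.≟ n
... | yes _ = m≤n⇒m≤1+n (size≤ x)
... | no  _ = ≤-refl

ex-ins-< : ∀ {n} i m (e : Vec ℕ n) j → i ≤ n → j < i → ex (ins i m e) j ≡ ex e j
ex-ins-< (suc i) m (x ∷ e) zero    (s≤s p) q = refl
ex-ins-< (suc i) m (x ∷ e) (suc j) (s≤s p) q = ex-ins-< i m e j p (≤-pred q)

ex-ins-≥ : ∀ {n} i m (e : Vec ℕ n) j → i ≤ n → i ≤ j → ex (ins i m e) (suc j) ≡ ex e j
ex-ins-≥ zero    m e       j       p       q = refl
ex-ins-≥ (suc i) m (x ∷ e) (suc j) (s≤s p) q = ex-ins-≥ i m e j p (≤-pred q)

ex-outside : ∀ {n} (e : Vec ℕ n) j → n ≤ j → ex e j ≡ 0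
ex-outside []      j       p = refl
ex-outside (x ∷ e) (suc j) p = ex-outside e j (≤-pred p)

-- The monomials divide x_1^(M-1) x_2^(M-2) ...; asking this of positive exponents only admits any
-- number of further variables with exponent 0.
Staircase : ∀ {n} → ℕ → Fun n → Set
Staircase M F = ∀ e → F e ≢ 0ℤ → ∀ i → 0 < ex e i → ex e i + suc i ≤ M

∸+suc : ∀ {j n} → j ≤ n → n ∸ j + suc j ≡ suc n
∸+suc {j} {n} p = trans (+-suc (n ∸ j) j) (cong suc (m∸n+n≡m p))

Staircase-leading : ∀ {n} M → M < suc n → {F : Fun (suc n)} → Staircase M F →
  ∀ (j : Fin (suc n)) → toℕ j < n → ∀ e → F (ins (toℕ j) (n ∸ toℕ j) e) ≡ 0ℤ
Staircase-leading {n} M M<n {F} h j j<n e with F (ins (toℕ j) (n ∸ toℕ j) e) ℤ.≟ 0ℤ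
... | yes z = z
... | no z  = contradiction (≤-trans (≤-reflexive (sym (∸+suc (toℕ≤ j))))
    (subst (λ s → 0 < s → s + suc (toℕ j) ≤ M) (ex-ins (toℕ j) (n ∸ toℕ j) e (toℕ≤ j)) (h _ z (toℕ j)) (m<n⇒0<n∸m j<n))) (<⇒≱ M<n)

-- In n + 1 variables with M ≤ n, the exponent n - j at position j < n would need n + 1 ≤ M, so
-- these leading coefficients vanish, and with them all codes whose largest value is not last. The
-- other codes fix n + 1, and exponent 0 in the last variable reduces them to n variables.
comb-size : ∀ {n} M (C : Code n → ℤ) → Staircase M (comb C) → ∀ x → C x ≢ 0ℤ → size x ≤ M
comb-size {zero}  M C h ε       c = z≤n
comb-size {suc n} M C h (i ◂ x) c with suc n ℕ.≤? M
... | yes p = ≤-trans (size≤ (i ◂ x)) p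
... | no p with toℕ i ℕ.≟ n
...   | no i≢n = contradiction (leading-zero C n (Staircase-leading M (≰⇒> p) {comb C} h) i (≤∧≢⇒< (toℕ≤ i) i≢n) x) c
...   | yes i≡n = comb-size M (λ y → C (i ◂ y)) restricted x c
  where
  restricted : Staircase M (comb (λ y → C (i ◂ y)))
  restricted e f j pos = subst (λ s → s + suc j ≤ M) same (h _ (λ z → f (trans (sym (comb-top C i below e)) z)) j (subst (0 <_) (sym same) pos))
    where
    below : ∀ k y → toℕ k < toℕ i → C (k ◂ y) ≡ 0ℤ
    below k y k<i = leading-zero C n (Staircase-leading M (≰⇒> p) {comb C} h) k (≤-trans k<i (toℕ≤ i)) y
    j<n : j < n
    j<n with j ℕ.<? n
    ... | yes q = q
    ... | no q  = contradiction (ex-outside e j (≮⇒≥ q)) (>⇒≢ pos)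
    same : ex (ins (toℕ i) (n ∸ toℕ i) e) j ≡ ex e j
    same = ex-ins-< (toℕ i) _ e j (toℕ≤ i) (subst (j <_) (sym i≡n) j<n)

-- Spanning

del : ∀ {n} → ℕ → Vec ℕ (suc n) → Vec ℕ n
del zero    (x ∷ e)     = e
del (suc t) (x ∷ [])    = []
del (suc t) (x ∷ y ∷ e) = x ∷ del t (y ∷ e)

ins-del : ∀ {n} t (e : Vec ℕ (suc n)) → t ≤ n → ins t (ex e t) (del t e) ≡ e
ins-del zero    (x ∷ e)     p       = refl
ins-del (suc t) (x ∷ y ∷ e) (s≤s p) = cong (x ∷_) (ins-del t (y ∷ e) p)

Box : ∀ {n} → Fun n → Set
Box {n} F = ∀ e → F e ≢ 0ℤ → ∀ i → i < n → ex e i + i < n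

single : ∀ {n} → Fin (suc n) → (Code n → ℤ) → Code (suc n) → ℤ
single i C (j ◂ x) with j Fin.≟ i
... | yes _ = C x
... | no  _ = 0ℤ

single-≡ : ∀ {n} i (C : Code n → ℤ) x → single i C (i ◂ x) ≡ C x
single-≡ i C x with i Fin.≟ i
... | yes _ = refl
... | no p  = contradiction refl p

single-≢ : ∀ {n} i j (C : Code n → ℤ) x → j ≢ i → single i C (j ◂ x) ≡ 0ℤ
single-≢ i j C x p with j Fin.≟ i
... | yes q = contradiction q p
... | no _  = refl

≤∸⇒+< : ∀ {a i n} → i < n → a ≤ n ∸ suc i → a + i < n
≤∸⇒+< {a} {i} {n} i<n p = ≤-trans (≤-reflexive (sym (+-suc a i))) (≤-trans (+-monoˡ-≤ (suc i) p) (≤-reflexive (m∸n+n≡m i<n)))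

-- Sharpens `Box` by one at the positions before t. For t = n + 1 it asks `ex e n + n < n`, so that
-- F vanishes.
Below : ∀ {n} → ℕ → Fun (suc n) → Set
Below {n} t F = ∀ e → F e ≢ 0ℤ → ∀ i → i < t → ex e i + i < n

-- The coefficients of the codes i ◂ x are read off from the coefficient of x_{i+1}^{n-i}
-- once those with smaller i have been subtracted.
span : ∀ {n} (F : Fun n) → Box F → ∃ λ C → ∀ e → F e ≡ comb C e
span-step : ∀ {n} (F : Fun (suc n)) → Box F → ∀ t → t ≤ suc n →
  ∃ λ C → Box (λ e → F e ℤ.- comb C e) × Below t (λ e → F e ℤ.- comb C e)

span {zero} F b = (λ _ → F []) , λ { [] → sym (trans (ℤₚ.+-identityʳ _) (ℤₚ.*-identityʳ (F []))) }
span {suc n} F b with span-step F b (suc n) ≤-refl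
... | C , _ , below = C , zero-diff
  where
  zero-diff : ∀ e → F e ≡ comb C e
  zero-diff e with F e ℤ.- comb C e ℤ.≟ 0ℤ
  ... | yes p = ℤₚ.i-j≡0⇒i≡j (F e) (comb C e) p
  ... | no p  = contradiction (≤-trans (s≤s (m≤n+m n (ex e n))) (below e p n ≤-refl)) (<-irrefl refl)

span-step {n} F b zero t≤ = (λ _ → 0ℤ) , (λ e h → b e (λ z → h (cong₂ ℤ._-_ z (none e)))) , λ _ _ _ ()
  where
  none : ∀ e → comb {suc n} (λ _ → 0ℤ) e ≡ 0ℤ
  none e = ΣL-zero (enum (suc n)) (λ x _ → ℤₚ.*-zeroˡ (S x e))
span-step {n} F b (suc t) t<n with span-step F b t (<⇒≤ t<n)
... | C , box , below with span (λ e → F (ins t (n ∸ t) e) ℤ.- comb C (ins t (n ∸ t) e)) inBox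
  where
  t≤n : t ≤ n
  t≤n = ≤-pred t<n
  inBox : Box (λ e → F (ins t (n ∸ t) e) ℤ.- comb C (ins t (n ∸ t) e))
  inBox e h j j<n with j ℕ.<? t
  -- The box for n variables is smaller by one. Before t the index is kept, so the sharper `below`
  -- is needed; from t on the index shifts by one, which makes up for it.
  ... | yes j<t = subst (λ s → s + j < n) (ex-ins-< t (n ∸ t) e j t≤n j<t) (below _ h j j<t)
  ... | no j≮t  = ≤-pred (≤-trans (≤-reflexive (cong suc (sym (+-suc (ex e j) j))))
                    (subst (λ s → s + suc j < suc n) (ex-ins-≥ t (n ∸ t) e j t≤n (≮⇒≥ j≮t)) (box _ h (suc j) (s≤s j<n))))
...   | C′ , eq = C″ , box′ , below′
  where
  i : Fin (suc n)
  i = fromℕ< t<n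
  i≡t : toℕ i ≡ t
  i≡t = toℕ-fromℕ< t<n
  t≤n : t ≤ n
  t≤n = ≤-pred t<n
  C″ : Code (suc n) → ℤ
  C″ x = C x ℤ.+ single i C′ x
  diff : ∀ e → F e ℤ.- comb C″ e ≡ (F e ℤ.- comb C e) ℤ.- comb (single i C′) e
  diff e = trans (cong (λ z → F e ℤ.- z) (comb-+ C (single i C′) e)) (ring (F e) (comb C e) (comb (single i C′) e))
    where
    ring : ∀ a b c → a ℤ.- (b ℤ.+ c) ≡ (a ℤ.- b) ℤ.- c
    ring = solve-∀
  origin : ∀ e → F e ℤ.- comb C″ e ≢ 0ℤ → (F e ℤ.- comb C e ≢ 0ℤ) ⊎ ∃ λ x → S (i ◂ x) e ≢ 0ℤ
  origin e h with +-nonzero (F e ℤ.- comb C e) (ℤ.- comb (single i C′) e) (λ z → h (trans (diff e) z))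
  ... | inj₁ p = inj₁ p
  ... | inj₂ p with comb-nonzero (single i C′) e (λ z → p (cong ℤ.-_ z))
  ...   | (j ◂ x) , c , s with j Fin.≟ i
  ...     | yes refl = inj₂ (x , s)
  ...     | no j≢i   = contradiction refl c
  box′ : Box (λ e → F e ℤ.- comb C″ e)
  box′ e h j j<n with origin e h
  ... | inj₁ p       = box e p j j<n
  ... | inj₂ (x , s) = ≤∸⇒+< j<n (S-deg (i ◂ x) j e s)
  top-value : ∀ e → F (ins t (n ∸ t) e) ℤ.- comb C″ (ins t (n ∸ t) e) ≡ 0ℤ
  top-value e = trans (diff (ins t (n ∸ t) e)) (trans (cong₂ ℤ._-_ (eq e) top′) (ℤₚ.+-inverseʳ (comb C′ e)))
    where
    top′ : comb (single i C′) (ins t (n ∸ t) e) ≡ comb C′ e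
    top′ = trans (cong (λ z → comb (single i C′) (ins z (n ∸ z) e)) (sym i≡t))
      (trans (comb-top (single i C′) i (λ j x l → single-≢ i j C′ x (λ { refl → <-irrefl refl l })) e)
             (ΣL-cong (enum n) (λ x → cong (ℤ._* S x e) (single-≡ i C′ x))))
  below′ : Below (suc t) (λ e → F e ℤ.- comb C″ e)
  below′ e h j j<st with j ℕ.≟ t
  ... | no j≢t with origin e h
  ...   | inj₁ p       = below e p j (≤∧≢⇒< (≤-pred j<st) j≢t)
  ...   | inj₂ (x , s) = ≤-trans (+-monoˡ-≤ j (S-deg-below i x j e (subst (j <_) (sym i≡t) (≤∧≢⇒< (≤-pred j<st) j≢t)) s))
                           (≤-reflexive (m∸n+n≡m (≤-trans (≤-pred j<st) t≤n)))
  -- Equality would put the leading exponent n - t at position t, where `top-value` has cleared the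
  -- coefficient.
  below′ e h j j<st | yes refl = ≤∧≢⇒< (≤-pred (box′ e h j t<n)) attained
    where
    attained : ex e j + j ≢ n
    attained p = h (subst (λ v → F v ℤ.- comb C″ v ≡ 0ℤ)
      (trans (cong (λ z → ins j z (del j e)) (trans (cong (_∸ j) (sym p)) (m+n∸n≡m (ex e j) j))) (ins-del j e t≤n))
      (top-value (del j e)))

-- Permutations and codes

strip-expAt : ∀ e j → expAt (stripZeros e) j ≡ expAt e j
strip-expAt []      j = refl
strip-expAt (a ∷ e) j = trans (cong (λ s → expAt s j) (strip-∷ a e)) (go a (stripZeros e) j (strip-expAt e))
  where
  go : ∀ a r j → (∀ i → expAt r i ≡ expAt e i) → expAt (stripCons a r) j ≡ expAt (a ∷ e) j
  go zero    []      zero    h = refl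
  go zero    []      (suc j) h = h j
  go (suc a) []      zero    h = refl
  go (suc a) []      (suc j) h = h j
  go zero    (x ∷ r) zero    h = refl
  go zero    (x ∷ r) (suc j) h = h j
  go (suc a) (x ∷ r) zero    h = refl
  go (suc a) (x ∷ r) (suc j) h = h j

strip≡⇒expAt≡ : ∀ {e f} → stripZeros e ≡ stripZeros f → ∀ j → expAt e j ≡ expAt f j
strip≡⇒expAt≡ {e} {f} p j = trans (sym (strip-expAt e j)) (trans (cong (λ s → expAt s j) p) (strip-expAt f j))

coeff-strip : ∀ p {m m′} → stripZeros m ≡ stripZeros m′ → coeff p m ≡ coeff p m′
coeff-strip []            h = refl
coeff-strip ((c , e) ∷ p) {m} {m′} h with ≡-dec ℕ._≟_ (stripZeros e) (stripZeros m) | ≡-dec ℕ._≟_ (stripZeros e) (stripZeros m′)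
... | yes _ | yes _ = cong (λ z → c ℤ.+ z) (coeff-strip p h)
... | yes q | no r  = contradiction (trans q h) r
... | no q  | yes r = contradiction (trans r (sym h)) q
... | no _  | no _  = coeff-strip p h

-- Polynomials in finitely many variables

InVars : ℕ → Poly → Set
InVars N = AllL (λ t → length (proj₂ t) ≤ N)

truncate : ∀ N → Mono → Vec ℕ N
truncate zero    m = []
truncate (suc N) m = expAt m 0 ∷ truncate N (tl m)

strip-truncate : ∀ N e → length e ≤ N → stripZeros (toList (truncate N e)) ≡ stripZeros e
strip-truncate zero    []      p = refl
strip-truncate (suc N) []      p = trans (strip-∷ 0 (toList (truncate N []))) (cong (stripCons 0) (strip-truncate N [] z≤n))
strip-truncate (suc N) (a ∷ e) p = trans (strip-∷ a (toList (truncate N e)))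
  (trans (cong (stripCons a) (strip-truncate N e (≤-pred p))) (sym (strip-∷ a e)))

truncate-cong : ∀ N {e f} → (∀ j → expAt e j ≡ expAt f j) → truncate N e ≡ truncate N f
truncate-cong zero    h = refl
truncate-cong (suc N) {e} {f} h = cong₂ _∷_ (h 0) (truncate-cong N (λ j → trans (sym (expAt-suc e j)) (trans (h (suc j)) (expAt-suc f j))))

coeff-outside : ∀ {N} p → InVars N p → ∀ m → stripZeros (toList (truncate N m)) ≢ stripZeros m → coeff p m ≡ 0ℤ
coeff-outside []            _          m h = refl
coeff-outside {N} ((c , e) ∷ p) (l ∷ᴬ ls) m h with ≡-dec ℕ._≟_ (stripZeros e) (stripZeros m)
... | no _  = coeff-outside p ls m h
... | yes q = contradiction (trans (cong (λ v → stripZeros (toList v)) (truncate-cong N (strip≡⇒expAt≡ {m} {e} (sym q)))) (trans (strip-truncate N e l) q)) h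

-- Exponent lists that do not fit into N variables up to trailing zeros have coefficient 0 on both
-- sides; `cf` tests all others.
≈ᴾ-from-cf : ∀ {N} p q → InVars N p → InVars N q → (∀ (m : Vec ℕ N) → cf p m ≡ cf q m) → p ≈ᴾ q
≈ᴾ-from-cf {N} p q lp lq h m with ≡-dec ℕ._≟_ (stripZeros (toList (truncate N m))) (stripZeros m)
... | yes e = trans (sym (coeff-strip p e)) (trans (h (truncate N m)) (coeff-strip q e))
... | no e  = trans (coeff-outside p lp m e) (sym (coeff-outside q lq m e))

setAt-length : ∀ {N} e k v → length e ≤ N → k < N → length (setAt e k v) ≤ N
setAt-length []      zero    v p       q       = q
setAt-length {suc N} []      (suc k) v p       (s≤s q) = s≤s (setAt-length [] k v z≤n q)
setAt-length (a ∷ e) zero    v p       q       = p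
setAt-length (a ∷ e) (suc k) v (s≤s p) (s≤s q) = s≤s (setAt-length e k v p q)

InVars-map : ∀ {N} {A : Set} (f : A → ℤ × Mono) xs → (∀ x → length (proj₂ (f x)) ≤ N) → InVars N (map f xs)
InVars-map f []       h = []ᴬ
InVars-map f (x ∷ xs) h = h x ∷ᴬ InVars-map f xs h

InVars-ddTerm : ∀ {N} k c e → suc k < N → length e ≤ N → InVars N (ddTerm (suc k) (c , e))
InVars-ddTerm k c e k<N l with expAt e k | expAt e (suc k)
... | a | b with ℕ.compare a b
...   | ℕ.less    _ _ = InVars-map _ _ (λ t → setAt-length (setAt e k _) (suc k) _ (setAt-length e k _ l (<⇒≤ k<N)) k<N)
...   | ℕ.equal   _   = []ᴬ
...   | ℕ.greater _ _ = InVars-map _ _ (λ t → setAt-length (setAt e k _) (suc k) _ (setAt-length e k _ l (<⇒≤ k<N)) k<N)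

InVars-∂ : ∀ {N} k p → suc k < N → InVars N p → InVars N (∂ (suc k) p)
InVars-∂ k []            k<N _         = []ᴬ
InVars-∂ k ((c , e) ∷ p) k<N (l ∷ᴬ ls) = LAllₚ.++⁺ (InVars-ddTerm k c e k<N l) (InVars-∂ k p k<N ls)

InVars-schubAux : ∀ {n} fuel (w : Vec ℕ n) → Dist w → InVars n (schubAux n fuel (toList w))
InVars-schubAux zero       w d = []ᴬ
InVars-schubAux {n} (suc fuel) w d with decr-or-asc w d
... | inj₁ dec rewrite firstAscent-Decr dec = ≤-reflexive (trans (length-map _ (upTo n)) (length-upTo n)) ∷ᴬ []ᴬ
... | inj₂ (k , a) rewrite firstAscent-Asc a | swapAt-toList k w =
  InVars-∂ k _ (Asc⇒< a) (InVars-schubAux fuel (swap k w) (Dist-swap k w d))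

addMono-length : ∀ {N} e f → length e ≤ N → length f ≤ N → length (addMono e f) ≤ N
addMono-length []      f       p       q       = q
addMono-length (a ∷ e) []      p       q       = p
addMono-length (a ∷ e) (b ∷ f) (s≤s p) (s≤s q) = s≤s (addMono-length e f p q)

InVars-* : ∀ {N} p q → InVars N p → InVars N q → InVars N (p *ᴾ q)
InVars-* []            q _         lq = []ᴬ
InVars-* {N} ((c , e) ∷ p) q (l ∷ᴬ lp) lq = LAllₚ.++⁺ (term q lq) (InVars-* p q lp lq)
  where
  term : ∀ q → InVars N q → InVars N (map _ q)
  term []            _         = []ᴬ
  term ((d , f) ∷ q) (m ∷ᴬ lq) = addMono-length e f l m ∷ᴬ term q lq

InVars-scale : ∀ {N} c p → InVars N p → InVars N (scale c p)
InVars-scale c []            _         = []ᴬ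
InVars-scale c ((d , f) ∷ p) (l ∷ᴬ ls) = l ∷ᴬ InVars-scale c p ls

InVars-mono : ∀ {N N′ p} → N ≤ N′ → InVars N p → InVars N′ p
InVars-mono h = LAll.map (λ l → ≤-trans l h)

-- Codes of one-line words, and stability

oneToN-suc : ∀ n → oneToN (suc n) ≡ oneToN n ++ suc n ∷ []
oneToN-suc n = trans (cong (map suc) (sym (upTo-∷ʳ n))) (map-++ suc (upTo n) (n ∷ []))

toList-ins : ∀ {n} M as bs (w : Vec ℕ n) → toList w ≡ as ++ bs → toList (ins (length as) M w) ≡ as ++ M ∷ bs
toList-ins M []       bs w       p    = cong (M ∷_) p
toList-ins M (a ∷ as) bs (x ∷ w) p with ∷-injective p
... | refl , q = cong (x ∷_) (toList-ins M as bs w q)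

encode : ∀ n W → W ↭ oneToN n → ∃ λ (x : Code n) → toList (wd x) ≡ W
encode zero    []      p = ε , refl
encode zero    (a ∷ W) p = contradiction (↭-length p) λ ()
encode (suc n) W       p with ∈-∃++ (∈-resp-↭ (↭-sym p) (subst (suc n ∈_) (sym (oneToN-suc n)) (∈-++⁺ʳ (oneToN n) (here refl))))
... | as , bs , refl with encode n (as ++ bs) (subst (as ++ bs ↭_) (++-identityʳ (oneToN n)) (drop-mid as (oneToN n) (subst (as ++ suc n ∷ bs ↭_) (oneToN-suc n) p)))
...   | x , q = fromℕ< as<n ◂ x , trans (cong (λ i → toList (ins i (suc n) (wd x))) (toℕ-fromℕ< as<n)) (toList-ins (suc n) as bs (wd x) q)
  where
  as<n : length as < suc n
  as<n = s≤s (≤-trans (m≤m+n (length as) (length bs)) (≤-reflexive (trans (sym (length-++ as)) (trans (cong length (sym q)) (length-toList (wd x))))))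

ins-↭ : ∀ {n} i M (w : Vec ℕ n) → toList (ins i M w) ↭ M ∷ toList w
ins-↭ zero    M w       = ↭-refl
ins-↭ (suc i) M []      = ↭-refl
ins-↭ (suc i) M (x ∷ w) = ↭-trans (prep x (ins-↭ i M w)) (_↭_.swap x M ↭-refl)

wd-↭ : ∀ {n} (x : Code n) → toList (wd x) ↭ oneToN n
wd-↭ ε               = ↭-refl
wd-↭ {suc n} (i ◂ x) = ↭-trans (ins-↭ (toℕ i) (suc n) (wd x)) (↭-trans (prep (suc n) (wd-↭ x))
  (↭-trans (∷↭∷ʳ (suc n) (oneToN n)) (↭-reflexive (sym (oneToN-suc n)))))

decode : ∀ {n} → Code n → Perm
decode x = mkPerm (toList (wd x)) (↭-trans (wd-↭ x) (↭-reflexive (cong oneToN (sym (length-toList (wd x))))))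

-- N may exceed the length of the word, the code being padded by fixed points; thus all permutations
-- of an expansion get codes in one `Code N`.
record Represents {N} (w : Perm) (x : Code N) : Set where
  field
    app-eq : ∀ i → at (toList (wd x)) i i ≡ app w i
    cf-eq  : ∀ m → cf (𝔖 w) m ≡ S x m
    inVars : InVars N (𝔖 w)
open Represents

represents-word : ∀ {n} w (x : Code n) → length (word w) ≡ n → toList (wd x) ≡ word w → Represents w x
represents-word w x refl q = record
  { app-eq = λ i → cong (λ W → at W i i) q
  ; cf-eq  = λ m → cong (λ W → cf (schubAux (length (word w)) (suc (length (word w) * length (word w))) W) m) (sym q)
  ; inVars = subst (λ W → InVars (length (word w)) (schubAux _ (suc (length (word w) * length (word w))) W)) q (InVars-schubAux _ (wd x) (wd-Dist x))
  }

at-snoc : ∀ W v i d → (i ≡ suc (length W) → v ≡ d) → at (W ++ v ∷ []) i d ≡ at W i d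
at-snoc []      v zero          d h = refl
at-snoc []      v (suc zero)    d h = h refl
at-snoc []      v (suc (suc i)) d h = refl
at-snoc (x ∷ W) v zero          d h = refl
at-snoc (x ∷ W) v (suc zero)    d h = refl
at-snoc (x ∷ W) v (suc (suc i)) d h = at-snoc W v (suc i) d (λ p → h (cong suc p))

snoc : ∀ {n} → Code n → Code (suc n)
snoc {n} x = fromℕ n ◂ x

toList-ins-end : ∀ {n} M (w : Vec ℕ n) → toList (ins n M w) ≡ toList w ++ M ∷ []
toList-ins-end M []      = refl
toList-ins-end M (x ∷ w) = cong (x ∷_) (toList-ins-end M w)

wd-snoc : ∀ {n} (x : Code n) → wd (snoc x) ≡ ins n (suc n) (wd x)
wd-snoc {n} x = cong (λ i → ins i (suc n) (wd x)) (toℕ-fromℕ n)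

expAt-toList : ∀ {n} (m : Vec ℕ n) j → expAt (toList m) j ≡ ex m j
expAt-toList []      j       = refl
expAt-toList (x ∷ m) zero    = refl
expAt-toList (x ∷ m) (suc j) = expAt-toList m j

strip-snoc0 : ∀ e → stripZeros (e ++ 0 ∷ []) ≡ stripZeros e
strip-snoc0 []      = refl
strip-snoc0 (a ∷ e) = trans (strip-∷ a (e ++ 0 ∷ [])) (trans (cong (stripCons a) (strip-snoc0 e)) (sym (strip-∷ a e)))

expAt-length : ∀ e j → length e ≤ j → expAt e j ≡ 0
expAt-length []      j       p = refl
expAt-length (a ∷ e) (suc j) p = expAt-length e j (≤-pred p)

-- Stability as a case of `S-top`: a largest value in last position has leading exponent n - n = 0.
S-snoc : ∀ {n} (x : Code n) e → S (snoc x) (ins n 0 e) ≡ S x e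
S-snoc {n} x e = trans (cong (S (snoc x)) (cong₂ (λ i k → ins i k e) (sym (toℕ-fromℕ n)) (sym (trans (cong (n ∸_) (toℕ-fromℕ n)) (n∸n≡0 n)))))
  (S-top (fromℕ n) x e)

-- Exponent 0 in the new variable is `S-snoc`. A positive exponent has coefficient 0 on both sides:
-- `𝔖 w` lives in n variables, and `S-deg` gives degree 0 in the last one.
represents-snoc : ∀ {n} w (x : Code n) → Represents w x → Represents w (snoc x)
represents-snoc {n} w x r = record
  { app-eq = λ i → trans (cong (λ v → at (toList v) i i) (wd-snoc x)) (trans (cong (λ W → at W i i) (toList-ins-end (suc n) (wd x)))
      (trans (at-snoc (toList (wd x)) (suc n) i i (λ p → trans (cong suc (sym (length-toList (wd x)))) (sym p))) (app-eq r i)))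
  ; cf-eq  = coefficients
  ; inVars = InVars-mono (n≤1+n n) (inVars r)
  }
  where
  coefficients : ∀ m → cf (𝔖 w) m ≡ S (snoc x) m
  coefficients m with ex m n in eq
  ... | zero = trans (cong (cf (𝔖 w)) (sym m≡)) (trans (coeff-strip (𝔖 w) strip≡) (trans (cf-eq r (del n m)) (trans (sym (S-snoc x (del n m))) (cong (S (snoc x)) m≡))))
    where
    m≡ : ins n 0 (del n m) ≡ m
    m≡ = trans (cong (λ k → ins n k (del n m)) (sym eq)) (ins-del n m ≤-refl)
    strip≡ : stripZeros (toList (ins n 0 (del n m))) ≡ stripZeros (toList (del n m))
    strip≡ = trans (cong stripZeros (toList-ins-end 0 (del n m))) (strip-snoc0 (toList (del n m)))
  ... | suc k = trans (coeff-outside (𝔖 w) (inVars r) (toList m) differ) (sym vanish)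
    where
    differ : stripZeros (toList (truncate n (toList m))) ≢ stripZeros (toList m)
    differ p = contradiction (trans (sym (expAt-length (toList (truncate n (toList m))) n (≤-reflexive (length-toList (truncate n (toList m))))))
      (trans (strip≡⇒expAt≡ {toList (truncate n (toList m))} {toList m} p n) (trans (expAt-toList m n) eq))) λ ()
    vanish : S (snoc x) m ≡ 0ℤ
    vanish with S (snoc x) m ℤ.≟ 0ℤ
    ... | yes z = z
    ... | no z  = contradiction (trans (sym (n≤0⇒n≡0 (≤-trans (S-deg (snoc x) n m z) (≤-reflexive (n∸n≡0 n))))) eq) λ ()

represents : ∀ w d → ∃ λ (x : Code (d + length (word w))) → Represents w x
represents w zero with encode (length (word w)) (word w) (isPerm w)
... | x , q = x , represents-word w x refl q
represents w (suc d) with represents w d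
... | x , r = snoc x , represents-snoc w x r

represents-≤ : ∀ w N → length (word w) ≤ N → ∃ λ (x : Code N) → Represents w x
represents-≤ w N p = subst (λ k → ∃ λ (x : Code k) → Represents w x) (m∸n+n≡m p) (represents w (N ∸ length (word w)))

decode-represents : ∀ {n} (x : Code n) → Represents (decode x) x
decode-represents x = represents-word (decode x) x (length-toList (wd x)) refl

cf-sumSchub : ∀ {n} L (m : Vec ℕ n) → cf (sumSchub L) m ≡ ΣL L (λ t → proj₂ t ℤ.* cf (𝔖 (proj₁ t)) m)
cf-sumSchub []            m = refl
cf-sumSchub ((w , c) ∷ L) m = trans (cf-++ (scale c (𝔖 w)) (sumSchub L) m) (cong₂ ℤ._+_ (cf-scale c (𝔖 w) m) (cf-sumSchub L m))

-- Forward stability and non-left-to-right-maxima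

at-ex : ∀ {n} (w : Vec ℕ n) q d → q < n → at (toList w) (suc q) d ≡ ex w q
at-ex (x ∷ w) zero    d p       = refl
at-ex (x ∷ w) (suc q) d (s≤s p) = at-ex w q d p

at-outside : ∀ {n} (w : Vec ℕ n) q d → n ≤ q → at (toList w) (suc q) d ≡ d
at-outside []      q       d p       = refl
at-outside (x ∷ w) (suc q) d (s≤s p) = at-outside w q d p

ex-All : ∀ {n} {P : ℕ → Set} {w : Vec ℕ n} → All P w → ∀ q → q < n → P (ex w q)
ex-All (p ∷ ps) zero    l       = p
ex-All (p ∷ ps) (suc q) (s≤s l) = ex-All ps q l

last-fixed : ∀ {n} (i : Fin (suc n)) (x : Code n) → toℕ i ≡ n → ∀ j → at (toList (wd (i ◂ x))) j j ≡ at (toList (wd x)) j j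
last-fixed {n} i x p j = trans (cong (λ k → at (toList (ins k (suc n) (wd x))) j j) p)
  (trans (cong (λ W → at W j j) (toList-ins-end (suc n) (wd x)))
    (at-snoc (toList (wd x)) (suc n) j j (λ q → trans (cong suc (sym (length-toList (wd x)))) (sym q))))

size-fixed : ∀ {n} (x : Code n) i → size x < i → at (toList (wd x)) i i ≡ i
size-fixed ε i p = refl
size-fixed {suc n} (i ◂ x) j p with toℕ i ℕ.≟ n
... | yes q = trans (last-fixed i x q j) (size-fixed x j p)
size-fixed {suc n} (i ◂ x) (suc j) p | no _ = at-outside (wd (i ◂ x)) j (suc j) (≤-pred p)

ex-ins-last : ∀ {n} i {M} {w : Vec ℕ n} → i < n → All (_< M) w → ex (ins i M w) n < M
ex-ins-last {suc n} zero    l       ps       = ex-All ps n ≤-refl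
ex-ins-last {suc n} (suc i) (s≤s l) (p ∷ ps) = ex-ins-last i l ps

size-moved : ∀ {n} (x : Code n) k → size x ≡ suc k → at (toList (wd x)) (suc k) (suc k) ≢ suc k
size-moved {suc n} (i ◂ x) k p h with toℕ i ℕ.≟ n
... | yes q = size-moved x k p (trans (sym (last-fixed i x q (suc k))) h)
... | no q with p
...   | refl = <⇒≢ (ex-ins-last (toℕ i) (≤∧≢⇒< (toℕ≤ i) q) (wd-< x)) (trans (sym (at-ex (wd (i ◂ x)) n (suc n) ≤-refl)) h)

lastNonFixed-fixed : ∀ K xs j → lastNonFixed K xs < suc K + j → at xs (suc j) (suc K + j) ≡ suc K + j
lastNonFixed-fixed K []       j       p = refl
lastNonFixed-fixed K (x ∷ xs) j       p with x ℕ.≟ suc K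
lastNonFixed-fixed K (x ∷ xs) zero    p | yes q = trans q (sym (+-identityʳ (suc K)))
lastNonFixed-fixed K (x ∷ xs) zero    p | no q  = contradiction (≤-trans (s≤s (m≤m⊔n (suc K) (lastNonFixed (suc K) xs))) p) (<⇒≱ (s≤s (≤-reflexive (+-identityʳ (suc K)))))
lastNonFixed-fixed K (x ∷ xs) (suc j) p | yes q rewrite +-suc K j = lastNonFixed-fixed (suc K) xs j p
lastNonFixed-fixed K (x ∷ xs) (suc j) p | no q  rewrite +-suc K j = lastNonFixed-fixed (suc K) xs j (≤-trans (s≤s (m≤n⊔m (suc K) (lastNonFixed (suc K) xs))) p)

lastNonFixed-moved : ∀ K xs v → lastNonFixed K xs ≡ suc v → ∃ λ j → v ≡ K + j × at xs (suc j) (suc v) ≢ suc v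
lastNonFixed-moved K (x ∷ xs) v p with x ℕ.≟ suc K
... | yes q with lastNonFixed-moved (suc K) xs v p
...   | j , r , s = suc j , trans r (sym (+-suc K j)) , s
lastNonFixed-moved K (x ∷ xs) v p | no q with ⊔-sel (suc K) (lastNonFixed (suc K) xs)
...   | inj₁ r = 0 , trans (suc-injective (trans (sym p) r)) (sym (+-identityʳ K)) , λ z → q (trans z (trans (sym p) r))
...   | inj₂ r with lastNonFixed-moved (suc K) xs v (trans (sym r) p)
...     | j , s , t = suc j , trans s (sym (+-suc K j)) , t

-- `lastNonFixed` and `size` are both the last moved point: moved if positive, with only fixed
-- points behind it.
FS-size : ∀ {N} w (x : Code N) → Represents w x → FS w ≡ 1 ⊔ size x
FS-size w x r = cong (1 ⊔_) same
  where
  same : lastNonFixed 0 (word w) ≡ size x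
  same with <-cmp (lastNonFixed 0 (word w)) (size x)
  ... | tri≈ _ p _ = p
  ... | tri< l _ _ with size x in eq
  ...   | suc k = contradiction (trans (app-eq r (suc k)) (lastNonFixed-fixed 0 (word w) k l)) (size-moved x k eq)
  same | tri> _ _ g with lastNonFixed 0 (word w) in eq
  ...   | suc v with lastNonFixed-moved 0 (word w) v eq
  ...     | j , refl , h = contradiction (trans (sym (app-eq r (suc v))) (size-fixed x (suc v) g)) h

cnt-snoc : ∀ {n} N j {M} {w : Vec ℕ n} → N ≤ M → All (_< M) w → cnt N j (ins n M w) ≡ cnt N j w
cnt-snoc N zero    p []       = trans (+-identityʳ _) (nm-≥ p)
cnt-snoc N (suc j) p []       = refl
cnt-snoc N zero    p (_∷_ {x = x} q qs) = cong (λ z → nm N x + z) (cnt-snoc _ 0 (⊔-lub p q) qs)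
cnt-snoc N (suc j) p (q ∷ qs) = cnt-snoc _ j (⊔-lub p q) qs

-- Trailing fixed points are left-to-right maxima, so the counted positions lie, counted from 1,
-- between i + 2 and `size x`.
cnt-size : ∀ {n} (x : Code n) i → 0 < cnt 0 (suc i) (wd x) → cnt 0 (suc i) (wd x) + suc i ≤ size x
cnt-size {suc n} (j ◂ x) i p with toℕ j ℕ.≟ n
... | yes q rewrite q | cnt-snoc 0 (suc i) z≤n (wd-< x) = cnt-size x i p
... | no _ = ≤-trans (+-monoˡ-≤ (suc i) (cnt≤ 0 (suc i) (wd (j ◂ x)))) (≤-reflexive (m∸n+n≡m i<n))
  where
  i<n : suc i ≤ suc n
  i<n with suc i ℕ.≤? suc n
  ... | yes l = l
  ... | no l  = contradiction (≤-trans p (≤-trans (cnt≤ 0 (suc i) (wd (j ◂ x))) (≤-reflexive (m≤n⇒m∸n≡0 (<⇒≤ (≰⇒> l)))))) λ ()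

small-¬Lr : ∀ {n} N j {w : Vec ℕ n} → All (_< N) w → ¬ Lr N j w
small-¬Lr N zero    (p ∷ ps) l = <⇒≱ p l
small-¬Lr N (suc j) (p ∷ ps) l = small-¬Lr _ j (VAll.map (λ q → ≤-trans q (m≤m⊔n N _)) ps) l

Lr-ins-last : ∀ {n} N i {M} {w : Vec ℕ n} → i < n → All (_< M) w → ¬ Lr N n (ins i M w)
Lr-ins-last {suc n} N zero    l       ps       h = small-¬Lr _ n (VAll.map (λ q → ≤-trans (m≤n⇒m≤1+n q) (m≤n⊔m N _)) ps) h
Lr-ins-last {suc n} N (suc i) (s≤s l) (p ∷ ps) h = Lr-ins-last _ i l ps h

Lr-snoc : ∀ {n} N k {M} (w : Vec ℕ n) → k < n → Lr N k (ins n M w) → Lr N k w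
Lr-snoc N zero    (x ∷ w) l       h = h
Lr-snoc N (suc k) (x ∷ w) (s≤s l) h = Lr-snoc _ k w l h

-- The last moved position stands behind the largest moved value. This decides the peaks of degree 0
-- in `peak-value≤1`.
size-¬Lr : ∀ {n} (x : Code n) k → size x ≡ suc k → ¬ Lr 0 k (wd x)
size-¬Lr {suc n} (i ◂ x) k p h with toℕ i ℕ.≟ n
... | yes q rewrite q = size-¬Lr x k p (Lr-snoc 0 k (wd x) (≤-trans (≤-reflexive (sym p)) (size≤ x)) h)
... | no q with p
...   | refl = Lr-ins-last 0 (toℕ i) (≤∧≢⇒< (toℕ≤ i) q) (wd-< x) h

-- The positions counted by Λ

NonLr : ∀ {n} → ℕ → ℕ → Vec ℕ n → Set
NonLr N q       []      = ⊥
NonLr N zero    (x ∷ w) = x < N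
NonLr N (suc q) (x ∷ w) = NonLr (N ⊔ suc x) q w

NonLr-sound : ∀ {n} N q (w : Vec ℕ n) → Dist w → NonLr N q w → q < n × (ex w q < N ⊎ ∃ λ q′ → q′ < q × ex w q < ex w q′)
NonLr-sound N zero    (x ∷ w) d        h = s≤s z≤n , inj₁ h
NonLr-sound N (suc q) (x ∷ w) (xs , d) h with NonLr-sound (N ⊔ suc x) q w d h
... | l , inj₂ (q′ , l′ , r) = s≤s l , inj₂ (suc q′ , s≤s l′ , r)
... | l , inj₁ r with ⊔-sel N (suc x)
...   | inj₁ s = s≤s l , inj₁ (subst (ex w q <_) s r)
...   | inj₂ s = s≤s l , inj₂ (0 , s≤s z≤n , ≤∧≢⇒< (≤-pred (subst (ex w q <_) s r)) (λ z → ex-All xs q l (sym z)))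

NonLr-complete : ∀ {n} N q (w : Vec ℕ n) → q < n → (ex w q < N ⊎ ∃ λ q′ → q′ < q × ex w q < ex w q′) → NonLr N q w
NonLr-complete N zero    (x ∷ w) l       (inj₁ p) = p
NonLr-complete N (suc q) (x ∷ w) (s≤s l) (inj₁ p) = NonLr-complete _ q w l (inj₁ (≤-trans p (m≤m⊔n N (suc x))))
NonLr-complete N (suc q) (x ∷ w) (s≤s l) (inj₂ (zero , _ , p)) = NonLr-complete _ q w l (inj₁ (≤-trans (m≤n⇒m≤1+n p) (m≤n⊔m N (suc x))))
NonLr-complete N (suc q) (x ∷ w) (s≤s l) (inj₂ (suc q′ , s≤s l′ , p)) = NonLr-complete _ q w l (inj₂ (q′ , l′ , p))

positions : ∀ {n} → ℕ → ℕ → ℕ → Vec ℕ n → List ℕ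
positions N K j       []      = []
positions N K zero    (x ∷ w) with x ℕ.<? N
... | yes _ = K ∷ positions (N ⊔ suc x) (suc K) 0 w
... | no  _ = positions (N ⊔ suc x) (suc K) 0 w
positions N K (suc j) (x ∷ w) = positions (N ⊔ suc x) (suc K) j w

positions-length : ∀ {n} N K j (w : Vec ℕ n) → length (positions N K j w) ≡ cnt N j w
positions-length N K j       []      = refl
positions-length N K zero    (x ∷ w) with x ℕ.<? N
... | yes _ = cong suc (positions-length _ (suc K) 0 w)
... | no  _ = positions-length _ (suc K) 0 w
positions-length N K (suc j) (x ∷ w) = positions-length _ (suc K) j w

positions⁻ : ∀ {n} N K j (w : Vec ℕ n) {p} → p ∈ positions N K j w → ∃ λ q → p ≡ K + q × j ≤ q × NonLr N q w
positions⁻ N K zero (x ∷ w) h with x ℕ.<? N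
positions⁻ N K zero (x ∷ w) (here refl) | yes l = 0 , sym (+-identityʳ K) , z≤n , l
positions⁻ N K zero (x ∷ w) (there h)   | yes l with positions⁻ _ (suc K) 0 w h
... | q , r , _ , s = suc q , trans r (sym (+-suc K q)) , z≤n , s
positions⁻ N K zero (x ∷ w) h           | no _ with positions⁻ _ (suc K) 0 w h
... | q , r , _ , s = suc q , trans r (sym (+-suc K q)) , z≤n , s
positions⁻ N K (suc j) (x ∷ w) h with positions⁻ _ (suc K) j w h
... | q , r , l , s = suc q , trans r (sym (+-suc K q)) , s≤s l , s

positions⁺ : ∀ {n} N K j (w : Vec ℕ n) q → j ≤ q → NonLr N q w → K + q ∈ positions N K j w
positions⁺ N K zero (x ∷ w) q l h with x ℕ.<? N
positions⁺ N K zero (x ∷ w) zero    l h | yes _ = here (+-identityʳ K)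
positions⁺ N K zero (x ∷ w) (suc q) l h | yes _ = there (subst (_∈ positions (N ⊔ suc x) (suc K) 0 w) (sym (+-suc K q)) (positions⁺ _ (suc K) 0 w q z≤n h))
positions⁺ N K zero (x ∷ w) zero    l h | no p  = contradiction h p
positions⁺ N K zero (x ∷ w) (suc q) l h | no _  = subst (_∈ positions (N ⊔ suc x) (suc K) 0 w) (sym (+-suc K q)) (positions⁺ _ (suc K) 0 w q z≤n h)
positions⁺ N K (suc j) (x ∷ w) (suc q) (s≤s l) h = subst (_∈ positions (N ⊔ suc x) (suc K) j w) (sym (+-suc K q)) (positions⁺ _ (suc K) j w q l h)

positions-unique : ∀ {n} N K j (w : Vec ℕ n) → Unique (positions N K j w)
positions-unique N K j       []      = []
positions-unique N K zero    (x ∷ w) with x ℕ.<? N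
... | yes _ = LAll.tabulate later ∷ positions-unique _ (suc K) 0 w
  where
  later : ∀ {p} → p ∈ positions (N ⊔ suc x) (suc K) 0 w → K ≢ p
  later h with positions⁻ (N ⊔ suc x) (suc K) 0 w h
  ... | q , refl , _ = <⇒≢ (s≤s (m≤m+n K q))
... | no  _ = positions-unique _ (suc K) 0 w
positions-unique N K (suc j) (x ∷ w) = positions-unique _ (suc K) j w

app-inside : ∀ {N w} {x : Code N} → Represents w x → ∀ p → p < N → app w (suc p) ≡ ex (wd x) p
app-inside {x = x} r p l = trans (sym (app-eq r (suc p))) (at-ex (wd x) p (suc p) l)

app-outside : ∀ {N w} {x : Code N} → Represents w x → ∀ p → N ≤ p → app w (suc p) ≡ suc p
app-outside {x = x} r p l = trans (sym (app-eq r (suc p))) (at-outside (wd x) p (suc p) l)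

-- Outside 1, ..., N the map is the identity and all earlier values are smaller, so j lies inside
-- the word.
HasInv⁻ : ∀ {N} w (x : Code N) → Represents w x → ∀ j → HasInv w j → ∃ λ q → j ≡ + suc q × NonLr 0 q (wd x)
HasInv⁻ w x r (+ zero)   (-[1+ k ] , _ , ())
HasInv⁻ w x r (+ zero)   (+ k , +<+ () , _)
HasInv⁻ w x r -[1+ k ]   (-[1+ l ] , p , q) = contradiction q (ℤₚ.<-asym p)
HasInv⁻ w x r (+ suc q)  (-[1+ l ] , _ , ())
HasInv⁻ w x r (+ suc q)  (+ zero , _ , +<+ ())
HasInv⁻ {N} w x r (+ suc q) (+ suc q′ , +<+ (s≤s q′<q) , +<+ h) = q , refl , nonLr
  where
  nonLr : NonLr 0 q (wd x)
  nonLr with q ℕ.<? N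
  ... | yes l = NonLr-complete 0 q (wd x) l (inj₂ (q′ , q′<q , subst₂ _<_ (app-inside r q l) (app-inside r q′ (<-trans q′<q l)) h))
  ... | no l with q′ ℕ.<? N
  ...   | yes l′ = contradiction (subst₂ _<_ (app-outside r q (≮⇒≥ l)) (app-inside r q′ l′) h)
                     (<⇒≱ (≤-trans (s≤s (≤-pred (ex-All (wd-< x) q′ l′))) (s≤s (m≤n⇒m≤1+n (≮⇒≥ l)))))
  ...   | no l′  = contradiction (subst₂ _<_ (app-outside r q (≮⇒≥ l)) (app-outside r q′ (≮⇒≥ l′)) h) (<-asym (s≤s q′<q))

HasInv⁺ : ∀ {N} w (x : Code N) → Represents w x → ∀ q → NonLr 0 q (wd x) → HasInv w (+ suc q)
HasInv⁺ {N} w x r q h with NonLr-sound 0 q (wd x) (wd-Dist x) h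
... | l , inj₂ (q′ , q′<q , lt) = + suc q′ , +<+ (s≤s q′<q) , +<+ (subst₂ _<_ (sym (app-inside r q l)) (sym (app-inside r q′ (<-trans q′<q l))) lt)

-- Positions in the integers are 1-based and those ≤ 0 carry no inversion.
start : ℤ → ℕ
start (+ suc k) = k
start (+ zero)  = 0
start -[1+ _ ]  = 0

start-≤ : ∀ i q → start i ≤ q → i ℤ.≤ + suc q
start-≤ (+ suc k) q p = +≤+ (s≤s p)
start-≤ (+ zero)  q p = +≤+ z≤n
start-≤ -[1+ _ ]  q p = -≤+

≤-start : ∀ i q → i ℤ.≤ + suc q → start i ≤ q
≤-start (+ suc k) q (+≤+ (s≤s p)) = p
≤-start (+ zero)  q p = z≤n
≤-start -[1+ _ ]  q p = z≤n

Λ-exists : ∀ {N} w (x : Code N) → Represents w x → ∀ i → IsΛ w i (cnt 0 (start i) (wd x))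
Λ-exists w x r i = map (λ p → + suc p) (positions 0 0 (start i) (wd x))
  , map⁺ (λ { refl → refl }) (positions-unique 0 0 (start i) (wd x))
  , (λ j → mk⇔ to from)
  , trans (length-map _ (positions 0 0 (start i) (wd x))) (positions-length 0 0 (start i) (wd x))
  where
  to : ∀ {j} → j ∈ map (λ p → + suc p) (positions 0 0 (start i) (wd x)) → (i ℤ.≤ j) × HasInv w j
  to h with ∈-map⁻ (λ p → + suc p) h
  ... | p , p∈ , refl with positions⁻ 0 0 (start i) (wd x) p∈
  ...   | q , refl , l , nl = start-≤ i q l , HasInv⁺ w x r q nl
  from : ∀ {j} → (i ℤ.≤ j) × HasInv w j → j ∈ map (λ p → + suc p) (positions 0 0 (start i) (wd x))
  from {j} (l , h) with HasInv⁻ w x r j h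
  ... | q , refl , nl = ∈-map⁺ (λ p → + suc p) (positions⁺ 0 0 (start i) (wd x) q (≤-start i q l) nl)

Λ-unique : ∀ w i {a b} → IsΛ w i a → IsΛ w i b → a ≡ b
Λ-unique w i (xs , ux , mx , refl) (ys , uy , my , refl) =
  ↭-length (∼bag⇒↭ (unique∧set⇒bag ux uy (λ {j} → mk⇔
    (λ h → Equivalence.from (my j) (Equivalence.to (mx j) h))
    (λ h → Equivalence.from (mx j) (Equivalence.to (my j) h)))))

-- Expansions as functions on codes

_≟ᶜ_ : ∀ {n} (x y : Code n) → Dec (x ≡ y)
ε       ≟ᶜ ε       = yes refl
(i ◂ x) ≟ᶜ (j ◂ y) with i Fin.≟ j | x ≟ᶜ y
... | yes refl | yes refl = yes refl
... | no p     | _        = no (λ { refl → p refl })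
... | yes _    | no p     = no (λ { refl → p refl })

point : ∀ {n} → Code n → ℤ → Code n → ℤ
point y c x with x ≟ᶜ y
... | yes _ = c
... | no  _ = 0ℤ

point-≡ : ∀ {n} (y : Code n) c → point y c y ≡ c
point-≡ y c with y ≟ᶜ y
... | yes _ = refl
... | no p  = contradiction refl p

point-≢ : ∀ {n} (y : Code n) c x → x ≢ y → point y c x ≡ 0ℤ
point-≢ y c x p with x ≟ᶜ y
... | yes q = contradiction q p
... | no _  = refl

comb-point : ∀ {n} (y : Code n) c e → comb (point y c) e ≡ c ℤ.* S y e
comb-point {n} y c e = trans (ΣL-single y (enum-unique n) (∈-enum y) (λ x p → *-zeroˡ′ (S x e) (point-≢ y c x p)))
  (cong (ℤ._* S y e) (point-≡ y c))

module Coefficients (N : ℕ) (code : Perm → Code N) where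

  coefficients : List (Perm × ℤ) → Code N → ℤ
  coefficients []            x = 0ℤ
  coefficients ((w , c) ∷ L) x = point (code w) c x ℤ.+ coefficients L x

  Encoded : List (Perm × ℤ) → Set
  Encoded = AllL (λ t → Represents (proj₁ t) (code (proj₁ t)))

  coefficients-zero : ∀ L x → AllL (λ t → x ≢ code (proj₁ t)) L → coefficients L x ≡ 0ℤ
  coefficients-zero []            x _         = refl
  coefficients-zero ((w , c) ∷ L) x (p ∷ᴬ ps) = cong₂ ℤ._+_ (point-≢ (code w) c x p) (coefficients-zero L x ps)

  code-distinct : ∀ {v w} → Represents v (code v) → Represents w (code w) → ¬ (v ≈ₚ w) → code v ≢ code w
  code-distinct rv rw h p = h (λ i → trans (sym (app-eq rv i)) (trans (cong (λ x → at (toList (wd x)) i i) p) (app-eq rw i)))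

  coefficients-∈ : ∀ L → Encoded L → AllPairs (λ a b → ¬ (proj₁ a ≈ₚ proj₁ b)) L → ∀ w c → (w , c) ∈ L → coefficients L (code w) ≡ c
  coefficients-∈ ((w , c) ∷ L) (r ∷ᴬ rs) (d ∷ ds) .w .c (here refl) = trans (cong₂ ℤ._+_ (point-≡ (code w) c)
    (coefficients-zero L (code w) (LAll.tabulate (λ t∈ → code-distinct r (LAll.lookup rs t∈) (LAll.lookup d t∈))))) (ℤₚ.+-identityʳ c)
  coefficients-∈ ((v , b) ∷ L) (r ∷ᴬ rs) (d ∷ ds) w c (there t∈) = trans (cong₂ ℤ._+_
    (point-≢ (code v) b (code w) (λ z → code-distinct r (LAll.lookup rs t∈) (LAll.lookup d t∈) (sym z)))
    (coefficients-∈ L rs ds w c t∈)) (ℤₚ.+-identityˡ c)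

  cf-coefficients : ∀ L → Encoded L → ∀ (m : Vec ℕ N) → cf (sumSchub L) m ≡ comb (coefficients L) m
  cf-coefficients L rs m = trans (cf-sumSchub L m) (go L rs)
    where
    go : ∀ L → Encoded L → ΣL L (λ t → proj₂ t ℤ.* cf (𝔖 (proj₁ t)) m) ≡ comb (coefficients L) m
    go []            _         = sym (ΣL-zero (enum N) (λ x _ → ℤₚ.*-zeroˡ (S x m)))
    go ((w , c) ∷ L) (r ∷ᴬ rs) = trans (cong₂ ℤ._+_ (trans (cong (c ℤ.*_) (cf-eq r m)) (sym (comb-point (code w) c m))) (go L rs))
      (sym (comb-+ (point (code w) c) (coefficients L) m))

ins-injective : ∀ {n} i j {M} {v w : Vec ℕ n} → i ≤ n → j ≤ n → All (_< M) v → All (_< M) w → ins i M v ≡ ins j M w → i ≡ j × v ≡ w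
ins-injective zero    zero    a       b       p        q        refl = refl , refl
ins-injective zero    (suc j) a       (s≤s b) p        (q ∷ qs) h    = contradiction (sym (cong (λ e → ex e 0) h)) (<⇒≢ q)
ins-injective (suc i) zero    (s≤s a) b       (p ∷ ps) q        h    = contradiction (cong (λ e → ex e 0) h) (<⇒≢ p)
ins-injective (suc i) (suc j) (s≤s a) (s≤s b) (_∷_ {x = x} p ps) (_∷_ {x = y} q qs) h with Vecₚ.∷-injective h
... | refl , t with ins-injective i j a b ps qs t
...   | refl , refl = refl , refl

wd-injective : ∀ {n} (x y : Code n) → wd x ≡ wd y → x ≡ y
wd-injective ε       ε       h = refl
wd-injective (i ◂ x) (j ◂ y) h with ins-injective (toℕ i) (toℕ j) (toℕ≤ i) (toℕ≤ j) (wd-< x) (wd-< y) h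
... | p , q = cong₂ _◂_ (toℕ-injective p) (wd-injective x y q)

ex-ext : ∀ {n} (v w : Vec ℕ n) → (∀ q → q < n → ex v q ≡ ex w q) → v ≡ w
ex-ext []      []      h = refl
ex-ext (x ∷ v) (y ∷ w) h = cong₂ _∷_ (h 0 (s≤s z≤n)) (ex-ext v w (λ q l → h (suc q) (s≤s l)))

decode-injective : ∀ {n} (x y : Code n) → decode x ≈ₚ decode y → x ≡ y
decode-injective x y h = wd-injective x y (ex-ext (wd x) (wd y) (λ q l →
  trans (sym (at-ex (wd x) q (suc q) l)) (trans (h (suc q)) (at-ex (wd y) q (suc q) l))))

-- The structure constants of a product

module Pair {N : ℕ} {u v : Perm} {x y : Code N} (rx : Represents u x) (ry : Represents v y) where

  f : Fun N
  f = conv (S x) (S y)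

  cf-f : ∀ e → cf (𝔖 u *ᴾ 𝔖 v) e ≡ f e
  cf-f e = trans (cf-* (𝔖 u) (𝔖 v) e) (conv-cong (cf-eq rx) (cf-eq ry) e)

  X Y : Vec ℕ N
  X = wd x
  Y = wd y

  f-deg : ∀ i → Deg i f (cnt 0 (suc i) X + cnt 0 (suc i) Y)
  f-deg i = conv-deg i (S x) (S y) (Sch-deg (S-Sch x) i) (Sch-deg (S-Sch y) i)

  size≤FSˡ : size x ≤ FS u
  size≤FSˡ = ≤-trans (m≤n⊔m 1 (size x)) (≤-reflexive (sym (FS-size u x rx)))

  size≤FSʳ : size y ≤ FS v
  size≤FSʳ = ≤-trans (m≤n⊔m 1 (size y)) (≤-reflexive (sym (FS-size v y ry)))

  -- If the count a of u at i is positive, then a + i + 1 ≤ FS u, while the count of v is at most FS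
  -- v; likewise with v alone.
  f-box : FS u + FS v ≤ N → Box f
  f-box h e p i i<N = ≤-trans (s≤s (+-monoˡ-≤ i (f-deg i e p))) bound
    where
    a b : ℕ
    a = cnt 0 (suc i) X
    b = cnt 0 (suc i) Y
    bound : a + b + i < N
    bound with a ℕ.≟ 0 | b ℕ.≟ 0
    ... | yes a≡0 | yes b≡0 = subst (_< N) (cong₂ (λ s t → s + t + i) (sym a≡0) (sym b≡0)) i<N
    ... | no a≢0 | _ = ≤-trans (≤-reflexive (trans (cong suc (trans (cong (_+ i) (+-comm a b)) (+-assoc b a i))) (trans (sym (+-suc b (a + i))) (cong (λ s → b + s) (sym (+-suc a i))))))
          (≤-trans (+-mono-≤ b≤ (≤-trans (cnt-size x i (n≢0⇒n>0 a≢0)) size≤FSˡ)) (≤-trans (≤-reflexive (+-comm (FS v) (FS u))) h))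
      where
      b≤ : b ≤ FS v
      b≤ with b ℕ.≟ 0
      ... | yes b≡0 = ≤-trans (≤-reflexive b≡0) z≤n
      ... | no b≢0  = ≤-trans (m≤m+n b (suc i)) (≤-trans (cnt-size y i (n≢0⇒n>0 b≢0)) size≤FSʳ)
    ... | yes a≡0 | no b≢0 = subst (λ s → s + b + i < N) (sym a≡0)
          (≤-trans (≤-reflexive (sym (+-suc b i))) (≤-trans (cnt-size y i (n≢0⇒n>0 b≢0)) (≤-trans size≤FSʳ (≤-trans (m≤n+m (FS v) (FS u)) h))))

  -- As `cnt 0 i` is Λ_{i+1}, this is the term of index i + 1 in the formula, its `- 1` cancelled.
  A : ℕ → ℕ
  A i = cnt 0 i X + cnt 0 i Y + i

-- The first peak

cnt-drop : ∀ {n} N i (w : Vec ℕ n) → i < n → Lr N i w ⊎ cnt N i w ≡ suc (cnt N (suc i) w)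
cnt-drop N zero    (x ∷ w) l with x ℕ.<? N
... | yes p = inj₂ refl
... | no p  = inj₁ (≮⇒≥ p)
cnt-drop N (suc i) (x ∷ w) (s≤s l) = cnt-drop _ i w l

module _ {N : ℕ} (X Y : Vec ℕ (suc N)) where

  private
    A : ℕ → ℕ
    A i = cnt 0 i X + cnt 0 i Y + i

  -- From m to m + 1 the last summand gains 1, and a count loses 1 if m is not a left-to-right
  -- maximum of its word; one loss already prevents a rise. From 0 to 1 there always is a rise, so
  -- the first peak is at some `suc i`.
  rise⇒Lr : ∀ m → m < suc N → A m < A (suc m) → Lr 0 m X × Lr 0 m Y
  rise⇒Lr m l h with cnt-drop 0 m X l | cnt-drop 0 m Y l
  ... | inj₁ p | inj₁ q = p , q
  ... | inj₂ p | _      = contradiction h (≤⇒≯ (≤-trans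
      (≤-reflexive (+-suc (cnt 0 (suc m) X + cnt 0 (suc m) Y) m))
      (+-monoˡ-≤ m (≤-trans (+-monoʳ-≤ (suc (cnt 0 (suc m) X)) (cnt-suc≤ 0 m Y)) (≤-reflexive (cong (_+ cnt 0 m Y) (sym p)))))))
  ... | inj₁ _ | inj₂ q = contradiction h (≤⇒≯ (≤-trans
      (≤-reflexive (trans (+-suc (cnt 0 (suc m) X + cnt 0 (suc m) Y) m) (cong (_+ m) (sym (+-suc (cnt 0 (suc m) X) (cnt 0 (suc m) Y))))))
      (+-monoˡ-≤ m (+-mono-≤ (cnt-suc≤ 0 m X) (≤-reflexive (sym q))))))

  -- At its first maximum the sequence A has just increased, so both words have a left-to-right maximum there.
  peak : ∀ m → m < suc N → ∃ λ i → i ≤ m × (∀ j → j ≤ suc m → A j ≤ A (suc i)) × Lr 0 i X × Lr 0 i Y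
  peak zero l = 0 , z≤n , best , first X , first Y
    where
    first : ∀ (w : Vec ℕ (suc N)) → Lr 0 0 w
    first (_ ∷ _) = z≤n
    first-cnt : ∀ (w : Vec ℕ (suc N)) → cnt 0 0 w ≡ cnt 0 1 w
    first-cnt (x ∷ w) = cong (_+ cnt (suc x) 0 w) (nm-≥ {0} {x} z≤n)
    best : ∀ j → j ≤ 1 → A j ≤ A 1
    best zero       _ = +-mono-≤ (+-mono-≤ (≤-reflexive (first-cnt X)) (≤-reflexive (first-cnt Y))) z≤n
    best (suc zero) _ = ≤-refl
    best (suc (suc j)) (s≤s ())
  peak (suc m) l with peak m (<⇒≤ l)
  ... | i , i≤m , best , lx , ly with A (suc (suc m)) ℕ.≤? A (suc i)
  ...   | yes p = i , m≤n⇒m≤1+n i≤m , best′ , lx , ly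
    where
    best′ : ∀ j → j ≤ suc (suc m) → A j ≤ A (suc i)
    best′ j q with j ℕ.≟ suc (suc m)
    ... | yes refl = p
    ... | no r     = best j (≤-pred (≤∧≢⇒< q r))
  ...   | no p = suc m , ≤-refl , best′ , rise⇒Lr (suc m) l (≤-trans (s≤s (best (suc m) ≤-refl)) (≰⇒> p))
    where
    best′ : ∀ j → j ≤ suc (suc m) → A j ≤ A (suc (suc m))
    best′ j q with j ℕ.≟ suc (suc m)
    ... | yes refl = ≤-refl
    ... | no r     = ≤-trans (best j (≤-pred (≤∧≢⇒< q r))) (<⇒≤ (≰⇒> p))

-- Existence of an expansion

idCode : ∀ n → Code n
idCode zero    = ε
idCode (suc n) = snoc (idCode n)

-- `idCode` is a default for words too long for N letters; `code-represents` excludes it.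
code : ∀ N → Perm → Code N
code N w with length (word w) ℕ.≤? N
... | yes p = proj₁ (represents-≤ w N p)
... | no _  = idCode N

code-represents : ∀ N w → length (word w) ≤ N → Represents w (code N w)
code-represents N w p with length (word w) ℕ.≤? N
... | yes q = proj₂ (represents-≤ w N q)
... | no q  = contradiction p q

InVars-sumSchub : ∀ {N} L → AllL (λ t → InVars N (𝔖 (proj₁ t))) L → InVars N (sumSchub L)
InVars-sumSchub []            _         = []ᴬ
InVars-sumSchub ((w , c) ∷ L) (p ∷ᴬ ps) = LAllₚ.++⁺ (InVars-scale c (𝔖 w) p) (InVars-sumSchub L ps)

-- In N the two lengths make the words fit, and FS u + FS v is the room that `f-box` asks for. The
-- list runs over all codes, zero coefficients included.
expansion : ∀ u v → ∃ λ L → IsSchubertExpansion u v L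
expansion u v with span f (f-box (m≤n+m (FS u + FS v) (length (word u) + length (word v))))
  where
  N : ℕ
  N = length (word u) + length (word v) + (FS u + FS v)
  open Pair (code-represents N u (≤-trans (m≤m+n _ _) (m≤m+n _ _))) (code-represents N v (≤-trans (m≤n+m _ (length (word u))) (m≤m+n _ _)))
... | C , eq = L , distinct ,
    ≈ᴾ-from-cf (𝔖 u *ᴾ 𝔖 v) (sumSchub L) (InVars-* (𝔖 u) (𝔖 v) (inVars ru) (inVars rv))
      (InVars-sumSchub L (LAllₚ.map⁺ (LAll.tabulate (λ {z} _ → inVars (decode-represents z))))) (λ m → trans (cf-f m) (trans (eq m) (sym (sum m))))
  where
  N : ℕ
  N = length (word u) + length (word v) + (FS u + FS v)
  ru : Represents u (code N u)
  ru = code-represents N u (≤-trans (m≤m+n _ _) (m≤m+n _ _))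
  rv : Represents v (code N v)
  rv = code-represents N v (≤-trans (m≤n+m _ (length (word u))) (m≤m+n _ _))
  open Pair ru rv
  L : List (Perm × ℤ)
  L = map (λ z → decode z , C z) (enum N)
  distinct : AllPairs (λ a b → ¬ (proj₁ a ≈ₚ proj₁ b)) L
  distinct = LPairsₚ.map⁺ (LPairs.map (λ {z} {z′} p q → p (decode-injective z z′ q)) (enum-unique N))
  sum : ∀ m → cf (sumSchub L) m ≡ comb C m
  sum m = trans (cf-sumSchub L m) (trans (ΣL-map _ (enum N) _) (ΣL-cong (enum N) (λ z → cong (C z ℤ.*_) (cf-eq (decode-represents z) m))))

-- The largest FS in a given expansion

totalLength : List (Perm × ℤ) → ℕ
totalLength []            = 0
totalLength ((w , _) ∷ L) = length (word w) + totalLength L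

length≤total : ∀ {w c} L → (w , c) ∈ L → length (word w) ≤ totalLength L
length≤total ((w , _) ∷ L) (here refl) = m≤m+n _ _
length≤total ((v , _) ∷ L) (there h)   = ≤-trans (length≤total L h) (m≤n+m _ (length (word v)))

value : ∀ a b k → + a ℤ.+ + b ℤ.+ + suc k ℤ.- + 1 ≡ + (a + b + k)
value a b k rewrite +-suc (a + b) k = refl

module Forward {N′ : ℕ} (code : Perm → Code (suc N′)) {u v : Perm} (ru : Represents u (code u)) (rv : Represents v (code v))
  (L : List (Perm × ℤ)) (encoded : AllL (λ t → Represents (proj₁ t) (code (proj₁ t))) L) (expands : IsSchubertExpansion u v L) where

  N : ℕ
  N = suc N′

  open Pair ru rv
  open Coefficients N code

  C : Code N → ℤ
  C = coefficients L

  f≡sum : ∀ e → f e ≡ cf (sumSchub L) e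
  f≡sum e = trans (sym (cf-f e)) (proj₂ expands (toList e))

  m : ℕ
  m = FS u ⊔ FS v

  FS≤N : ∀ w → Represents w (code w) → FS w ≤ N
  FS≤N w r = ≤-trans (≤-reflexive (FS-size w (code w) r)) (⊔-lub (s≤s z≤n) (size≤ (code w)))

  1≤FS : ∀ w → 1 ≤ FS w
  1≤FS w = m≤m⊔n 1 (lastNonFixed 0 (word w))

  m≡ : suc (m ∸ 1) ≡ m
  m≡ = trans (+-comm 1 (m ∸ 1)) (m∸n+n≡m (≤-trans (1≤FS u) (m≤m⊔n (FS u) (FS v))))

  peaked : ∃ λ i → i ≤ m ∸ 1 × (∀ j → j ≤ suc (m ∸ 1) → A j ≤ A (suc i)) × Lr 0 i X × Lr 0 i Y
  -- Started at m - 1, `peak` covers A 0, ..., A m, which are the indices 1, ..., 1 + m of the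
  -- statement.
  peaked = peak X Y (m ∸ 1) (≤-trans (≤-reflexive m≡) (⊔-lub (FS≤N u ru) (FS≤N v rv)))

  i : ℕ
  i = proj₁ peaked

  i<m : suc i ≤ m
  i<m = ≤-trans (s≤s (proj₁ (proj₂ peaked))) (≤-reflexive m≡)

  M : ℕ
  M = A (suc i)

  A≤M : ∀ j → j ≤ m → A j ≤ M
  A≤M j l = proj₁ (proj₂ (proj₂ peaked)) j (≤-trans l (≤-reflexive (sym m≡)))

  lrX : Lr 0 i X
  lrX = proj₁ (proj₂ (proj₂ (proj₂ peaked)))

  lrY : Lr 0 i Y
  lrY = proj₂ (proj₂ (proj₂ (proj₂ peaked)))

  -- A positive exponent at j needs a positive count in u or v, which puts `suc j` in the range up
  -- to m where M bounds A.
  staircase-f : Staircase M f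
  staircase-f e h j pos = ≤-trans (+-monoˡ-≤ (suc j) (f-deg j e h)) (A≤M (suc j) j<m)
    where
    a b : ℕ
    a = cnt 0 (suc j) X
    b = cnt 0 (suc j) Y
    j<m : suc j ≤ m
    j<m with a ℕ.≟ 0 | b ℕ.≟ 0
    ... | no p | _ = ≤-trans (m≤n+m (suc j) a) (≤-trans (cnt-size (code u) j (n≢0⇒n>0 p)) (≤-trans size≤FSˡ (m≤m⊔n _ _)))
    ... | yes _ | no p = ≤-trans (m≤n+m (suc j) b) (≤-trans (cnt-size (code v) j (n≢0⇒n>0 p)) (≤-trans size≤FSʳ (m≤n⊔m (FS u) _)))
    ... | yes p | yes q = contradiction (≤-trans pos (≤-trans (f-deg j e h) (≤-reflexive (cong₂ _+_ p q)))) λ ()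

  FS≤M : ∀ w c → (w , c) ∈ L → c ≢ 0ℤ → FS w ≤ M
  FS≤M w c w∈ c≢0 = ≤-trans (≤-reflexive (FS-size w (code w) (LAll.lookup encoded w∈)))
    (⊔-lub (≤-trans (s≤s z≤n) (m≤n+m (suc i) _)) (comb-size M C staircase-comb (code w) (λ z → c≢0 (trans (sym (coefficients-∈ L encoded (proj₁ expands) w c w∈)) z))))
    where
    staircase-comb : Staircase M (comb C)
    staircase-comb e h = staircase-f e (λ z → h (trans (sym (cf-coefficients L encoded e)) (trans (sym (f≡sum e)) z)))

  ¬Lr-at-FS : ∀ w k → Represents w (code w) → FS w ≡ suc (suc k) → ¬ Lr 0 (suc k) (wd (code w))
  ¬Lr-at-FS w k r p with ⊔-sel 1 (size (code w))
  ... | inj₁ q = contradiction (trans (sym q) (trans (sym (FS-size w (code w) r)) p)) λ ()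
  ... | inj₂ q = size-¬Lr (code w) (suc k) (trans (sym q) (trans (sym (FS-size w (code w) r)) p))

  m≤peak : ∀ {k} → (∀ j → j ≤ m → A j ≤ A k) → cnt 0 k X + cnt 0 k Y ≡ 0 → m ≤ k
  m≤peak {k} best z = ≤-trans (m≤n+m m _) (≤-trans (best m ≤-refl) (≤-reflexive (cong (_+ k) z)))

  -- With both counts 0 the peak value is `suc k`, while A m is at least m; so `suc k` equals m, the
  -- FS of u or of v. For k > 0 this is the last moved position of that permutation and hence not a
  -- left-to-right maximum.
  peak-value≤1 : ∀ k → suc k ≤ m → (∀ j → j ≤ m → A j ≤ A (suc k)) → Lr 0 k X → Lr 0 k Y →
    cnt 0 (suc k) X + cnt 0 (suc k) Y ≡ 0 → A (suc k) ≤ 1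
  peak-value≤1 zero    _   _    _  _  z = ≤-reflexive (cong (_+ 1) z)
  peak-value≤1 (suc k) k<m best lx ly z with ⊔-sel (FS u) (FS v)
  ... | inj₁ p = contradiction lx (¬Lr-at-FS u k ru (trans (sym p) (≤-antisym (m≤peak best z) k<m)))
  ... | inj₂ p = contradiction ly (¬Lr-at-FS v k rv (trans (sym p) (≤-antisym (m≤peak best z) k<m)))

  -- A monomial E of top degree at i in the product must occur in some `𝔖 w` of the expansion. The
  -- count of w at i is then at least that degree, and `cnt-size` turns this into M ≤ FS w if the
  -- degree is positive.
  attained : ∃ λ w → ∃ λ c → ((w , c) ∈ L) × (¬ c ≡ 0ℤ) × (+ FS w ≡ + M)
  attained with conv-attained (S-Sch (code u)) (S-Sch (code v)) i lrX lrY
  ... | E , fE , exE with ΣL-nonzero L _ (λ z → fE (trans (f≡sum E) (trans (cf-sumSchub L E) z)))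
  ...   | (w , c) , w∈ , h = w , c , w∈ , c≢0 , cong +_ (≤-antisym (FS≤M w c w∈ c≢0) M≤FS)
    where
    c≢0 : c ≢ 0ℤ
    c≢0 = proj₁ (*-nonzero c _ h)
    r : Represents w (code w)
    r = LAll.lookup encoded w∈
    sw : S (code w) E ≢ 0ℤ
    sw z = proj₂ (*-nonzero c _ h) (trans (cf-eq r E) z)
    s≤ : cnt 0 (suc i) X + cnt 0 (suc i) Y ≤ cnt 0 (suc i) (wd (code w))
    s≤ = ≤-trans (≤-reflexive (sym exE)) (Sch-deg (S-Sch (code w)) i E sw)
    M≤FS : M ≤ FS w
    M≤FS with cnt 0 (suc i) X + cnt 0 (suc i) Y ℕ.≟ 0
    ... | yes z = ≤-trans (peak-value≤1 i i<m A≤M lrX lrY z) (1≤FS w)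
    ... | no z  = ≤-trans (+-monoˡ-≤ (suc i) s≤) (≤-trans (cnt-size (code w) i (≤-trans (n≢0⇒n>0 z) s≤))
                    (≤-trans (m≤n⊔m 1 _) (≤-reflexive (sym (FS-size w (code w) r)))))

  isFSPair : IsFSPair L (+ M)
  isFSPair = attained , λ w c w∈ c≢0 → +≤+ (FS≤M w c w∈ c≢0)

  isMaxΛ : IsMaxΛ u v (+ (1 + m)) (+ M)
  -- A at `suc i` is the term of index i + 2, within the bound because `suc i ≤ m`.
  isMaxΛ = (+ suc (suc i) , +≤+ (s≤s i<m) , _ , _ , Λ-exists u (code u) ru (+ suc (suc i)) , Λ-exists v (code v) rv (+ suc (suc i)) , value (cnt 0 (suc i) X) (cnt 0 (suc i) Y) (suc i)) , upper
    where
    -- All indices up to 1 have the same two counts, since positions ≤ 0 carry no inversion, so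
    -- index 1 dominates them.
    early : ∀ I → I ℤ.≤ + 1 → ∀ a b → a ≡ cnt 0 0 X → b ≡ cnt 0 0 Y → + a ℤ.+ + b ℤ.+ I ℤ.- + 1 ℤ.≤ + M
    early I l a b refl refl = ℤₚ.≤-trans (ℤₚ.+-monoˡ-≤ (ℤ.- + 1) (ℤₚ.+-monoʳ-≤ (+ (a + b)) l))
      (ℤₚ.≤-trans (ℤₚ.≤-reflexive (value a b 0)) (+≤+ (A≤M 0 z≤n)))
    upper : ∀ I → I ℤ.≤ + (1 + m) → ∀ a b → IsΛ u I a → IsΛ v I b → + a ℤ.+ + b ℤ.+ I ℤ.- + 1 ℤ.≤ + M
    upper I l a b pa pb with Λ-unique u I pa (Λ-exists u (code u) ru I) | Λ-unique v I pb (Λ-exists v (code v) rv I)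
    upper (+ suc k) (+≤+ (s≤s l)) a b pa pb | refl | refl = ℤₚ.≤-trans (ℤₚ.≤-reflexive (value a b k)) (+≤+ (A≤M k l))
    upper (+ zero)  l a b pa pb | p | q = early (+ zero) (+≤+ z≤n) a b p q
    upper -[1+ k ]  l a b pa pb | p | q = early -[1+ k ] -≤+ a b p q

theorem1p6 : (u v : Perm) →
    (∃ λ L → IsSchubertExpansion u v L) ×
    (∀ (L : List (Σ Perm (λ _ → ℤ))) → IsSchubertExpansion u v L →
    ∃ λ M → IsFSPair L M × IsMaxΛ u v (+ (1 Data.Nat.+ (FS u ⊔ FS v))) M)
theorem1p6 u v = expansion u v , forward
  where
  forward : ∀ (L : List (Σ Perm (λ _ → ℤ))) → IsSchubertExpansion u v L →
    ∃ λ M → IsFSPair L M × IsMaxΛ u v (+ (1 + (FS u ⊔ FS v))) M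
  forward L expands = + M , isFSPair , isMaxΛ
    where
    N : ℕ
    -- The successor is the form that `peak` asks for; the total length makes every word of L fit.
    N = suc (length (word u) + length (word v) + totalLength L)
    open Forward (code N)
      (code-represents N u (m≤n⇒m≤1+n (≤-trans (m≤m+n _ _) (m≤m+n _ _))))
      (code-represents N v (m≤n⇒m≤1+n (≤-trans (m≤n+m _ (length (word u))) (m≤m+n _ _))))
      L (LAll.tabulate (λ {t} t∈ → code-represents N (proj₁ t) (m≤n⇒m≤1+n (≤-trans (length≤total L t∈) (m≤n+m _ _))))) expands
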